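{- Let $R$ be a cut-free jump-free proof-structure of $(\neg\bot\otimes)\mathit{LL}$ such that $R\models\mathsf{ACC}_{\sharp\mathsf w}$, and let $m$ be a non-erasing node of $R$. Then there exists a cut-free sequent calculus proof $\pi$ in $(\neg\bot\otimes)\mathit{LL}$ such that $\pi\mathrel{|\!\!\Rightarrow}\langle R\rangle_{\mathsf w}^{m}$.
   Context: Formulae of $\mathit{MLL}$ (with units): $A::=X\mid \mathbf 1\mid\bot\mid A\otimes A\mid A\wp A$, with $X$ ranging over a countably infinite set of atomic formulae equipped with a fixed-point-free involution $(\cdot)^\bot$, extended to formulae by De Morgan duality ($\mathbf 1$ dual to $\bot$, $\otimes$ dual to $\wp$). The fragment $(\neg\bot\otimes)\mathit{LL}$ is the set of formulae of kind $A$ or $E$ given by $$A::=X\mid\mathbf 1\mid A\otimes A\mid A\wp A\mid A\wp E\mid E\wp A,\qquad E::=\bot\mid E\wp E.$$ Cut-free sequent calculus rules (sequents are finite sequences of formulae of the fragment): axiom $\vdash A,A^\bot$; exchange; $\otimes$ (from $\vdash\Gamma,A$ and $\vdash B,\Delta$ infer $\vdash\Gamma,A\otimes B,\Delta$); $\vdash\mathbf 1$; $\wp$ (from $\vdash\Gamma,A,B$ infer $\vdash\Gamma,A\wp B$); $\bot$ (from $\vdash\Gamma$ infer $\vdash\Gamma,\bot$). Graphs are finite directed graphs (parallel arcs allowed, no loops); an arc is a conclusion of its tail and a premise of its head. A (cut-free) proof-structure (ps) of a fragment is such a graph without directed cycles, with nodes labelled $\mathtt{ax}$ (2 conclusions,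 no premise), $\mathtt 1$ or $\bot$ (1 conclusion, no premise), $\otimes$ or $\wp$ (2 premises ordered as left and right, 1 conclusion), $\bullet$ (1 premise, no conclusion), with a total order on its conclusions (the premises of $\bullet$ nodes), and with arcs typed by formulae of the fragment in the evident way (the conclusions of an $\mathtt{ax}$ node have dual types, the conclusion of a $\mathtt 1$/$\bot$ node has type $\mathbf 1$/$\bot$, the conclusion of a $\otimes$/$\wp$ node has as type the tensor/par of the types of its left and right premises). In addition $R$ comes with a partial jump function $J_R$ from the set $\mathsf w(R)$ of its $\bot$ nodes to the set of its nodes, with domain $\mathrm{dom}(J_R)$. $R$ is jump-total if $\mathrm{dom}(J_R)=\mathsf w(R)$, jump-free if $\mathrm{dom}(J_R)=\emptyset$; $\langle R\rangle$ is $R$ with all jumps removed. A switching $\varphi$ of $R$ maps each $\wp$ node to one of its premises; the switching graph $R^\varphi$ is obtained by redirecting, for each $\wp$ node $n$, the head of the premise other than $\varphi(n)$ to a fresh $\bullet$ node, and adding an arc (jump) from $n$ to $J_R(n)$ for each $n\in\mathrm{dom}(J_R)$. $R\models\mathsf{ACC}_{\sharp\mathsf w}$ means: for every switching $\varphi$, $R^\varphi$ has no undirected cycle and has exactly $\sharp\mathsf w(R)-\sharp\mathrm{dom}(J_R)+1$ connected components. Erasing nodes (inductively): a node is erasing when it is a $\bot$, $\wp$ or $\bullet$ node all of whose premises are conclusions of erasing nodes. Write $n\prec n'$ if there is a non-empty directed path of $R$ from $n$ to $n'$. Let $\mathsf w_\wp(R)$ be the set of $n\in\mathsf w(R)$ for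 which there is a non-erasing $\wp$ node $n_0$ with $n\prec n_0$, and $\mathsf w_{\mathsf e}(R)=\mathsf w(R)\setminus\mathsf w_\wp(R)$. Canonical jumps: $\langle R\rangle_{\mathsf w}^m$ is the jump-total ps with the same underlying jump-free ps $\langle R\rangle$ and with jump function $J$ defined by: for $n\in\mathsf w_\wp(R)$, $J(n)=n'$, where $n_0$ is the $\prec$-least non-erasing $\wp$ node with $n\prec n_0$ and $n'$ is the non-erasing node one of whose conclusions is a premise of $n_0$ (the other premise of $n_0$ being the conclusion of an erasing node); for $n\in\mathsf w_{\mathsf e}(R)$, $J(n)=m$. Relation $\pi\mathrel{|\!\!\Rightarrow}R$ between sequent calculus proofs and jump-total ps, by induction on $\pi$: an axiom (resp. $\mathbf 1$) rule is related to the single $\mathtt{ax}$ (resp. $\mathtt 1$) node with conclusions pointing to $\bullet$ nodes; exchange changes the order of conclusions; if $\pi_1\mathrel{|\!\!\Rightarrow}R_1$ and $\pi$ is $\pi_1$ followed by a $\bot$ rule, then $\pi\mathrel{|\!\!\Rightarrow}R$ for every $R$ obtained from $R_1$ by adding a $\bot$ node $n$ whose conclusion points to a new $\bullet$ node, with jump $J_R(n)$ an arbitrary node of $R_1$ (other jumps as in $R_1$); if $\pi$ is $\pi_1$ followed by a $\wp$ rule (resp. is obtained from $\pi_1,\pi_2$ by a $\otimes$ rule) and $\pi_i\mathrel{|\!\!\Rightarrow}R_i$, then $\pi\mathrel{|\!\!\Rightarrow}R$ where $R$ is obtained from $R_1$ (resp. the disjoint union of $R_1,R_2$) by removing the $\bullet$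 nodes of the two active conclusions (these $\bullet$ nodes not being targets of jumps), making these the left and right premises of a new $\wp$ (resp. $\otimes$) node whose conclusion points to a new $\bullet$ node, and keeping all jumps. -}

module Defs where

open import Data.Bool.Base using (if_then_else_)
open import Data.Bool.Properties using (T?)
open import Data.Fin.Base using (Fin; zero; suc)
import Data.Fin.Properties as Fin
open import Data.Fin.Induction using (spo-wellFounded; spo-noetherian)
open import Data.Fin.Patterns using (0F; 1F; 2F; 3F; 4F; 5F)
open import Data.List.Base using (List; []; _∷_; _++_; length; map)
open import Data.List.Membership.Propositional using (_∈_)
open import Data.List.Relation.Unary.Unique.Propositional using (Unique)
open import Data.Maybe.Base as Maybe using (Maybe; just; nothing; is-just)
import Data.Maybe.Properties as Maybeₚ
open import Data.Nat.Base using (ℕ; _+_; _∸_; _<_; suc; z≤n; s≤s)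
open import Data.Product using (Σ; Σ-syntax; ∃; ∃-syntax; ∃!; _×_; _,_; proj₁; proj₂)
open import Data.Sum.Base as Sum using (_⊎_; inj₁; inj₂; [_,_]′; swap)
import Data.Sum.Properties as Sumₚ
open import Data.Vec.Base using (count; tabulate)
open import Function.Base using (_∘_; flip)
open import Function.Bundles using (_↔_; _⇔_; module Inverse)
open import Function.Definitions using (Surjective)
open import Induction.WellFounded using (WellFounded; Acc; acc; module Subrelation)
open import Relation.Binary.Construct.Closure.Equivalence using (EqClosure)
open import Relation.Binary.Construct.Closure.Transitive using (TransClosure; _∷_)
  renaming (_++_ to _⁺++_; [_] to [_]⁺)
import Relation.Binary.Construct.On as On
open import Relation.Binary.Definitions using (DecidableEquality)
open import Relation.Binary.Structures using (IsStrictPartialOrder)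
open import Relation.Binary.PropositionalEquality
  using (_≡_; _≢_; refl; sym; trans; cong; subst; subst₂; isEquivalence)
open import Relation.Nullary.Decidable using (Dec; yes; no; does; map′; decidable-stable)
open import Relation.Nullary.Negation using (¬_; contradiction)

record Atoms : Set₁ where
  field
    Atom             : Set
    countable        : Atom ↔ ℕ
    _ᵈ               : Atom → Atom
    ᵈ-involutive     : ∀ X → (X ᵈ) ᵈ ≡ X
    ᵈ-fixedPointFree : ∀ X → X ᵈ ≢ X

infixr 7 _⊗_ _⅋_

data Formula (𝒜 : Atoms) : Set where
  atom    : Atoms.Atom 𝒜 → Formula 𝒜
  𝟏 𝐛     : Formula 𝒜                          -- 𝐛 is the unit ⊥
  _⊗_ _⅋_ : Formula 𝒜 → Formula 𝒜 → Formula 𝒜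

module _ {𝒜 : Atoms} where

  infix 8 _^⊥

  _^⊥ : Formula 𝒜 → Formula 𝒜
  atom X  ^⊥ = atom (Atoms._ᵈ 𝒜 X)
  𝟏       ^⊥ = 𝐛
  𝐛       ^⊥ = 𝟏
  (A ⊗ B) ^⊥ = A ^⊥ ⅋ B ^⊥
  (A ⅋ B) ^⊥ = A ^⊥ ⊗ B ^⊥

  data KindE : Formula 𝒜 → Set where
    𝐛   : KindE 𝐛
    _⅋_ : ∀ {E E′} → KindE E → KindE E′ → KindE (E ⅋ E′)

  data KindA : Formula 𝒜 → Set where
    atom : ∀ X → KindA (atom X)
    𝟏    : KindA 𝟏
    _⊗_  : ∀ {A B} → KindA A → KindA B → KindA (A ⊗ B)
    _⅋_  : ∀ {A B} → KindA A → KindA B → KindA (A ⅋ B)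
    _⅋ʳ_ : ∀ {A E} → KindA A → KindE E → KindA (A ⅋ E)
    _⅋ˡ_ : ∀ {E A} → KindE E → KindA A → KindA (E ⅋ A)

  Fragment : Formula 𝒜 → Set
  Fragment F = KindA F ⊎ KindE F

  infix 2 ⊢_

  -- Sequents of the fragment only: the side conditions on the rules
  -- suffice, since a rule without one introduces only 𝟏 or 𝐛.
  data ⊢_ : List (Formula 𝒜) → Set where
    -- The fragment is not closed under _^⊥.
    ax   : ∀ A → Fragment A → Fragment (A ^⊥) → ⊢ A ∷ A ^⊥ ∷ []
    exch : ∀ Γ {A B} Δ → ⊢ Γ ++ A ∷ B ∷ Δ → ⊢ Γ ++ B ∷ A ∷ Δ
    tens : ∀ Γ {A B} Δ → Fragment (A ⊗ B) →
           ⊢ Γ ++ A ∷ [] → ⊢ B ∷ Δ → ⊢ Γ ++ A ⊗ B ∷ Δ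
    one  : ⊢ 𝟏 ∷ []
    par  : ∀ Γ {A B} → Fragment (A ⅋ B) →
           ⊢ Γ ++ A ∷ B ∷ [] → ⊢ Γ ++ A ⅋ B ∷ []
    bot  : ∀ {Γ} → ⊢ Γ → ⊢ Γ ++ 𝐛 ∷ []

record Graph : Set₁ where
  field
    Node Arc  : Set
    tail head : Arc → Node

  Arrow : Node → Node → Set
  Arrow x y = ∃[ a ] tail a ≡ x × head a ≡ y

  Connected : Node → Node → Set
  Connected = EqClosure Arrow

  infix 4 _≺_
  _≺_ : Node → Node → Set
  _≺_ = TransClosure Arrow

  data Walk : Node → Node → List Arc → Set where
    []       : ∀ {x} → Walk x x []
    forward  : ∀ {x y as} a → tail a ≡ x → Walk (head a) y as → Walk x y (a ∷ as)
    backward : ∀ {x y as} a → head a ≡ x → Walk (tail a) y as → Walk x y (a ∷ as)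

  -- A non-empty closed walk without repeated arcs; two parallel arcs or
  -- a loop form a cycle.
  UndirectedCycle : Set
  UndirectedCycle = ∃[ x ] ∃[ a ] ∃[ as ] Walk x x (a ∷ as) × Unique (a ∷ as)

  HasComponents : ℕ → Set
  HasComponents k = Σ[ component ∈ (Node → Fin k) ]
    Surjective _≡_ _≡_ component ×
    (∀ x y → component x ≡ component y ⇔ Connected x y)

data Label : Set where
  ax one bot tens par • : Label

private
  code : Label → Fin 6
  code ax   = 0F
  code one  = 1F
  code bot  = 2F
  code tens = 3F
  code par  = 4F
  code •    = 5F

  decode : Fin 6 → Label
  decode 0F = ax
  decode 1F = one
  decode 2F = bot
  decode 3F = tens
  decode 4F = par
  decode 5F = •

  decode∘code : ∀ l → decode (code l) ≡ l
  decode∘code ax   = refl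
  decode∘code one  = refl
  decode∘code bot  = refl
  decode∘code tens = refl
  decode∘code par  = refl
  decode∘code •    = refl

infix 4 _≟ᴸ_
_≟ᴸ_ : DecidableEquality Label
l ≟ᴸ l′ = map′
  (λ eq → trans (sym (decode∘code l)) (trans (cong decode eq) (decode∘code l′)))
  (cong code) (code l Fin.≟ code l′)

#premises #conclusions : Label → ℕ
#premises ax   = 0
#premises one  = 0
#premises bot  = 0
#premises tens = 2
#premises par  = 2
#premises •    = 1

#conclusions ax   = 2
#conclusions one  = 1
#conclusions bot  = 1
#conclusions tens = 1
#conclusions par  = 1
#conclusions •    = 0

-- The data of a proof-structure; the laws are in ProofStructure.
record Structure (𝒜 : Atoms) : Set₁ where
  field
    graph : Graph

  open Graph graph public

  infix 4 _≟ᴺ_ _≟ᴬ_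

  field
    _≟ᴺ_        : DecidableEquality Node
    _≟ᴬ_        : DecidableEquality Arc
    label       : Node → Label
    type        : Arc → Formula 𝒜
    -- Position of an arc among the premises of its head: for ⊗ and ⅋
    -- nodes, the left premise has index 0 and the right one index 1.
    index       : Arc → ℕ
    conclusions : List Arc
    jump        : Node → Maybe Node   -- nothing outside dom(J), see jump-domain

  data Erasing (n : Node) : Set where
    erasing : label n ≡ bot ⊎ label n ≡ par ⊎ label n ≡ • →
              (∀ a → head a ≡ n → Erasing (tail a)) → Erasing n

  NonErasing⅋ : Node → Set
  NonErasing⅋ n = label n ≡ par × ¬ Erasing n

  w : Node → Set
  w n = label n ≡ bot

  w⅋ : Node → Set
  w⅋ n = w n × ∃[ n₀ ] NonErasing⅋ n₀ × n ≺ n₀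

  wₑ : Node → Set
  wₑ n = w n × ¬ w⅋ n

  JumpFree : Set
  JumpFree = ∀ n → jump n ≡ nothing

  JumpTarget : Node → Set
  JumpTarget t = ∃[ n ] jump n ≡ just t

  ⅋Node : Set
  ⅋Node = Σ[ n ∈ Node ] label n ≡ par

  Switching : Set
  Switching = (n : ⅋Node) → Σ[ a ∈ Arc ] head a ≡ proj₁ n

  module _ (φ : Switching) where

    -- inj₂ n is the fresh • node for the premise of n not chosen by φ.
    switchedHead : Arc → Node ⊎ ⅋Node
    switchedHead a with label (head a) ≟ᴸ par
    ... | no  _ = inj₁ (head a)
    ... | yes p with proj₁ (φ (head a , p)) ≟ᴬ a
    ...   | yes _ = inj₁ (head a)
    ...   | no  _ = inj₂ (head a , p)

    switchingGraph : Graph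
    switchingGraph = record
      { Node = Node ⊎ ⅋Node
      ; Arc  = Arc ⊎ (Σ[ n ∈ Node ] Σ[ t ∈ Node ] jump n ≡ just t)
      ; tail = [ inj₁ ∘ tail , (λ (n , _) → inj₁ n) ]′
      ; head = [ switchedHead , (λ (_ , t , _) → inj₁ t) ]′
      }

record ProofStructure (𝒜 : Atoms) : Set₁ where
  field
    structure : Structure 𝒜

  open Structure structure public

  field
    #nodes #arcs : ℕ
    nodes        : Node ↔ Fin #nodes
    arcs         : Arc ↔ Fin #arcs

    acyclic         : ∀ n → ¬ (n ≺ n)
    index<          : ∀ a → index a < #premises (label (head a))
    premise         : ∀ n i → i < #premises (label n) →
                      ∃! _≡_ λ a → head a ≡ n × index a ≡ i
    conclusionCount : ∀ n → (Σ[ a ∈ Arc ] tail a ≡ n) ↔ Fin (#conclusions (label n))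

    conclusions-unique   : Unique conclusions
    conclusions-complete : ∀ a → a ∈ conclusions ⇔ label (head a) ≡ •

    type-fragment : ∀ a → Fragment (type a)
    type-ax       : ∀ a b → a ≢ b → tail a ≡ tail b → label (tail a) ≡ ax →
                    type b ≡ type a ^⊥
    type-one      : ∀ a → label (tail a) ≡ one → type a ≡ 𝟏
    type-bot      : ∀ a → label (tail a) ≡ bot → type a ≡ 𝐛
    type-tens     : ∀ c l r → label (tail c) ≡ tens →
                    head l ≡ tail c → index l ≡ 0 → head r ≡ tail c → index r ≡ 1 →
                    type c ≡ type l ⊗ type r
    type-par      : ∀ c l r → label (tail c) ≡ par →
                    head l ≡ tail c → index l ≡ 0 → head r ≡ tail c → index r ≡ 1 →
                    type c ≡ type l ⅋ type r

    jump-domain : ∀ n t → jump n ≡ just t → label n ≡ bot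

  #w #dom : ℕ
  #w   = count (λ n → label n ≟ᴸ bot) (tabulate (Inverse.from nodes))
  #dom = count (λ n → T? (is-just (jump n))) (tabulate (Inverse.from nodes))

  ACC#w : Set
  ACC#w = ∀ φ → ¬ Graph.UndirectedCycle (switchingGraph φ) ×
                Graph.HasComponents (switchingGraph φ) (#w ∸ #dom + 1)

  LeastNonErasing⅋Below : Node → Node → Set
  LeastNonErasing⅋Below n n₀ =
    NonErasing⅋ n₀ × n ≺ n₀ ×
    (∀ n₁ → NonErasing⅋ n₁ → n ≺ n₁ → n₀ ≡ n₁ ⊎ n₀ ≺ n₁)

  Canonical⅋Jump : Node → Node → Set
  Canonical⅋Jump n n′ = ∃[ n₀ ] LeastNonErasing⅋Below n n₀ ×
    ∃[ a ] ∃[ b ] head a ≡ n₀ × head b ≡ n₀ ×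
      tail a ≡ n′ × ¬ Erasing n′ × Erasing (tail b)

  -- These conditions determine J, and such a J exists: see canonicalJump.
  record IsCanonicalJump (m : Node) (J : Node → Maybe Node) : Set where
    field
      on-w⅋ : ∀ n → w⅋ n → ∃[ n′ ] Canonical⅋Jump n n′ × J n ≡ just n′
      on-wₑ : ∀ n → wₑ n → J n ≡ just m
      off-w : ∀ n → ¬ w n → J n ≡ nothing

  private
    conclusion-unique : ∀ {n} → #conclusions (label n) ≡ 1 → ∀ {c d} →
                        tail c ≡ n → tail d ≡ n → c ≡ d
    conclusion-unique {n} one≡ {c} {d} tc td =
      cong proj₁ (injective (c , tc) (d , td) (fin1 one≡ _ _))
      where
      open Inverse (conclusionCount n)
      injective : ∀ x y → to x ≡ to y → x ≡ y
      injective x y eq = trans (sym (strictlyInverseʳ x)) (trans (cong from eq) (strictlyInverseʳ y))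
      fin1 : ∀ {k} → k ≡ 1 → (i j : Fin k) → i ≡ j
      fin1 refl zero zero = refl

    ≺-wellFounded : WellFounded _≺_ × WellFounded (flip _≺_)
    ≺-wellFounded = transfer (spo-wellFounded spo) , transfer (spo-noetherian spo)
      where
      open Inverse nodes
      _⊏_ : Fin #nodes → Fin #nodes → Set
      i ⊏ j = from i ≺ from j
      spo : IsStrictPartialOrder _≡_ _⊏_
      spo = record
        { isEquivalence = isEquivalence
        ; irrefl        = λ { {i} refl i⊏i → acyclic (from i) i⊏i }
        ; trans         = _⁺++_
        ; <-resp-≈      = (λ { refl p → p }) , (λ { refl p → p })
        }
      transfer : ∀ {_<_ : Node → Node → Set} →
                 WellFounded (λ i j → from i < from j) → WellFounded _<_
      transfer {_<_} wf = Subrelation.wellFounded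
        (subst₂ _<_ (sym (strictlyInverseʳ _)) (sym (strictlyInverseʳ _)))
        (On.wellFounded to wf)

    all-arcs? : ∀ {P : Arc → Set} → (∀ a → Dec (P a)) → Dec (∀ a → P a)
    all-arcs? {P} P? = map′
      (λ p a → subst P (strictlyInverseʳ a) (p (to a))) (λ p i → p (from i))
      (Fin.all? (λ i → P? (from i)))
      where open Inverse arcs

    erasing? : ∀ n → Dec (Erasing n)
    erasing? n = go n (proj₁ ≺-wellFounded n)
      where
      erasable? : ∀ l → Dec (l ≡ bot ⊎ l ≡ par ⊎ l ≡ •)
      erasable? ax   = no λ { (inj₁ ()) ; (inj₂ (inj₁ ())) ; (inj₂ (inj₂ ())) }
      erasable? one  = no λ { (inj₁ ()) ; (inj₂ (inj₁ ())) ; (inj₂ (inj₂ ())) }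
      erasable? bot  = yes (inj₁ refl)
      erasable? tens = no λ { (inj₁ ()) ; (inj₂ (inj₁ ())) ; (inj₂ (inj₂ ())) }
      erasable? par  = yes (inj₂ (inj₁ refl))
      erasable? •    = yes (inj₂ (inj₂ refl))

      go : ∀ n → Acc _≺_ n → Dec (Erasing n)
      go n (acc rec) with erasable? (label n)
      ... | no ¬l = no λ { (erasing l _) → ¬l l }
      ... | yes l = map′ (erasing l) (λ { (erasing _ ps) → ps }) (all-arcs? premise?)
        where
        premise? : ∀ a → Dec (head a ≡ n → Erasing (tail a))
        premise? a with head a ≟ᴺ n
        ... | no ¬h = yes (λ h → contradiction h ¬h)
        ... | yes h = map′ (λ e _ → e) (λ f → f h) (go (tail a) (rec [ a , refl , h ]⁺))

    premises-of : ∀ n → #premises (label n) ≡ 2 → Σ[ l ∈ Arc ] Σ[ r ∈ Arc ]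
      (head l ≡ n × index l ≡ 0) × (head r ≡ n × index r ≡ 1) ×
      (∀ a → head a ≡ n → a ≡ l ⊎ a ≡ r)
    premises-of n two = l , r , proj₁ (proj₂ pl) , proj₁ (proj₂ pr) , cover
      where
      pl = premise n 0 (subst (0 <_) (sym two) (s≤s z≤n))
      pr = premise n 1 (subst (1 <_) (sym two) (s≤s (s≤s z≤n)))
      l = proj₁ pl
      r = proj₁ pr
      cover : ∀ a → head a ≡ n → a ≡ l ⊎ a ≡ r
      cover a refl with index a in eq | subst (index a <_) two (index< a)
      ... | 0 | _ = inj₁ (sym (proj₂ (proj₂ pl) (refl , eq)))
      ... | 1 | _ = inj₂ (sym (proj₂ (proj₂ pr) (refl , eq)))
      ... | suc (suc _) | s≤s (s≤s ())

    #2 : ∀ {l} → l ≡ tens ⊎ l ≡ par → #premises l ≡ 2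
    #2 (inj₁ refl) = refl
    #2 (inj₂ refl) = refl

    erasing⇒KindE : ∀ c → Erasing (tail c) → KindE (type c)
    erasing⇒KindE c e = go c e refl
      where
      go : ∀ {n} c → Erasing n → tail c ≡ n → KindE (type c)
      go c (erasing (inj₁ b) _) refl = subst KindE (sym (type-bot c b)) 𝐛
      go c (erasing (inj₂ (inj₁ p)) ps) refl
        with l , r , (hl , il) , (hr , ir) , _ ← premises-of (tail c) (#2 (inj₂ p)) =
        subst KindE (sym (type-par c l r p hl il hr ir))
          (go l (ps l hl) refl ⅋ go r (ps r hr) refl)
      go c (erasing (inj₂ (inj₂ b)) _) refl =
        contradiction (Inverse.to (conclusionCount (tail c)) (c , refl))
          (λ i → none b i)
        where
        none : ∀ {l} → l ≡ • → ¬ Fin (#conclusions l)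
        none refl ()

    A∧E : ∀ {F : Formula 𝒜} → KindA F → ¬ KindE F
    A∧E (a ⅋ a′) (e ⅋ e′) = A∧E a e
    A∧E (a ⅋ʳ _) (e ⅋ _)  = A∧E a e
    A∧E (_ ⅋ˡ a) (_ ⅋ e)  = A∧E a e

    ⊗-premises : ∀ {F G : Formula 𝒜} → Fragment (F ⊗ G) → ¬ KindE F × ¬ KindE G
    ⊗-premises (inj₁ (f ⊗ g)) = A∧E f , A∧E g

    below : ∀ {n c x} → #conclusions (label n) ≡ 1 → tail c ≡ n → n ≺ x →
            head c ≡ x ⊎ head c ≺ x
    below one≡ tc [ d , td , hd ]⁺ with refl ← conclusion-unique one≡ tc td = inj₁ hd
    below one≡ tc ((d , td , refl) ∷ p) with refl ← conclusion-unique one≡ tc td = inj₂ p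

    the-conclusion : ∀ {n} → #conclusions (label n) ≡ 1 → ∃[ c ] tail c ≡ n
    the-conclusion {n} one≡ = Inverse.from (conclusionCount n) (subst Fin (sym one≡) zero)

    no-conclusion : ∀ {n} → label n ≡ • → ∀ {x} → ¬ n ≺ x
    no-conclusion {n} l p = none l (Inverse.to (conclusionCount n) (first p))
      where
      first : ∀ {x} → n ≺ x → Σ[ a ∈ Arc ] tail a ≡ n
      first [ a , t , _ ]⁺       = a , t
      first ((a , t , _) ∷ _) = a , t
      none : ∀ {l} → l ≡ • → ¬ Fin (#conclusions l)
      none refl ()

    Search : Node → Set
    Search n = (∃[ n′ ] Canonical⅋Jump n n′) ⊎ ¬ (∃[ n₀ ] NonErasing⅋ n₀ × n ≺ n₀)

    passErasing : ∀ {n} c → #conclusions (label n) ≡ 1 → tail c ≡ n →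
                  Erasing (head c) → Search (head c) → Search n
    passErasing c one≡ refl eh (inj₁ (n′ , n₀ , (ne , p , least) , rest)) =
      inj₁ (n′ , n₀ , (ne , (c , refl , refl) ∷ p , least′) , rest)
      where
      least′ : ∀ n₁ → NonErasing⅋ n₁ → tail c ≺ n₁ → n₀ ≡ n₁ ⊎ n₀ ≺ n₁
      least′ n₁ ne₁ q with below one≡ refl q
      ... | inj₁ refl = contradiction eh (proj₂ ne₁)
      ... | inj₂ q′   = least n₁ ne₁ q′
    passErasing c one≡ refl eh (inj₂ none) = inj₂ λ (n₀ , ne , q) →
      [ (λ { refl → proj₂ ne eh }) , (λ q′ → none (n₀ , ne , q′)) ]′ (below one≡ refl q)

    stopAt⅋ : ∀ {a c} → label (head c) ≡ par → ¬ Erasing (head c) →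
              #conclusions (label (tail c)) ≡ 1 → Erasing (tail c) →
              head a ≡ head c → (∀ x → head x ≡ head c → x ≡ a ⊎ x ≡ c) →
              ∃[ n′ ] Canonical⅋Jump (tail c) n′
    stopAt⅋ {a} {c} p ¬eh one≡ e ha cover =
      tail a , head c ,
      ((p , ¬eh) , [ c , refl , refl ]⁺ , λ n₁ _ q → below one≡ refl q) ,
      a , c , ha , refl , refl , ¬ea , e
      where
      ¬ea : ¬ Erasing (tail a)
      ¬ea ea = ¬eh (erasing (inj₂ (inj₁ p)) λ x hx →
        [ (λ { refl → ea }) , (λ { refl → e }) ]′ (cover x hx))

    stopAt : ∀ {n} c → #conclusions (label n) ≡ 1 → tail c ≡ n → Erasing n →
             ¬ Erasing (head c) → ∀ l → label (head c) ≡ l → ∃[ n′ ] Canonical⅋Jump n n′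
    stopAt c _ refl e ¬eh ax  l with () ← subst (λ l → index c < #premises l) l (index< c)
    stopAt c _ refl e ¬eh one l with () ← subst (λ l → index c < #premises l) l (index< c)
    stopAt c _ refl e ¬eh bot l with () ← subst (λ l → index c < #premises l) l (index< c)
    stopAt c _ refl e ¬eh • l = contradiction (erasing (inj₂ (inj₂ l)) only) ¬eh
      where
      only : ∀ a → head a ≡ head c → Erasing (tail a)
      only a h = subst (Erasing ∘ tail)
        (trans (sym (q (refl , zero-index c l))) (q (h , zero-index a (trans (cong label h) l)))) e
        where
        zero-index : ∀ a → label (head a) ≡ • → index a ≡ 0
        zero-index a l with index a | subst (λ l → index a < #premises l) l (index< a)
        ... | 0 | _ = refl
        ... | suc _ | s≤s ()
        q = proj₂ (proj₂ (premise (head c) 0 (subst (λ l → 0 < #premises l) (sym l) (s≤s z≤n))))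
    stopAt c _ refl e ¬eh tens t
      with d , td ← the-conclusion (cong #conclusions t)
         | l , r , (hl , il) , (hr , ir) , cover ← premises-of (head c) (#2 (inj₁ t)) =
      contradiction (cover c refl) λ
        { (inj₁ refl) → proj₁ ¬E (erasing⇒KindE c e)
        ; (inj₂ refl) → proj₂ ¬E (erasing⇒KindE c e) }
      where
      td′ : ∀ a → head a ≡ head c → head a ≡ tail d
      td′ a h = trans h (sym td)
      ¬E : ¬ KindE (type l) × ¬ KindE (type r)
      ¬E = ⊗-premises (subst Fragment
        (type-tens d l r (trans (cong label td) t) (td′ l hl) il (td′ r hr) ir)
        (type-fragment d))
    stopAt {n} c one≡ refl e ¬eh par p
      with l , r , (hl , il) , (hr , ir) , cover ← premises-of (head c) (#2 (inj₂ p))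
      with cover c refl
    ... | inj₁ refl = stopAt⅋ p ¬eh one≡ e hr (λ x hx → swap (cover x hx))
    ... | inj₂ refl = stopAt⅋ p ¬eh one≡ e hl cover

    search : ∀ n → Erasing n → Search n
    search n = go n (proj₂ ≺-wellFounded n)
      where
      go : ∀ n → Acc (flip _≺_) n → Erasing n → Search n
      step : ∀ {n} → Acc (flip _≺_) n → Erasing n → #conclusions (label n) ≡ 1 → Search n
      step {n} (acc rec) e one≡ with c , refl ← the-conclusion {n} one≡ | erasing? (head c)
      ... | yes eh = passErasing c one≡ refl eh (go (head c) (rec [ c , refl , refl ]⁺) eh)
      ... | no ¬eh = inj₁ (stopAt c one≡ refl e ¬eh _ refl)

      go n a e@(erasing (inj₁ b) _)        = step a e (cong #conclusions b)
      go n a e@(erasing (inj₂ (inj₁ p)) _) = step a e (cong #conclusions p)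
      go n a e@(erasing (inj₂ (inj₂ b)) _) = inj₂ λ (_ , _ , q) → no-conclusion b q

    canonicalAt : ∀ m n → Σ[ j ∈ Maybe Node ]
      (w⅋ n → ∃[ n′ ] Canonical⅋Jump n n′ × j ≡ just n′) ×
      (wₑ n → j ≡ just m) ×
      (¬ w n → j ≡ nothing)
    canonicalAt m n with label n ≟ᴸ bot
    ... | no ¬b = nothing , (λ (b , _) → contradiction b ¬b)
                , (λ (b , _) → contradiction b ¬b) , (λ _ → refl)
    ... | yes b with search n (erasing (inj₁ b) premise-free)
      where
      premise-free : ∀ a → head a ≡ n → Erasing (tail a)
      premise-free a refl with () ← subst (λ l → index a < #premises l) b (index< a)
    ...   | inj₁ (n′ , j@(n₀ , (ne , p , _) , _)) =
            just n′ , (λ _ → n′ , j , refl)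
          , (λ (_ , ¬w⅋) → contradiction (b , n₀ , ne , p) ¬w⅋) , (λ ¬b → contradiction b ¬b)
    ...   | inj₂ none =
            just m , (λ (_ , some) → contradiction some none)
          , (λ _ → refl) , (λ ¬b → contradiction b ¬b)

  canonicalJump : ∀ m → ∃ (IsCanonicalJump m)
  canonicalJump m = proj₁ ∘ canonicalAt m , record
    { on-w⅋ = proj₁ ∘ proj₂ ∘ canonicalAt m
    ; on-wₑ = proj₁ ∘ proj₂ ∘ proj₂ ∘ canonicalAt m
    ; off-w = proj₂ ∘ proj₂ ∘ proj₂ ∘ canonicalAt m
    }

module _ {𝒜 : Atoms} where

  ⟨_⟩ʷ : (R : ProofStructure 𝒜) → ProofStructure.Node R → ProofStructure 𝒜
  ⟨ R ⟩ʷ m = record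
    { structure            = record structure { jump = proj₁ (canonicalJump m) }
    ; nodes                = nodes
    ; arcs                 = arcs
    ; acyclic              = acyclic
    ; index<               = index<
    ; premise              = premise
    ; conclusionCount      = conclusionCount
    ; conclusions-unique   = conclusions-unique
    ; conclusions-complete = conclusions-complete
    ; type-fragment        = type-fragment
    ; type-ax              = type-ax
    ; type-one             = type-one
    ; type-bot             = type-bot
    ; type-tens            = type-tens
    ; type-par             = type-par
    ; jump-domain          = domain
    }
    where
    open ProofStructure R
    domain : ∀ n t → proj₁ (canonicalJump m) n ≡ just t → label n ≡ bot
    domain n t eq = decidable-stable (label n ≟ᴸ bot) λ ¬b →
      contradiction (trans (sym eq) (IsCanonicalJump.off-w (proj₂ (canonicalJump m)) n ¬b)) λ ()

  record _≅_ (S T : Structure 𝒜) : Set where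
    private
      module S = Structure S
      module T = Structure T
    field
      nodes : S.Node ↔ T.Node
      arcs  : S.Arc ↔ T.Arc

    node : S.Node → T.Node
    node = Inverse.to nodes

    arc : S.Arc → T.Arc
    arc = Inverse.to arcs

    field
      tail        : ∀ a → T.tail (arc a) ≡ node (S.tail a)
      head        : ∀ a → T.head (arc a) ≡ node (S.head a)
      label       : ∀ n → T.label (node n) ≡ S.label n
      type        : ∀ a → T.type (arc a) ≡ S.type a
      index       : ∀ a → T.index (arc a) ≡ S.index a
      conclusions : T.conclusions ≡ map arc S.conclusions
      jump        : ∀ n → T.jump (node n) ≡ Maybe.map node (S.jump n)

  axiomStructure : Formula 𝒜 → Structure 𝒜
  axiomStructure A = record
    { graph       = record
        { Node = Fin 3
        ; Arc  = Fin 2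
        ; tail = λ _ → 0F
        ; head = suc
        }
    ; _≟ᴺ_        = Fin._≟_
    ; _≟ᴬ_        = Fin._≟_
    ; label       = λ { 0F → ax ; 1F → • ; 2F → • }
    ; type        = λ { 0F → A ; 1F → A ^⊥ }
    ; index       = λ _ → 0
    ; conclusions = 0F ∷ 1F ∷ []
    ; jump        = λ _ → nothing
    }

  oneStructure : Structure 𝒜
  oneStructure = record
    { graph       = record
        { Node = Fin 2
        ; Arc  = Fin 1
        ; tail = λ _ → 0F
        ; head = λ _ → 1F
        }
    ; _≟ᴺ_        = Fin._≟_
    ; _≟ᴬ_        = Fin._≟_
    ; label       = λ { 0F → one ; 1F → • }
    ; type        = λ _ → 𝟏
    ; index       = λ _ → 0
    ; conclusions = 0F ∷ []
    ; jump        = λ _ → nothing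
    }

  -- inj₂ 0F is the new ⊥ node, inj₂ 1F the new • node, nothing the new arc.
  addBot : (S : Structure 𝒜) → Structure.Node S → Structure 𝒜
  addBot S t = record
    { graph       = record
        { Node = Node ⊎ Fin 2
        ; Arc  = Maybe Arc
        ; tail = Maybe.maybe′ (inj₁ ∘ tail) (inj₂ 0F)
        ; head = Maybe.maybe′ (inj₁ ∘ head) (inj₂ 1F)
        }
    ; _≟ᴺ_        = Sumₚ.≡-dec _≟ᴺ_ Fin._≟_
    ; _≟ᴬ_        = Maybeₚ.≡-dec _≟ᴬ_
    ; label       = λ { (inj₁ n) → label n ; (inj₂ 0F) → bot ; (inj₂ 1F) → • }
    ; type        = Maybe.maybe′ type 𝐛
    ; index       = Maybe.maybe′ index 0
    ; conclusions = map just conclusions ++ nothing ∷ []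
    ; jump        = λ { (inj₁ n) → Maybe.map inj₁ (jump n)
                      ; (inj₂ 0F) → just (inj₁ t)
                      ; (inj₂ 1F) → nothing }
    }
    where open Structure S

  _⊎ˢ_ : Structure 𝒜 → Structure 𝒜 → Structure 𝒜
  S ⊎ˢ T = record
    { graph       = record
        { Node = S.Node ⊎ T.Node
        ; Arc  = S.Arc ⊎ T.Arc
        ; tail = Sum.map S.tail T.tail
        ; head = Sum.map S.head T.head
        }
    ; _≟ᴺ_        = Sumₚ.≡-dec S._≟ᴺ_ T._≟ᴺ_
    ; _≟ᴬ_        = Sumₚ.≡-dec S._≟ᴬ_ T._≟ᴬ_
    ; label       = [ S.label , T.label ]′
    ; type        = [ S.type , T.type ]′
    ; index       = [ S.index , T.index ]′
    ; conclusions = map inj₁ S.conclusions ++ map inj₂ T.conclusions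
    ; jump        = [ Maybe.map inj₁ ∘ S.jump , Maybe.map inj₂ ∘ T.jump ]′
    }
    where
    module S = Structure S
    module T = Structure T

  module _ (S : Structure 𝒜) (l r : Structure.Arc S) where
    open Structure S

    Remaining : Set
    Remaining = Σ[ n ∈ Node ] n ≢ head l × n ≢ head r

    private
      _≟ᴿ_ : DecidableEquality Remaining
      (n , _) ≟ᴿ (n′ , _) = map′ (λ { refl → refl }) (cong proj₁) (n ≟ᴺ n′)

    -- inj₂ 0F is the new binary node, inj₂ 1F the new • node.  Redirecting
    -- along remap sends exactly the arcs that pointed to the removed
    -- nodes head l and head r, namely l and r, to the new binary node.
    remap : Node → Remaining ⊎ Fin 2
    remap n with n ≟ᴺ head l | n ≟ᴺ head r
    ... | no n≢l | no n≢r = inj₁ (n , n≢l , n≢r)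
    ... | _      | _      = inj₂ 0F

    -- Replaces the conclusions l and r, which must be the ones between
    -- those in cs and ds, by the conclusion of a new binary node.
    joinWith : Label → (Formula 𝒜 → Formula 𝒜 → Formula 𝒜) →
               List Arc → List Arc → Structure 𝒜
    joinWith ℓ _∙_ cs ds = record
      { graph       = record
          { Node = Remaining ⊎ Fin 2
          ; Arc  = Maybe Arc
          ; tail = Maybe.maybe′ (remap ∘ tail) (inj₂ 0F)
          ; head = Maybe.maybe′ (remap ∘ head) (inj₂ 1F)
          }
      ; _≟ᴺ_        = Sumₚ.≡-dec _≟ᴿ_ Fin._≟_
      ; _≟ᴬ_        = Maybeₚ.≡-dec _≟ᴬ_
      ; label       = λ { (inj₁ (n , _)) → label n ; (inj₂ 0F) → ℓ ; (inj₂ 1F) → • }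
      ; type        = Maybe.maybe′ type (type l ∙ type r)
      ; index       = Maybe.maybe′
          (λ a → if does (a ≟ᴬ l) then 0 else if does (a ≟ᴬ r) then 1 else index a) 0
      ; conclusions = map just cs ++ nothing ∷ map just ds
      ; jump        = λ { (inj₁ (n , _)) → Maybe.map remap (jump n) ; (inj₂ _) → nothing }
      }

  withConclusions : (S : Structure 𝒜) → List (Structure.Arc S) → Structure 𝒜
  withConclusions S cs = record S { conclusions = cs }

  infix 4 _|⇒_

  -- The laws of proof-structures and jump-totality are preserved by every
  -- constructor, so they are not imposed on the structures below.
  data _|⇒_ : ∀ {Γ} → ⊢ Γ → Structure 𝒜 → Set₁ where

    -- Proof-structures are considered up to renaming of nodes and arcs.
    iso : ∀ {Γ} {π : ⊢ Γ} {S T} → π |⇒ S → S ≅ T → π |⇒ T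

    ax : ∀ A f f^⊥ → ax A f f^⊥ |⇒ axiomStructure A

    one : one |⇒ oneStructure

    exch : ∀ {Γ A B Δ} {π : ⊢ Γ ++ A ∷ B ∷ Δ} {S} → π |⇒ S →
           ∀ cs a b ds → length cs ≡ length Γ →
           Structure.conclusions S ≡ cs ++ a ∷ b ∷ ds →
           exch Γ Δ π |⇒ withConclusions S (cs ++ b ∷ a ∷ ds)

    bot : ∀ {Γ} {π : ⊢ Γ} {S} → π |⇒ S → ∀ t → bot π |⇒ addBot S t

    par : ∀ {Γ A B} {f : Fragment (A ⅋ B)} {π : ⊢ Γ ++ A ∷ B ∷ []} {S} → π |⇒ S →
          ∀ cs a b → Structure.conclusions S ≡ cs ++ a ∷ b ∷ [] →
          ¬ Structure.JumpTarget S (Structure.head S a) →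
          ¬ Structure.JumpTarget S (Structure.head S b) →
          par Γ f π |⇒ joinWith S a b par _⅋_ cs []

    tens : ∀ {Γ A B Δ} {f : Fragment (A ⊗ B)} {π : ⊢ Γ ++ A ∷ []} {ρ : ⊢ B ∷ Δ} {S T} →
           π |⇒ S → ρ |⇒ T →
           ∀ cs a b ds →
           Structure.conclusions S ≡ cs ++ a ∷ [] →
           Structure.conclusions T ≡ b ∷ ds →
           ¬ Structure.JumpTarget S (Structure.head S a) →
           ¬ Structure.JumpTarget T (Structure.head T b) →
           tens Γ Δ f π ρ |⇒
             joinWith (S ⊎ˢ T) (inj₁ a) (inj₂ b) tens _⊗_ (map inj₁ cs) (map inj₂ ds)

{-# OPTIONS --safe #-}
-- Call a node core if it is neither erasing nor a • node.  Core nodes are grouped into classes, each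
-- either a sequentialized upward-closed block or a single ⊗ or ⅋ node; initially the blocks are the ax
-- and 1 nodes.  A ⊗ node whose premises leave two blocks merges them (one block would give a switching
-- cycle); a ⅋ node all of whose core premises leave one block is absorbed by it, after the erasing
-- trees above it have been added with their canonical jumps.  Suppose neither is possible.  A block
-- without premise of a pending ⊗ node can be isolated by a switching, so by connectedness it contains
-- all core nodes; the remaining ⊥ nodes may then jump to m.  If there is no such block, every
-- class picks an arc of its own (a block: one into a pending ⊗ node; a pending ⊗ node: a premise
-- leaving a pending node; a ⅋ node: its selected premise), and k arcs between k classes close a cycle.
module Submission where

open import Defs
open import Axiom.UniquenessOfIdentityProofs.WithK using (uip)
open import Data.Bool.Base using (Bool; T; _∨_; if_then_else_)
import Data.Bool.Properties as Bool
open import Data.Bool.Properties using (T?; T-∨)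
open import Data.Empty using (⊥)
open import Data.Fin.Base using (Fin; zero; suc; punchIn; punchOut)
open import Data.Fin.Induction using (spo-wellFounded; spo-noetherian)
open import Data.Fin.Patterns using (0F; 1F; 2F)
import Data.Fin.Properties as Fin
open import Data.List.Base using (List; []; _∷_; _++_; map; length; allFin)
open import Data.List.Membership.DecPropositional using (_∈?_)
open import Data.List.Membership.Propositional using (_∈_; _∉_)
open import Data.List.Membership.Propositional.Properties
  using (∈-map⁺; ∈-map⁻; ∈-++⁺ˡ; ∈-++⁺ʳ; ∈-++⁻; ∈-∃++; ∈-allFin)
open import Data.List.Membership.Propositional.Properties.WithK using (unique∧set⇒bag)
open import Data.List.Properties
  using (map-++; map-∘; map-cong; map-id; length-map; length-tabulate; ++-assoc; ++-identityʳ)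
open import Data.List.Relation.Binary.BagAndSetEquality using (∼bag⇒↭)
open import Data.List.Relation.Binary.Permutation.Propositional as ↭
  using (_↭_; ↭-sym; ↭-prep; ↭-trans; ↭-reflexive; ↭⇒↭ₛ)
open import Data.List.Relation.Binary.Permutation.Propositional.Properties
  using (shift; ∈-resp-↭; ++-comm; map⁺)
import Data.List.Relation.Binary.Permutation.Setoid.Properties as Perm
open import Data.List.Relation.Unary.All as All using (All; []; _∷_)
import Data.List.Relation.Unary.All.Properties as Allₚ
open import Data.List.Relation.Unary.AllPairs using ([]; _∷_)
open import Data.List.Relation.Unary.Any using (here; there)
open import Data.List.Relation.Unary.Unique.Propositional using (Unique)
import Data.List.Relation.Unary.Unique.Propositional.Properties as Uniqueₚ
open import Data.Maybe.Base as Maybe using (Maybe; just; nothing)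
import Data.Maybe.Properties as Maybeₚ
open import Data.Maybe.Properties using (just-injective)
open import Data.Nat.Base using (ℕ; zero; suc; _+_; _∸_; _<_; _≤_; z≤n; s≤s; s≤s⁻¹)
open import Data.Nat.Induction using (<-wellFounded)
import Data.Nat.Properties as ℕ
open import Data.Product using (Σ; Σ-syntax; ∃; ∃-syntax; _×_; _,_; proj₁; proj₂)
open import Data.Product.Properties using (Σ-≡,≡→≡)
open import Data.Sum.Base as Sum using (_⊎_; inj₁; inj₂; [_,_]′)
import Data.Sum.Properties as Sumₚ
open import Data.Sum.Properties using (inj₁-injective; inj₂-injective)
open import Data.Vec.Base using (Vec; []; _∷_; count; lookup; tabulate)
open import Data.Vec.Properties using (lookup∘tabulate)
open import Function.Base using (_∘_; id; const; flip)
open import Function.Bundles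
  using (_↔_; mk↔ₛ′; mk⇔; module Inverse; module Equivalence)
open import Induction.WellFounded using (WellFounded; Acc; acc; module Subrelation)
open import Relation.Binary.Construct.Closure.Equivalence as EqC using (EqClosure)
open import Relation.Binary.Construct.Closure.ReflexiveTransitive
  using (_◅_; _◅◅_) renaming (ε to ε⋆)
open import Relation.Binary.Construct.Closure.Symmetric using (fwd; bwd)
open import Relation.Binary.Construct.Closure.Transitive using (_∷_)
  renaming (_++_ to _⁺++_; [_] to [_]⁺)
import Relation.Binary.Construct.On as On
open import Relation.Binary.Definitions using (DecidableEquality)
open import Relation.Binary.PropositionalEquality
open import Relation.Binary.Structures using (IsStrictPartialOrder)
open import Relation.Nullary.Decidable
  using (Dec; yes; no; does; map′; ⌊_⌋; ¬?; _⊎-dec_; _×-dec_; _→-dec_;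
         decidable-stable; toWitness; fromWitness)
open import Relation.Nullary.Negation using (¬_; contradiction)

-- Trails and forests

-- The obstacle is that a ⊥ rule fixes its jump when it is applied, so the target must already be
-- present. Every block therefore carries the final jumps `J` from the start, and an erasing tree
-- enters a block only once the targets of its ⊥ nodes are there: when the ⅋ node below it is
-- absorbed, or at the very end. At an absorbed ⅋ node the canonical target is the tail of its core
-- premise, which lies in the absorbing block. No erasing tree is ever due at a ⊗ node: in the
-- fragment its premises have kind A, whereas conclusions of erasing nodes have kind E.
-- Connectedness enters through the bound `#w + 1` on the number of components. If every non-erasing
-- ⅋ node keeps a non-erasing premise, the ⊥ nodes lie in `#w` different components without core
-- nodes, so one component is left for all core nodes. Acyclicity is needed for a single switching
-- `φ₀` only. Since each class is connected in its switching graph, classes act as vertices, and a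
-- forest on `k` vertices has fewer than `k` arcs.

record Merge {k : ℕ} (S : Fin k → Set) : Set where
  field
    {k′} : ℕ
    k′<k : k′ < k
    μ    : Fin k → Fin k′
    σ    : Fin k′ → Fin k
    μ∘σ  : ∀ i → μ (σ i) ≡ i
    μ-≡  : ∀ {x y} → μ x ≡ μ y → x ≡ y ⊎ (S x × S y)
    μ-S  : ∀ {x y} → S x → S y → μ x ≡ μ y

merge₂ : ∀ {k} {i j : Fin k} → i ≢ j → Merge (λ x → x ≡ i ⊎ x ≡ j)
merge₂ {suc k} {i} {j} i≢j = record
  { k′<k = ℕ.≤-refl ; μ = μ ; σ = punchIn j ; μ∘σ = μ∘σ ; μ-≡ = μ-≡
  ; μ-S = λ p q → trans (merged p) (sym (merged q)) }
  where
  j≢i : j ≢ i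
  j≢i = i≢j ∘ sym

  μ : Fin (suc k) → Fin k
  μ x with j Fin.≟ x
  ... | yes _  = punchOut j≢i
  ... | no j≢x = punchOut j≢x

  μ∘σ : ∀ x → μ (punchIn j x) ≡ x
  μ∘σ x with j Fin.≟ punchIn j x
  ... | yes p = contradiction (sym p) (Fin.punchInᵢ≢i j x)
  ... | no p  = trans (Fin.punchOut-cong j refl) (Fin.punchOut-punchIn j)

  merged : ∀ {x} → x ≡ i ⊎ x ≡ j → μ x ≡ punchOut j≢i
  merged {x} p with j Fin.≟ x | p
  ... | yes _ | _ = refl
  ... | no j≢x | inj₁ x≡i = Fin.punchOut-cong j x≡i
  ... | no j≢x | inj₂ x≡j = contradiction (sym x≡j) j≢x

  μ-≡ : ∀ {x y} → μ x ≡ μ y → x ≡ y ⊎ ((x ≡ i ⊎ x ≡ j) × (y ≡ i ⊎ y ≡ j))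
  μ-≡ {x} {y} eq with j Fin.≟ x | j Fin.≟ y
  ... | yes p | yes q = inj₁ (trans (sym p) q)
  ... | yes p | no q  = inj₂ (inj₂ (sym p) , inj₁ (sym (Fin.punchOut-injective j≢i q eq)))
  ... | no p  | yes q = inj₂ (inj₁ (Fin.punchOut-injective p j≢i eq) , inj₂ (sym q))
  ... | no p  | no q  = inj₁ (Fin.punchOut-injective p q eq)

-- The ⊗ step contracts three classes at once: two blocks and the ⊗ node between them.
merge₃ : ∀ {k} {i j l : Fin k} → i ≢ j → i ≢ l → j ≢ l →
         Merge (λ x → x ≡ i ⊎ x ≡ j ⊎ x ≡ l)
merge₃ {k} {i} {j} {l} i≢j i≢l j≢l = record
  { k′<k = ℕ.<-trans M₂.k′<k M₁.k′<k
  ; μ    = M₂.μ ∘ M₁.μ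
  ; σ    = M₁.σ ∘ M₂.σ
  ; μ∘σ  = λ x → trans (cong M₂.μ (M₁.μ∘σ _)) (M₂.μ∘σ x)
  ; μ-≡  = μ-≡
  ; μ-S  = λ p q → trans (merged p) (sym (merged q))
  }
  where
  module M₁ = Merge (merge₂ i≢j)
  l∉ : ∀ {x} → x ≡ i ⊎ x ≡ j → M₁.μ x ≢ M₁.μ l
  l∉ p eq with M₁.μ-≡ eq | p
  ... | inj₁ x≡l | inj₁ x≡i = i≢l (trans (sym x≡i) x≡l)
  ... | inj₁ x≡l | inj₂ x≡j = j≢l (trans (sym x≡j) x≡l)
  ... | inj₂ (_ , inj₁ l≡i) | _ = i≢l (sym l≡i)
  ... | inj₂ (_ , inj₂ l≡j) | _ = j≢l (sym l≡j)
  module M₂ = Merge (merge₂ (l∉ (inj₁ refl)))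

  S : Fin k → Set
  S x = x ≡ i ⊎ x ≡ j ⊎ x ≡ l

  preimage : ∀ {x} → M₁.μ x ≡ M₁.μ i ⊎ M₁.μ x ≡ M₁.μ l → S x
  preimage (inj₁ eq) with M₁.μ-≡ eq
  ... | inj₁ p              = inj₁ p
  ... | inj₂ (inj₁ p , _)   = inj₁ p
  ... | inj₂ (inj₂ p , _)   = inj₂ (inj₁ p)
  preimage (inj₂ eq) with M₁.μ-≡ eq
  ... | inj₁ p              = inj₂ (inj₂ p)
  ... | inj₂ (inj₁ p , _)   = inj₁ p
  ... | inj₂ (inj₂ p , _)   = inj₂ (inj₁ p)

  μ-≡ : ∀ {x y} → M₂.μ (M₁.μ x) ≡ M₂.μ (M₁.μ y) → x ≡ y ⊎ (S x × S y)
  μ-≡ eq with M₂.μ-≡ eq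
  ... | inj₂ (p , q) = inj₂ (preimage p , preimage q)
  ... | inj₁ eq′ with M₁.μ-≡ eq′
  ...   | inj₁ x≡y = inj₁ x≡y
  ...   | inj₂ (p , q) = inj₂ ([ inj₁ , inj₂ ∘ inj₁ ]′ p , [ inj₁ , inj₂ ∘ inj₁ ]′ q)

  merged : ∀ {x} → S x → M₂.μ (M₁.μ x) ≡ M₂.μ (M₁.μ i)
  merged (inj₁ refl)        = refl
  merged (inj₂ (inj₁ refl)) = cong M₂.μ (M₁.μ-S (inj₂ refl) (inj₁ refl))
  merged (inj₂ (inj₂ refl)) = M₂.μ-S (inj₂ refl) (inj₁ refl)

module Trails (G : Graph) (_≟_ : DecidableEquality (Graph.Arc G)) where
  open Graph G

  Via : (Arc → Set) → Node → Node → Set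
  Via P x y = ∃[ a ] P a × tail a ≡ x × head a ≡ y

  Linked : (Arc → Set) → Node → Node → Set
  Linked P = EqClosure (Via P)

  linked-map : ∀ {P Q} → (∀ {a} → P a → Q a) → ∀ {x y} → Linked P x y → Linked Q x y
  linked-map f = EqC.map (λ (a , p , ts) → a , f p , ts)

  Ends : Arc → Node → Node → Set
  Ends a x y = (tail a ≡ x × head a ≡ y) ⊎ (head a ≡ x × tail a ≡ y)

  step : ∀ {a x y z as} → Ends a x y → Walk y z as → Walk x z (a ∷ as)
  step (inj₁ (t , refl)) p = forward _ t p
  step (inj₂ (h , refl)) p = backward _ h p

  Trail : (Arc → Set) → Node → Node → Set
  Trail P x y = ∃[ as ] Walk x y as × Unique as × All P as

  cut : ∀ {P : Arc → Set} {a x y as} → a ∈ as → Walk x y as → Unique as → All P as →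
        Σ[ z ∈ Node ] Σ[ bs ∈ List Arc ] (tail a ≡ z ⊎ head a ≡ z) ×
          Walk z y bs × Unique (a ∷ bs) × All P (a ∷ bs)
  cut (here refl) (forward a t p)  u ps = _ , _ , inj₂ refl , p , u , ps
  cut (here refl) (backward a h p) u ps = _ , _ , inj₁ refl , p , u , ps
  cut (there i) (forward a t p)  (_ ∷ u) (_ ∷ ps) = cut i p u ps
  cut (there i) (backward a h p) (_ ∷ u) (_ ∷ ps) = cut i p u ps

  -- If `a` already occurs, `cut` keeps what follows that occurrence. The rest starts at one end of
  -- `a`: from `x` it is taken as it is, from `y` it is preceded by `a`, which is then used only
  -- once.
  tidy : ∀ {P a x y z} → Ends a x y → P a → Trail P y z → Trail P x z
  tidy {a = a} e pa (as , p , u , ps) with _∈?_ _≟_ a as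
  ... | no a∉ = a ∷ as , step e p , Allₚ.¬Any⇒All¬ as a∉ ∷ u , pa ∷ ps
  ... | yes i with cut i p u ps | e
  ...   | _ , bs , inj₁ refl , q , v ∷ u′ , qs′ ∷ qs | inj₁ (refl , _)  = bs , q , u′ , qs
  ...   | _ , bs , inj₂ refl , q , us , qs           | inj₁ (t , refl)  = a ∷ bs , step e q , us , qs
  ...   | _ , bs , inj₂ refl , q , v ∷ u′ , qs′ ∷ qs | inj₂ (refl , _)  = bs , q , u′ , qs
  ...   | _ , bs , inj₁ refl , q , us , qs           | inj₂ (h , refl)  = a ∷ bs , step e q , us , qs

  trail : ∀ {P x y} → Linked P x y → Trail P x y
  trail ε⋆ = [] , [] , [] , []
  trail (fwd (a , p , t , h) ◅ l) = tidy (inj₁ (t , h)) p (trail l)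
  trail (bwd (a , p , t , h) ◅ l) = tidy (inj₂ (h , t)) p (trail l)

  closeCycle : ∀ {P a} → ¬ P a → Linked P (tail a) (head a) → UndirectedCycle
  closeCycle {P} {a} ¬pa l with as , p , u , ps ← trail l =
    head a , a , as , backward a refl p ,
    All.map (λ pb a≡b → ¬pa (subst P (sym a≡b) pb)) ps ∷ u

  -- Union-find: each arc of as either closes a cycle or joins two of the k classes of cl.
  tooManyArcs : ∀ {V : Set} (v : V → Node) (as : List Arc) {k} (cl : V → Fin k) {P : Arc → Set} →
    (∀ x y → cl x ≡ cl y → Linked P (v x) (v y)) →
    Unique as → All (¬_ ∘ P) as →
    All (λ a → ∃[ x ] ∃[ y ] v x ≡ tail a × v y ≡ head a) as →
    k ≤ length as → V → UndirectedCycle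
  tooManyArcs v [] {suc k} cl conn u new ends () x₀
  -- No arcs are left, so `k` is 0; but `x₀` belongs to some class.
  tooManyArcs v [] {0} cl conn u new ends k≤ x₀ with () ← cl x₀
  tooManyArcs {V} v (a ∷ as) {k} cl {P} conn (a∉as ∷ u) (¬pa ∷ new) ((x , y , tx , hy) ∷ ends) k≤ x₀
    with cl x Fin.≟ cl y
  ... | yes eq = closeCycle ¬pa (subst₂ (Linked P) tx hy (conn x y eq))
  ... | no x≢y = tooManyArcs v as (M.μ ∘ cl) {P′} conn′ u
        (All.zipWith (λ (¬p , a≢b) → [ ¬p , a≢b ∘ sym ]′) (new , a∉as)) ends (s≤s⁻¹ (ℕ.≤-trans M.k′<k k≤)) x₀
    where
    module M = Merge (merge₂ x≢y)
    P′ : Arc → Set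
    P′ b = P b ⊎ b ≡ a
    old : ∀ z w → cl z ≡ cl w → Linked P′ (v z) (v w)
    old z w eq = linked-map inj₁ (conn z w eq)
    x~y : Linked P′ (v x) (v y)
    x~y = fwd (a , inj₂ refl , sym tx , sym hy) ◅ ε⋆
    conn′ : ∀ z w → M.μ (cl z) ≡ M.μ (cl w) → Linked P′ (v z) (v w)
    conn′ z w eq with M.μ-≡ eq
    ... | inj₁ eq′ = old z w eq′
    ... | inj₂ (inj₁ p , inj₁ q) = old z w (trans p (sym q))
    ... | inj₂ (inj₂ p , inj₂ q) = old z w (trans p (sym q))
    ... | inj₂ (inj₁ p , inj₂ q) = old z x p ◅◅ x~y ◅◅ old y w (sym q)
    ... | inj₂ (inj₂ p , inj₁ q) = old z y p ◅◅ EqC.symmetric _ x~y ◅◅ old x w (sym q)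

-- Nodes and arcs of a proof-structure

module _ {A : Set} {n} (A↔ : A ↔ Fin n) {P : A → Set} (P? : ∀ a → Dec (P a)) where
  open Inverse A↔

  finite-all? : Dec (∀ a → P a)
  finite-all? = map′ (λ p a → subst P (strictlyInverseʳ a) (p (to a))) (λ p → p ∘ from)
    (Fin.all? (P? ∘ from))

  finite-any? : Dec (∃ P)
  finite-any? = map′ (λ (i , p) → from i , p)
    (λ (a , p) → to a , subst P (sym (strictlyInverseʳ a)) p) (Fin.any? (P? ∘ from))

A∧E : ∀ {𝒜} {F : Formula 𝒜} → KindA F → ¬ KindE F
A∧E (a ⅋ _)  (e ⅋ _) = A∧E a e
A∧E (a ⅋ʳ _) (e ⅋ _) = A∧E a e
A∧E (_ ⅋ˡ a) (_ ⅋ e) = A∧E a e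

module Basics {𝒜 : Atoms} (R : ProofStructure 𝒜) where
  open ProofStructure R public

  private
    wellFounded : WellFounded _≺_ × WellFounded (flip _≺_)
    wellFounded = transfer (spo-wellFounded spo) , transfer (spo-noetherian spo)
      where
      open Inverse nodes
      spo : IsStrictPartialOrder _≡_ (λ i j → from i ≺ from j)
      spo = record
        { isEquivalence = isEquivalence
        ; irrefl        = λ { {i} refl → acyclic (from i) }
        ; trans         = _⁺++_
        ; <-resp-≈      = (λ { refl p → p }) , (λ { refl p → p })
        }
      transfer : ∀ {_<_ : Node → Node → Set} →
                 WellFounded (λ i j → from i < from j) → WellFounded _<_
      transfer {_<_} wf = Subrelation.wellFounded
        (subst₂ _<_ (sym (strictlyInverseʳ _)) (sym (strictlyInverseʳ _)))
        (On.wellFounded to wf)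

  ≺-wellFounded : WellFounded _≺_
  ≺-wellFounded = proj₁ wellFounded

  ≻-wellFounded : WellFounded (flip _≺_)
  ≻-wellFounded = proj₂ wellFounded

  infix 4 _≼_
  _≼_ : Node → Node → Set
  x ≼ y = x ≡ y ⊎ x ≺ y

  arc≺ : ∀ {a n} → head a ≡ n → tail a ≺ n
  arc≺ {a} h = [ a , refl , h ]⁺

  ≼-≺-trans : ∀ {x y z} → x ≼ y → y ≺ z → x ≺ z
  ≼-≺-trans (inj₁ refl) q = q
  ≼-≺-trans (inj₂ p)    q = p ⁺++ q

  abstract
    erasing? : ∀ n → Dec (Erasing n)
    erasing? n = go n (≺-wellFounded n)
      where
      go : ∀ n → Acc _≺_ n → Dec (Erasing n)
      go n (acc rec) with label n ≟ᴸ bot ⊎-dec (label n ≟ᴸ par ⊎-dec label n ≟ᴸ •)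
      ... | no ¬l = no λ { (erasing l _) → ¬l l }
      ... | yes l = map′ (erasing l) (λ { (erasing _ ps) → ps }) (finite-all? arcs premise?)
        where
        premise? : ∀ a → Dec (head a ≡ n → Erasing (tail a))
        premise? a with head a ≟ᴺ n
        ... | no ¬h = yes λ h → contradiction h ¬h
        ... | yes h = map′ (λ e _ → e) (λ f → f h) (go (tail a) (rec (arc≺ h)))

  erasing-premise : ∀ {a} → Erasing (head a) → Erasing (tail a)
  erasing-premise (erasing _ ps) = ps _ refl

  ≺-erasing : ∀ {x y} → x ≺ y → Erasing y → Erasing x
  ≺-erasing [ a , refl , refl ]⁺   e = erasing-premise e
  ≺-erasing ((a , refl , refl) ∷ p) e = erasing-premise (≺-erasing p e)

  ≼-erasing : ∀ {x y} → x ≼ y → Erasing y → Erasing x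
  ≼-erasing (inj₁ refl) e = e
  ≼-erasing (inj₂ p)    e = ≺-erasing p e

  erasing-label : ∀ {n} → Erasing n → label n ≡ bot ⊎ label n ≡ par ⊎ label n ≡ •
  erasing-label (erasing l _) = l

  premiseless : ∀ {n a} → #premises (label n) ≡ 0 → head a ≢ n
  premiseless {a = a} none refl = ℕ.n≮0 (subst (index a <_) none (index< a))

  erasing-bot : ∀ {n} → label n ≡ bot → Erasing n
  erasing-bot b = erasing (inj₁ b) λ a h → contradiction h (premiseless (cong #premises b))

  tail-• : ∀ a → label (tail a) ≢ •
  tail-• a l with () ← subst Fin (cong #conclusions l) (Inverse.to (conclusionCount (tail a)) (a , refl))

  conclusion : ∀ {n} → label n ≢ • → ∃[ c ] tail c ≡ n
  conclusion {n} ¬• = Inverse.from (conclusionCount n) (some _ ¬•)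
    where
    some : ∀ l → l ≢ • → Fin (#conclusions l)
    some ax   _ = zero
    some one  _ = zero
    some bot  _ = zero
    some tens _ = zero
    some par  _ = zero
    some •    p = contradiction refl p

  conclusions-≡ : ∀ {c d} → tail c ≡ tail d → label (tail d) ≢ ax → c ≡ d
  conclusions-≡ {c} {d} eq ¬ax =
    cong proj₁ (injective (c , eq) (d , refl) (unique _ ¬ax _ _))
    where
    open Inverse (conclusionCount (tail d))
    injective : ∀ x y → to x ≡ to y → x ≡ y
    injective x y p = trans (sym (strictlyInverseʳ x)) (trans (cong from p) (strictlyInverseʳ y))
    unique : ∀ l → l ≢ ax → (i j : Fin (#conclusions l)) → i ≡ j
    unique ax   p _ _       = contradiction refl p
    unique one  _ zero zero = refl
    unique bot  _ zero zero = refl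
    unique tens _ zero zero = refl
    unique par  _ zero zero = refl

  erasing-conclusions-≡ : ∀ {c d} → Erasing (tail c) → tail d ≡ tail c → c ≡ d
  erasing-conclusions-≡ {c} e eq = sym (conclusions-≡ eq λ l → not-ax (subst Lab l (erasing-label e)))
    where
    Lab : Label → Set
    Lab l = l ≡ bot ⊎ l ≡ par ⊎ l ≡ •
    not-ax : ¬ Lab ax
    not-ax (inj₂ (inj₁ ()))
    not-ax (inj₂ (inj₂ ()))

  -- The descending path from an erasing node is unique, so it leaves the erasing part only once.
  erasing-linear : ∀ {x y z} → x ≼ y → Erasing y → x ≺ z → ¬ Erasing z → y ≺ z
  erasing-linear (inj₁ refl) e q ¬e = q
  erasing-linear (inj₂ [ c , refl , refl ]⁺) e [ d , td , refl ]⁺ ¬e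
    with refl ← erasing-conclusions-≡ (erasing-premise e) td = contradiction e ¬e
  erasing-linear (inj₂ [ c , refl , refl ]⁺) e ((d , td , refl) ∷ q) ¬e
    with refl ← erasing-conclusions-≡ (erasing-premise e) td = q
  erasing-linear (inj₂ ((c , refl , refl) ∷ p)) e [ d , td , refl ]⁺ ¬e
    with refl ← erasing-conclusions-≡ (erasing-premise (≺-erasing p e)) td =
    contradiction (≺-erasing p e) ¬e
  erasing-linear (inj₂ ((c , refl , refl) ∷ p)) e ((d , td , refl) ∷ q) ¬e
    with refl ← erasing-conclusions-≡ (erasing-premise (≺-erasing p e)) td =
    erasing-linear (inj₂ p) e q ¬e

  record Binary (n : Node) : Set where
    field
      l r     : Arc
      head-l  : head l ≡ n
      head-r  : head r ≡ n
      index-l : index l ≡ 0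
      index-r : index r ≡ 1
      cover   : ∀ a → head a ≡ n → a ≡ l ⊎ a ≡ r

    l≢r : l ≢ r
    l≢r eq with () ← trans (sym index-l) (trans (cong index eq) index-r)

  binary : ∀ {n} → #premises (label n) ≡ 2 → Binary n
  binary {n} two
    with l , (hl , il) , ul ← premise n 0 (subst (0 <_) (sym two) (s≤s z≤n))
       | r , (hr , ir) , ur ← premise n 1 (subst (1 <_) (sym two) (s≤s (s≤s z≤n))) =
    record { l = l ; r = r ; head-l = hl ; head-r = hr ; index-l = il ; index-r = ir ; cover = cover }
    where
    cover : ∀ a → head a ≡ n → a ≡ l ⊎ a ≡ r
    cover a refl with index a in eq | subst (index a <_) two (index< a)
    ... | 0 | _ = inj₁ (sym (ul (refl , eq)))
    ... | 1 | _ = inj₂ (sym (ur (refl , eq)))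
    ... | suc (suc _) | s≤s (s≤s ())

  tens-binary : ∀ {n} → label n ≡ tens → Binary n
  tens-binary t = binary (cong #premises t)

  par-binary : ∀ {n} → label n ≡ par → Binary n
  par-binary p = binary (cong #premises p)

  •-index : ∀ {a} → label (head a) ≡ • → index a ≡ 0
  •-index {a} b with index a | subst (λ l → index a < #premises l) b (index< a)
  ... | 0     | _      = refl
  ... | suc _ | s≤s ()

  •-premise-≡ : ∀ {a b} → label (head a) ≡ • → head a ≡ head b → a ≡ b
  •-premise-≡ {a} {b} l eq
    with _ , _ , u ← premise (head a) 0 (subst (λ l → 0 < #premises l) (sym l) (s≤s z≤n)) =
    trans (sym (u (refl , •-index l))) (u (sym eq , •-index (trans (cong label (sym eq)) l)))

  •-premise : ∀ {n} → label n ≡ • → ∃[ a ] head a ≡ n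
  •-premise {n} l
    with a , (h , _) , _ ← premise n 0 (subst (λ l → 0 < #premises l) (sym l) (s≤s z≤n)) = a , h

  erasing⇒KindE : ∀ c → Erasing (tail c) → KindE (type c)
  erasing⇒KindE c e = go c e refl
    where
    go : ∀ {n} c → Erasing n → tail c ≡ n → KindE (type c)
    go c (erasing (inj₁ b) _) refl = subst KindE (sym (type-bot c b)) 𝐛
    go c (erasing (inj₂ (inj₁ p)) ps) refl =
      subst KindE (sym (type-par c l r p head-l index-l head-r index-r))
        (go l (ps l head-l) refl ⅋ go r (ps r head-r) refl)
      where open Binary (par-binary p)
    go c (erasing (inj₂ (inj₂ b)) _) refl = contradiction b (tail-• c)

  -- Here the restriction to the fragment is used: both components of a ⊗ formula have kind A, the
  -- conclusion of an erasing node has kind E, and no formula has both kinds.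
  tens-premise : ∀ a → label (head a) ≡ tens → ¬ Erasing (tail a)
  tens-premise a t e with c , tc ← conclusion {head a} (λ b → contradiction (trans (sym t) b) λ ()) =
    not-E (subst Fragment type-c (type-fragment c)) (cover a refl)
    where
    open Binary (tens-binary t)
    type-c = type-tens c l r (trans (cong label tc) t)
      (trans head-l (sym tc)) index-l (trans head-r (sym tc)) index-r
    not-E : Fragment (type l ⊗ type r) → ¬ (a ≡ l ⊎ a ≡ r)
    not-E (inj₁ (k ⊗ _)) (inj₁ a≡l) = A∧E k (subst (KindE ∘ type) a≡l (erasing⇒KindE a e))
    not-E (inj₁ (_ ⊗ k)) (inj₂ a≡r) = A∧E k (subst (KindE ∘ type) a≡r (erasing⇒KindE a e))

  module CanonicalJump (m : Node) (¬em : ¬ Erasing m)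
                       (J : Node → Maybe Node) (canonical : IsCanonicalJump m J) where
    open IsCanonicalJump canonical

    jump-label : ∀ {n t} → J n ≡ just t → label n ≡ bot
    jump-label {n} eq with label n ≟ᴸ bot
    ... | yes b = b
    ... | no ¬b with () ← trans (sym eq) (off-w n ¬b)

    jump-total : ∀ {n} → label n ≡ bot → ∃[ t ] J n ≡ just t
    jump-total {n} b with J n in eq
    ... | just t  = t , refl
    ... | nothing = contradiction (trans (sym eq) (on-wₑ n (b , ¬w⅋))) λ ()
      where
      ¬w⅋ : ¬ w⅋ n
      ¬w⅋ p with _ , _ , eq′ ← on-w⅋ n p with () ← trans (sym eq) eq′

    -- `w⅋` is not decided here. An erasing target refutes `w⅋ n`, because canonical ⅋ jumps have
    -- non-erasing targets; so `n` is in `wₑ` and its target is `m`.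
    jump-nonErasing : ∀ {n t} → J n ≡ just t → ¬ Erasing t
    jump-nonErasing {n} eq et = ¬em (subst Erasing
      (just-injective (trans (sym eq) (on-wₑ n (jump-label eq , ¬w⅋)))) et)
      where
      ¬w⅋ : ¬ w⅋ n
      ¬w⅋ p with _ , (_ , _ , _ , _ , _ , _ , _ , ¬e , _) , eq′ ← on-w⅋ n p
        with refl ← trans (sym eq) eq′ = ¬e et

    -- The least non-erasing ⅋ node `n₀` below `x` is `head b` itself: the path from `x` to `n₀`
    -- runs through `tail b` and its only conclusion `b`, so `n₀ ≺ head b` would close a directed
    -- cycle.
    jump-into-⅋ : ∀ {x b t} → label (head b) ≡ par → ¬ Erasing (head b) → Erasing (tail b) →
                  x ≼ tail b → J x ≡ just t →
                  ∃[ a ] head a ≡ head b × tail a ≡ t × ¬ Erasing t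
    jump-into-⅋ {x} {b} p ¬e eb x≼ eq
      with _ , (n₀ , ((_ , ¬e₀) , x≺n₀ , least) , a , _ , ha , _ , ta , ¬et , _) , eq′ ←
             on-w⅋ x (jump-label eq , head b , (p , ¬e) , ≼-≺-trans x≼ (arc≺ refl))
      with refl ← trans (sym eq) eq′
      with least (head b) (p , ¬e) (≼-≺-trans x≼ (arc≺ refl))
    ... | inj₁ refl = a , ha , ta , ¬et
    ... | inj₂ n₀≺ with erasing-linear x≼ eb x≺n₀ ¬e₀
    ...   | [ c , tc , refl ]⁺ with refl ← erasing-conclusions-≡ eb tc =
            contradiction n₀≺ (acyclic (head b))
    ...   | (c , tc , refl) ∷ q with refl ← erasing-conclusions-≡ eb tc =
            contradiction (q ⁺++ n₀≺) (acyclic (head b))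

-- Structures realizing an upward-closed set of nodes

module _ {𝒜 : Atoms} (S : Structure 𝒜) (l r : Structure.Arc S) where
  open Structure S

  remap-other : ∀ {n} (p : n ≢ head l) (q : n ≢ head r) → remap S l r n ≡ inj₁ (n , p , q)
  remap-other {n} p q with n ≟ᴺ head l | n ≟ᴺ head r
  ... | no _  | no _  = refl
  ... | no _  | yes h = contradiction h q
  ... | yes h | _     = contradiction h p

  remap-l : ∀ {n} → n ≡ head l → remap S l r n ≡ inj₂ 0F
  remap-l {n} h with n ≟ᴺ head l | n ≟ᴺ head r
  ... | yes _ | yes _ = refl
  ... | yes _ | no _  = refl
  ... | no ¬h | _     = contradiction h ¬h

  remap-r : ∀ {n} → n ≡ head r → remap S l r n ≡ inj₂ 0F
  remap-r {n} h with n ≟ᴺ head l | n ≟ᴺ head r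
  ... | yes _ | yes _ = refl
  ... | no _  | yes _ = refl
  ... | yes _ | no ¬h = contradiction h ¬h
  ... | no _  | no ¬h = contradiction h ¬h

module Realization {𝒜 : Atoms} (R : ProofStructure 𝒜)
    (J : ProofStructure.Node R → Maybe (ProofStructure.Node R))
    (J-label : ∀ {n t} → J n ≡ just t → ProofStructure.label R n ≡ bot) where
  open Basics R

  -- A node of a structure realizing a set of nodes of R: a node of R, or the fresh • node
  -- below an arc whose head in R is not a • node.
  Point : Set
  Point = Node ⊎ Arc

  -- A • node of R keeps its identity as `inj₁`, since `J` may target it; the fresh • nodes `inj₂`
  -- are never targets.
  pend : Arc → Point
  pend a with label (head a) ≟ᴸ •
  ... | yes _ = inj₁ (head a)
  ... | no _  = inj₂ a

  pend-• : ∀ {a} → label (head a) ≡ • → pend a ≡ inj₁ (head a)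
  pend-• {a} b with label (head a) ≟ᴸ •
  ... | yes _ = refl
  ... | no ¬b = contradiction b ¬b

  pend-¬• : ∀ {a} → label (head a) ≢ • → pend a ≡ inj₂ a
  pend-¬• {a} ¬b with label (head a) ≟ᴸ •
  ... | yes b = contradiction b ¬b
  ... | no _  = refl

  pend-node : ∀ {a n} → pend a ≡ inj₁ n → label n ≡ •
  pend-node {a} eq with label (head a) ≟ᴸ • | eq
  ... | yes b | refl = b
  ... | no _  | ()

  pend-injective : ∀ {a b} → pend a ≡ pend b → a ≡ b
  pend-injective {a} {b} eq with label (head a) ≟ᴸ • | label (head b) ≟ᴸ •
  ... | yes p | yes q = •-premise-≡ p (inj₁-injective eq)
  ... | no _  | no _  = inj₂-injective eq
  pend-injective () | yes _ | no _
  pend-injective () | no _  | yes _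

  J-nothing : ∀ {n} → label n ≢ bot → J n ≡ nothing
  J-nothing {n} ¬b with J n in eq
  ... | nothing = refl
  ... | just _  = contradiction (J-label eq) ¬b

  pointLabel : Point → Label
  pointLabel = [ label , const • ]′

  pointJump : Point → Maybe Point
  pointJump = [ Maybe.map inj₁ ∘ J , const nothing ]′

  pend-label : ∀ a → pointLabel (pend a) ≡ •
  pend-label a with label (head a) ≟ᴸ •
  ... | yes b = b
  ... | no _  = refl

  pend-jump : ∀ a → pointJump (pend a) ≡ nothing
  pend-jump a with label (head a) ≟ᴸ •
  ... | yes b = cong (Maybe.map inj₁) (J-nothing λ b′ → contradiction (trans (sym b) b′) λ ())
  ... | no _  = refl

  pointJump-node : ∀ {x y} → pointJump x ≡ just y → ∃[ n ] y ≡ inj₁ n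
  pointJump-node {inj₁ n} eq with J n
  pointJump-node {inj₁ n} refl | just t = t , refl
  pointJump-node {inj₁ n} ()   | nothing

  Image : (Node → Set) → Point → Set
  Image U x = (∃[ n ] x ≡ inj₁ n × U n) ⊎
              (∃[ a ] x ≡ pend a × U (tail a) × ¬ U (head a))

  -- `e` and `ε` embed `S` into R: its arcs are those with tail in `U`, its nodes those of `U` and
  -- one pending • node for each arc leaving `U`. Since `U` contains no • node (`proper`), all •
  -- nodes occur as pending points. By `jump≡` the jumps of `S` are already the final ones, and
  -- `index∉` is 0 because a • node has a single premise.
  record Realizes (S : Structure 𝒜) (U : Node → Set) : Set where
    private module S = Structure S
    field
      U?      : ∀ n → Dec (U n)
      up      : ∀ {a} → U (head a) → U (tail a)
      proper  : ∀ {n} → U n → label n ≢ •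
      e       : S.Node → Point
      e-inj   : ∀ {x y} → e x ≡ e y → x ≡ y
      e-image : ∀ x → Image U (e x)
      ε       : S.Arc → Arc
      ε-inj   : ∀ {a b} → ε a ≡ ε b → a ≡ b
      ε-sur   : ∀ {a} → U (tail a) → ∃[ s ] ε s ≡ a
      ε-image : ∀ s → U (tail (ε s))
      tail≡   : ∀ s → e (S.tail s) ≡ inj₁ (tail (ε s))
      head∈   : ∀ {s} → U (head (ε s)) → e (S.head s) ≡ inj₁ (head (ε s))
      head∉   : ∀ {s} → ¬ U (head (ε s)) → e (S.head s) ≡ pend (ε s)
      label≡  : ∀ x → S.label x ≡ pointLabel (e x)
      type≡   : ∀ s → S.type s ≡ type (ε s)
      index∈  : ∀ {s} → U (head (ε s)) → S.index s ≡ index (ε s)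
      index∉  : ∀ {s} → ¬ U (head (ε s)) → S.index s ≡ 0
      jump≡   : ∀ x → Maybe.map e (S.jump x) ≡ pointJump (e x)

    e-node : ∀ {x n} → e x ≡ inj₁ n → label n ≢ • → U n
    e-node {x} eq ¬b with e-image x
    ... | inj₁ (m , eq′ , u) = subst U (inj₁-injective (trans (sym eq′) eq)) u
    ... | inj₂ (a , eq′ , _) = contradiction (pend-node (trans (sym eq′) eq)) ¬b

    e-pend : ∀ {x a} → e x ≡ pend a → U (tail a) × ¬ U (head a)
    e-pend {x} {a} eq with e-image x
    ... | inj₁ (m , eq′ , u) = contradiction (pend-node (trans (sym eq) eq′)) (proper u)
    ... | inj₂ (b , eq′ , u) with refl ← pend-injective {a} {b} (trans (sym eq) eq′) = u

    e-sur-pend : ∀ {a} → U (tail a) → ¬ U (head a) → ∃[ x ] e x ≡ pend a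
    e-sur-pend u ¬u with s , refl ← ε-sur u = _ , head∉ ¬u

    -- A node other than • is the tail of some arc, so surjectivity of `ε` already gives
    -- surjectivity on nodes.
    e-sur-node : ∀ {n} → U n → ∃[ x ] e x ≡ inj₁ n
    e-sur-node u with c , refl ← conclusion (proper u) with s , refl ← ε-sur u = _ , tail≡ s

    head-pend : ∀ {s a} → label (head a) ≢ • → e (S.head s) ≡ pend a → ε s ≡ a
    head-pend {s} {a} ¬b eq with U? (head (ε s))
    ... | yes u = contradiction (trans (sym (head∈ u)) (trans eq (pend-¬• ¬b))) λ ()
    ... | no ¬u = pend-injective (trans (sym (head∉ ¬u)) eq)

    -- Discharges the side condition of the ⅋ and ⊗ rules: jumps of `S` lead to points `inj₁`,
    -- whereas the • node to be removed is a fresh point `inj₂`.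
    pend-not-target : ∀ {s} → label (head (ε s)) ≢ • → ¬ U (head (ε s)) →
                      ¬ S.JumpTarget (S.head s)
    pend-not-target {s} ¬b ¬u (x , eq)
      with _ , eq′ ← pointJump-node {e x} (trans (sym (jump≡ x)) (cong (Maybe.map e) eq)) =
      contradiction (trans (sym eq′) (trans (head∉ ¬u) (pend-¬• ¬b))) λ ()

  realizes-withConclusions : ∀ {S U} cs → Realizes S U → Realizes (withConclusions S cs) U
  realizes-withConclusions cs r = record { Realizes r }

  module _ {S : Structure 𝒜} {U : Node → Set} (real : Realizes S U) where
    private module S = Structure S
    open Realizes real

    realizes-addBot : ∀ {n} → label n ≡ bot → ¬ U n → ∀ c → tail c ≡ n →
                      ∀ t → Maybe.map inj₁ (J n) ≡ just (e t) →
                      Realizes (addBot S t) (λ x → U x ⊎ x ≡ n)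
    realizes-addBot {n} b ¬un c refl t jn = record
      { U?      = λ x → U? x ⊎-dec (x ≟ᴺ n)
      ; up      = λ { (inj₁ u) → inj₁ (up u) ; (inj₂ h) → contradiction h no-premise }
      ; proper  = λ { (inj₁ u) → proper u ; (inj₂ refl) l → contradiction (trans (sym b) l) λ () }
      ; e       = e′
      ; e-inj   = λ {x} {y} → e-inj′ x y
      ; e-image = image
      ; ε       = ε′
      ; ε-inj   = λ {x} {y} → ε-inj′ x y
      ; ε-sur   = ε-sur′
      ; ε-image = λ { (just s) → inj₁ (ε-image s) ; nothing → inj₂ refl }
      ; tail≡   = λ { (just s) → tail≡ s ; nothing → refl }
      ; head∈   = λ { {just s}  (inj₁ u) → head∈ u
                    ; {just s}  (inj₂ h) → contradiction h no-premise
                    ; {nothing} u → contradiction u head-c }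
      ; head∉   = λ { {just s} ¬u → head∉ (¬u ∘ inj₁) ; {nothing} _ → refl }
      ; label≡  = λ { (inj₁ x) → label≡ x ; (inj₂ 0F) → sym b ; (inj₂ 1F) → sym (pend-label c) }
      ; type≡   = λ { (just s) → type≡ s ; nothing → sym (type-bot c b) }
      ; index∈  = λ { {just s}  (inj₁ u) → index∈ u
                    ; {just s}  (inj₂ h) → contradiction h no-premise
                    ; {nothing} u → contradiction u head-c }
      ; index∉  = λ { {just s} ¬u → index∉ (¬u ∘ inj₁) ; {nothing} _ → refl }
      ; jump≡   = λ { (inj₁ x) → trans (sym (Maybeₚ.map-∘ (S.jump x))) (jump≡ x)
                    ; (inj₂ 0F) → sym jn
                    ; (inj₂ 1F) → sym (pend-jump c) }
      }
      where
      no-premise : ∀ {a} → head a ≢ n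
      no-premise = premiseless (cong #premises b)
      head-c : ¬ (U (head c) ⊎ head c ≡ n)
      head-c (inj₁ u) = ¬un (up u)
      head-c (inj₂ h) = no-premise h
      ¬•n : label n ≢ •
      ¬•n l = contradiction (trans (sym b) l) λ ()

      e′ : S.Node ⊎ Fin 2 → Point
      e′ (inj₁ x)  = e x
      e′ (inj₂ 0F) = inj₁ n
      e′ (inj₂ 1F) = pend c

      e-inj′ : ∀ x y → e′ x ≡ e′ y → x ≡ y
      e-inj′ (inj₁ x)  (inj₁ y)  eq = cong inj₁ (e-inj eq)
      e-inj′ (inj₁ x)  (inj₂ 0F) eq = contradiction (e-node eq ¬•n) ¬un
      e-inj′ (inj₁ x)  (inj₂ 1F) eq = contradiction (proj₁ (e-pend eq)) ¬un
      e-inj′ (inj₂ 0F) (inj₁ y)  eq = contradiction (e-node (sym eq) ¬•n) ¬un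
      e-inj′ (inj₂ 1F) (inj₁ y)  eq = contradiction (proj₁ (e-pend (sym eq))) ¬un
      e-inj′ (inj₂ 0F) (inj₂ 0F) eq = refl
      e-inj′ (inj₂ 1F) (inj₂ 1F) eq = refl
      e-inj′ (inj₂ 0F) (inj₂ 1F) eq = contradiction (pend-node (sym eq)) ¬•n
      e-inj′ (inj₂ 1F) (inj₂ 0F) eq = contradiction (pend-node eq) ¬•n

      image : ∀ x → Image (λ x → U x ⊎ x ≡ n) (e′ x)
      image (inj₁ x) with e-image x
      ... | inj₁ (m , eq , u)      = inj₁ (m , eq , inj₁ u)
      ... | inj₂ (a , eq , u , ¬u) = inj₂ (a , eq , inj₁ u , [ ¬u , no-premise ]′)
      image (inj₂ 0F) = inj₁ (n , refl , inj₂ refl)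
      image (inj₂ 1F) = inj₂ (c , refl , inj₂ refl , head-c)

      ε′ : Maybe S.Arc → Arc
      ε′ = Maybe.maybe′ ε c

      ε-inj′ : ∀ x y → ε′ x ≡ ε′ y → x ≡ y
      ε-inj′ (just x) (just y) eq = cong just (ε-inj eq)
      ε-inj′ nothing  nothing  eq = refl
      ε-inj′ (just x) nothing  eq = contradiction (subst (U ∘ tail) eq (ε-image x)) ¬un
      ε-inj′ nothing  (just y) eq = contradiction (subst (U ∘ tail) (sym eq) (ε-image y)) ¬un

      ε-sur′ : ∀ {a} → U (tail a) ⊎ tail a ≡ n → ∃[ s ] ε′ s ≡ a
      ε-sur′ (inj₁ u) with s , eq ← ε-sur u = just s , eq
      ε-sur′ {a} (inj₂ t) = nothing , sym (conclusions-≡ t λ l → contradiction (trans (sym b) l) λ ())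

    realizes-join : ∀ {n} (B : Binary n) {ℓ} → label n ≡ ℓ → ℓ ≡ par ⊎ ℓ ≡ tens → ¬ U n →
                    ∀ c → tail c ≡ n →
                    ∀ {_∙_} → type c ≡ type (Binary.l B) ∙ type (Binary.r B) →
                    ∀ {sl sr} → ε sl ≡ Binary.l B → ε sr ≡ Binary.r B → ∀ cs ds →
                    Realizes (joinWith S sl sr ℓ _∙_ cs ds) (λ x → U x ⊎ x ≡ n)
    realizes-join {n} B lab≡ ℓ≡ ¬un c refl {_∙_} type-c {sl} {sr} εl εr cs ds = record
      { U?      = λ x → U? x ⊎-dec (x ≟ᴺ n)
      ; up      = λ { (inj₁ u) → inj₁ (up u) ; (inj₂ h) → inj₁ (premise-∈ (cover _ h)) }
      ; proper  = λ { (inj₁ u) → proper u ; (inj₂ refl) → ¬•n }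
      ; e       = e′
      ; e-inj   = λ {x} {y} → e-inj′ x y
      ; e-image = image
      ; ε       = ε′
      ; ε-inj   = λ {x} {y} → ε-inj′ x y
      ; ε-sur   = ε-sur′
      ; ε-image = λ { (just s) → inj₁ (ε-image s) ; nothing → inj₂ refl }
      ; tail≡   = λ { (just s) → tail≡′ s ; nothing → refl }
      ; head∈   = λ { {just s} u → head∈′ s u ; {nothing} u → contradiction u head-c }
      ; head∉   = λ { {just s} ¬u → head∉′ s ¬u ; {nothing} _ → refl }
      ; label≡  = λ { (inj₁ (x , _)) → label≡ x ; (inj₂ 0F) → sym lab≡ ; (inj₂ 1F) → sym (pend-label c) }
      ; type≡   = λ { (just s) → type≡ s
                    ; nothing → trans (cong₂ _∙_ (trans (type≡ sl) (cong type εl))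
                                               (trans (type≡ sr) (cong type εr))) (sym type-c) }
      ; index∈  = λ { {just s} u → index∈′ s u ; {nothing} u → contradiction u head-c }
      ; index∉  = λ { {just s} ¬u → index∉′ s ¬u ; {nothing} _ → refl }
      ; jump≡   = λ { (inj₁ (x , _)) → jump≡′ x
                    ; (inj₂ 0F) → cong (Maybe.map inj₁) (sym (J-nothing ¬bot))
                    ; (inj₂ 1F) → sym (pend-jump c) }
      }
      where
      open Binary B
      U′ : Node → Set
      U′ x = U x ⊎ x ≡ n
      lab : label n ≡ par ⊎ label n ≡ tens
      lab = Sum.map (trans lab≡) (trans lab≡) ℓ≡
      label≢ : ∀ {k} → par ≢ k → tens ≢ k → label n ≢ k
      label≢ ≢par ≢tens eq = [ (λ p → ≢par (trans (sym p) eq)) , (λ t → ≢tens (trans (sym t) eq)) ]′ lab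
      ¬•n : label n ≢ •
      ¬•n = label≢ (λ ()) λ ()
      ¬bot : label n ≢ bot
      ¬bot = label≢ (λ ()) λ ()
      ¬ax : label n ≢ ax
      ¬ax = label≢ (λ ()) λ ()

      premise-∈ : ∀ {a} → a ≡ l ⊎ a ≡ r → U (tail a)
      premise-∈ (inj₁ refl) = subst (U ∘ tail) εl (ε-image sl)
      premise-∈ (inj₂ refl) = subst (U ∘ tail) εr (ε-image sr)

      head-c : ¬ U′ (head c)
      head-c (inj₁ u) = ¬un (up u)
      head-c (inj₂ h) = acyclic n (arc≺ h)

      head-sl : e (S.head sl) ≡ inj₂ l
      head-sl = trans (head∉ (¬un ∘ subst U (trans (cong head εl) head-l)))
        (trans (cong pend εl) (pend-¬• (¬•n ∘ trans (cong label (sym head-l)))))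
      head-sr : e (S.head sr) ≡ inj₂ r
      head-sr = trans (head∉ (¬un ∘ subst U (trans (cong head εr) head-r)))
        (trans (cong pend εr) (pend-¬• (¬•n ∘ trans (cong label (sym head-r)))))

      head-unique-l : ∀ {s} → S.head s ≡ S.head sl → s ≡ sl
      head-unique-l eq = ε-inj (trans (head-pend (¬•n ∘ trans (cong label (sym head-l)))
        (trans (trans (cong e eq) head-sl) (sym (pend-¬• (¬•n ∘ trans (cong label (sym head-l))))))) (sym εl))
      head-unique-r : ∀ {s} → S.head s ≡ S.head sr → s ≡ sr
      head-unique-r eq = ε-inj (trans (head-pend (¬•n ∘ trans (cong label (sym head-r)))
        (trans (trans (cong e eq) head-sr) (sym (pend-¬• (¬•n ∘ trans (cong label (sym head-r))))))) (sym εr))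

      e′ : Remaining S sl sr ⊎ Fin 2 → Point
      e′ (inj₁ (x , _)) = e x
      e′ (inj₂ 0F)      = inj₁ n
      e′ (inj₂ 1F)      = pend c

      e′-remap : ∀ {x} → x ≢ S.head sl → x ≢ S.head sr → e′ (remap S sl sr x) ≡ e x
      e′-remap p q = cong e′ (remap-other S sl sr p q)

      -- `remap` moves only `head sl` and `head sr`, and both are fresh points `inj₂`. Hence it
      -- leaves every node coming from R in place, in particular tails and jump targets.
      e′-remap-node : ∀ {x k} → e x ≡ inj₁ k → e′ (remap S sl sr x) ≡ e x
      e′-remap-node eq = e′-remap
        (λ { refl → contradiction (trans (sym eq) head-sl) λ () })
        (λ { refl → contradiction (trans (sym eq) head-sr) λ () })

      e-inj′ : ∀ x y → e′ x ≡ e′ y → x ≡ y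
      e-inj′ (inj₁ (x , _))  (inj₁ (y , _))  eq with refl ← e-inj eq = refl
      e-inj′ (inj₁ (x , _))  (inj₂ 0F) eq = contradiction (e-node eq ¬•n) ¬un
      e-inj′ (inj₁ (x , _))  (inj₂ 1F) eq = contradiction (proj₁ (e-pend eq)) ¬un
      e-inj′ (inj₂ 0F) (inj₁ (y , _))  eq = contradiction (e-node (sym eq) ¬•n) ¬un
      e-inj′ (inj₂ 1F) (inj₁ (y , _))  eq = contradiction (proj₁ (e-pend (sym eq))) ¬un
      e-inj′ (inj₂ 0F) (inj₂ 0F) eq = refl
      e-inj′ (inj₂ 1F) (inj₂ 1F) eq = refl
      e-inj′ (inj₂ 0F) (inj₂ 1F) eq = contradiction (pend-node (sym eq)) ¬•n
      e-inj′ (inj₂ 1F) (inj₂ 0F) eq = contradiction (pend-node eq) ¬•n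

      image : ∀ x → Image U′ (e′ x)
      image (inj₁ (x , ≢l , ≢r)) with e-image x
      ... | inj₁ (k , eq , u)      = inj₁ (k , eq , inj₁ u)
      ... | inj₂ (a , eq , u , ¬u) = inj₂ (a , eq , inj₁ u , [ ¬u , not-premise ∘ cover a ]′)
        where
        not-premise : ¬ (a ≡ l ⊎ a ≡ r)
        not-premise (inj₁ refl) = ≢l (e-inj (trans eq (trans
          (pend-¬• (¬•n ∘ trans (cong label (sym head-l)))) (sym head-sl))))
        not-premise (inj₂ refl) = ≢r (e-inj (trans eq (trans
          (pend-¬• (¬•n ∘ trans (cong label (sym head-r)))) (sym head-sr))))
      image (inj₂ 0F) = inj₁ (n , refl , inj₂ refl)
      image (inj₂ 1F) = inj₂ (c , refl , inj₂ refl , head-c)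

      ε′ : Maybe S.Arc → Arc
      ε′ = Maybe.maybe′ ε c

      ε-inj′ : ∀ x y → ε′ x ≡ ε′ y → x ≡ y
      ε-inj′ (just x) (just y) eq = cong just (ε-inj eq)
      ε-inj′ nothing  nothing  eq = refl
      ε-inj′ (just x) nothing  eq = contradiction (subst (U ∘ tail) eq (ε-image x)) ¬un
      ε-inj′ nothing  (just y) eq = contradiction (subst (U ∘ tail) (sym eq) (ε-image y)) ¬un

      ε-sur′ : ∀ {a} → U (tail a) ⊎ tail a ≡ n → ∃[ s ] ε′ s ≡ a
      ε-sur′ (inj₁ u) with s , eq ← ε-sur u = just s , eq
      ε-sur′ {a} (inj₂ t) = nothing , sym (conclusions-≡ t ¬ax)

      tail≡′ : ∀ s → e′ (remap S sl sr (S.tail s)) ≡ inj₁ (tail (ε s))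
      tail≡′ s = trans (e′-remap-node (tail≡ s)) (tail≡ s)

      premise-arc : ∀ {s} → head (ε s) ≡ n → s ≡ sl ⊎ s ≡ sr
      premise-arc h with cover _ h
      ... | inj₁ eq = inj₁ (ε-inj (trans eq (sym εl)))
      ... | inj₂ eq = inj₂ (ε-inj (trans eq (sym εr)))

      head∈′ : ∀ s → U′ (head (ε s)) → e′ (remap S sl sr (S.head s)) ≡ inj₁ (head (ε s))
      head∈′ s (inj₁ u) = trans (e′-remap-node (head∈ u)) (head∈ u)
      head∈′ s (inj₂ h) with premise-arc h
      ... | inj₁ refl = trans (cong e′ (remap-l S sl sr refl)) (cong inj₁ (sym h))
      ... | inj₂ refl = trans (cong e′ (remap-r S sl sr refl)) (cong inj₁ (sym h))

      not-l : ∀ {s} → head (ε s) ≢ n → s ≢ sl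
      not-l ¬h refl = ¬h (trans (cong head εl) head-l)
      not-r : ∀ {s} → head (ε s) ≢ n → s ≢ sr
      not-r ¬h refl = ¬h (trans (cong head εr) head-r)

      head∉′ : ∀ s → ¬ U′ (head (ε s)) → e′ (remap S sl sr (S.head s)) ≡ pend (ε s)
      head∉′ s ¬u = trans (e′-remap (not-l (¬u ∘ inj₂) ∘ head-unique-l) (not-r (¬u ∘ inj₂) ∘ head-unique-r))
        (head∉ (¬u ∘ inj₁))

      index′ : S.Arc → _
      index′ s = if does (s S.≟ᴬ sl) then 0 else if does (s S.≟ᴬ sr) then 1 else S.index s

      index-other : ∀ {s} → head (ε s) ≢ n → index′ s ≡ S.index s
      index-other {s} ¬h with s S.≟ᴬ sl | s S.≟ᴬ sr
      ... | yes p | _     = contradiction p (not-l ¬h)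
      ... | no _  | yes p = contradiction p (not-r ¬h)
      ... | no _  | no _  = refl

      index∈′ : ∀ s → U′ (head (ε s)) → index′ s ≡ index (ε s)
      index∈′ s (inj₁ u) = trans (index-other λ h → ¬un (subst U h u)) (index∈ u)
      index∈′ s (inj₂ h) with s S.≟ᴬ sl | s S.≟ᴬ sr
      ... | yes refl | _       = sym (trans (cong index εl) index-l)
      ... | no _     | yes refl = sym (trans (cong index εr) index-r)
      ... | no p     | no q    = contradiction (premise-arc h) [ p , q ]′

      index∉′ : ∀ s → ¬ U′ (head (ε s)) → index′ s ≡ 0
      index∉′ s ¬u = trans (index-other (¬u ∘ inj₂)) (index∉ (¬u ∘ inj₁))

      jump≡′ : ∀ x → Maybe.map e′ (Maybe.map (remap S sl sr) (S.jump x)) ≡ pointJump (e x)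
      jump≡′ x with S.jump x | jump≡ x
      ... | nothing | eq = eq
      ... | just t  | eq with _ , eq′ ← pointJump-node {e x} (sym eq) =
        trans (cong just (e′-remap-node eq′)) eq

  -- Both sets are upward closed and they are disjoint, so no arc leads from one to the other: an
  -- arc leaving either set also leaves the union.
  realizes-⊎ : ∀ {S T U V} → Realizes S U → Realizes T V → (∀ {n} → U n → ¬ V n) →
               Realizes (S ⊎ˢ T) (λ n → U n ⊎ V n)
  realizes-⊎ {S} {T} {U} {V} rS rT disjoint = record
    { U?      = λ n → A.U? n ⊎-dec B.U? n
    ; up      = λ { (inj₁ u) → inj₁ (A.up u) ; (inj₂ v) → inj₂ (B.up v) }
    ; proper  = [ A.proper , B.proper ]′
    ; e       = [ A.e , B.e ]′
    ; e-inj   = λ { {inj₁ x} {inj₁ y} eq → cong inj₁ (A.e-inj eq)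
                  ; {inj₁ x} {inj₂ y} eq → contradiction eq (separate x y)
                  ; {inj₂ x} {inj₁ y} eq → contradiction (sym eq) (separate y x)
                  ; {inj₂ x} {inj₂ y} eq → cong inj₂ (B.e-inj eq) }
    ; e-image = image
    ; ε       = [ A.ε , B.ε ]′
    ; ε-inj   = λ { {inj₁ x} {inj₁ y} eq → cong inj₁ (A.ε-inj eq)
                  ; {inj₁ x} {inj₂ y} eq → contradiction eq (separateᴬ x y)
                  ; {inj₂ x} {inj₁ y} eq → contradiction (sym eq) (separateᴬ y x)
                  ; {inj₂ x} {inj₂ y} eq → cong inj₂ (B.ε-inj eq) }
    ; ε-sur   = λ { (inj₁ u) → inj₁ (proj₁ (A.ε-sur u)) , proj₂ (A.ε-sur u)
                  ; (inj₂ v) → inj₂ (proj₁ (B.ε-sur v)) , proj₂ (B.ε-sur v) }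
    ; ε-image = λ { (inj₁ s) → inj₁ (A.ε-image s) ; (inj₂ s) → inj₂ (B.ε-image s) }
    ; tail≡   = λ { (inj₁ s) → A.tail≡ s ; (inj₂ s) → B.tail≡ s }
    ; head∈   = λ { {inj₁ s} u → A.head∈ (outV u (A.ε-image s))
                  ; {inj₂ s} u → B.head∈ (outU u (B.ε-image s)) }
    ; head∉   = λ { {inj₁ s} ¬u → A.head∉ (¬u ∘ inj₁) ; {inj₂ s} ¬u → B.head∉ (¬u ∘ inj₂) }
    ; label≡  = λ { (inj₁ x) → A.label≡ x ; (inj₂ x) → B.label≡ x }
    ; type≡   = λ { (inj₁ s) → A.type≡ s ; (inj₂ s) → B.type≡ s }
    ; index∈  = λ { {inj₁ s} u → A.index∈ (outV u (A.ε-image s))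
                  ; {inj₂ s} u → B.index∈ (outU u (B.ε-image s)) }
    ; index∉  = λ { {inj₁ s} ¬u → A.index∉ (¬u ∘ inj₁) ; {inj₂ s} ¬u → B.index∉ (¬u ∘ inj₂) }
    ; jump≡   = λ { (inj₁ x) → trans (sym (Maybeₚ.map-∘ (Structure.jump S x))) (A.jump≡ x)
                  ; (inj₂ x) → trans (sym (Maybeₚ.map-∘ (Structure.jump T x))) (B.jump≡ x) }
    }
    where
    module A = Realizes rS
    module B = Realizes rT

    outV : ∀ {a} → U (head a) ⊎ V (head a) → U (tail a) → U (head a)
    outV (inj₁ u) _ = u
    outV (inj₂ v) u = contradiction (B.up v) (disjoint u)

    outU : ∀ {a} → U (head a) ⊎ V (head a) → V (tail a) → V (head a)
    outU (inj₂ v) _ = v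
    outU (inj₁ u) v = contradiction v (disjoint (A.up u))

    separateᴬ : ∀ x y → A.ε x ≢ B.ε y
    separateᴬ x y eq = disjoint (subst (U ∘ tail) eq (A.ε-image x)) (B.ε-image y)

    separate : ∀ x y → A.e x ≢ B.e y
    separate x y eq with A.e-image x
    ... | inj₁ (n , eq′ , u) =
      disjoint u (B.e-node (trans (sym eq) eq′) (A.proper u))
    ... | inj₂ (a , eq′ , u , _) = disjoint u (proj₁ (B.e-pend (trans (sym eq) eq′)))

    image : ∀ x → Image (λ n → U n ⊎ V n) ([ A.e , B.e ]′ x)
    image (inj₁ x) with A.e-image x
    ... | inj₁ (n , eq , u) = inj₁ (n , eq , inj₁ u)
    ... | inj₂ (a , eq , u , ¬u) = inj₂ (a , eq , inj₁ u , λ h → ¬u (outV h u))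
    image (inj₂ x) with B.e-image x
    ... | inj₁ (n , eq , u) = inj₁ (n , eq , inj₂ u)
    ... | inj₂ (a , eq , u , ¬u) = inj₂ (a , eq , inj₂ u , λ h → ¬u (outU h u))

  ax-conclusions : ∀ {n} → label n ≡ ax → ∃[ a ] ∃[ b ] a ≢ b × tail a ≡ n × tail b ≡ n ×
                   (∀ d → tail d ≡ n → d ≡ a ⊎ d ≡ b)
  ax-conclusions {n} l = proj₁ (c 0F) , proj₁ (c 1F) , different , proj₂ (c 0F) , proj₂ (c 1F) , cover
    where
    open Inverse (conclusionCount n)
    two : 2 ≡ #conclusions (label n)
    two = cong #conclusions (sym l)
    c : Fin 2 → Σ[ a ∈ Arc ] tail a ≡ n
    c i = from (subst Fin two i)
    to-c : ∀ i → subst Fin (sym two) (to (c i)) ≡ i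
    to-c i = trans (cong (subst Fin (sym two)) (strictlyInverseˡ _)) (subst-sym-subst two)
    different : proj₁ (c 0F) ≢ proj₁ (c 1F)
    different eq with () ← trans (sym (to-c 0F)) (trans (cong (subst Fin (sym two) ∘ to)
      (Σ-≡,≡→≡ (eq , uip _ _))) (to-c 1F))
    at : ∀ {d i} → subst Fin (sym two) (to d) ≡ i → d ≡ c i
    at refl = trans (sym (strictlyInverseʳ _)) (cong from (sym (subst-subst-sym two)))
    cover : ∀ d → tail d ≡ n → d ≡ proj₁ (c 0F) ⊎ d ≡ proj₁ (c 1F)
    cover d t with subst Fin (sym two) (to (d , t)) in eq
    ... | 0F = inj₁ (cong proj₁ (at eq))
    ... | 1F = inj₂ (cong proj₁ (at eq))

  realizes-ax : ∀ {n} → label n ≡ ax → ∀ {a b} → a ≢ b → tail a ≡ n → tail b ≡ n →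
                (∀ d → tail d ≡ n → d ≡ a ⊎ d ≡ b) →
                Realizes (axiomStructure (type a)) (_≡ n)
  realizes-ax {n} l {a} {b} a≢b refl tb cover = record
    { U?      = _≟ᴺ n
    ; up      = λ h → contradiction h no-premise
    ; proper  = λ { refl l′ → contradiction (trans (sym l) l′) λ () }
    ; e       = e
    ; e-inj   = λ {x} {y} → e-inj x y
    ; e-image = λ { 0F → inj₁ (n , refl , refl)
                  ; 1F → inj₂ (a , refl , refl , no-premise)
                  ; 2F → inj₂ (b , refl , tb , no-premise) }
    ; ε       = ε
    ; ε-inj   = λ { {0F} {0F} _ → refl ; {0F} {1F} eq → contradiction eq a≢b
                  ; {1F} {0F} eq → contradiction (sym eq) a≢b ; {1F} {1F} _ → refl }
    ; ε-sur   = λ t → [ (λ eq → 0F , sym eq) , (λ eq → 1F , sym eq) ]′ (cover _ t)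
    ; ε-image = λ { 0F → refl ; 1F → tb }
    ; tail≡   = λ { 0F → refl ; 1F → cong inj₁ (sym tb) }
    ; head∈   = λ h → contradiction h no-premise
    ; head∉   = λ { {0F} _ → refl ; {1F} _ → refl }
    ; label≡  = λ { 0F → sym l ; 1F → sym (pend-label a) ; 2F → sym (pend-label b) }
    ; type≡   = λ { 0F → refl ; 1F → sym (type-ax a b a≢b (sym tb) l) }
    ; index∈  = λ h → contradiction h no-premise
    ; index∉  = λ _ → refl
    ; jump≡   = λ { 0F → cong (Maybe.map inj₁) (sym (J-nothing λ b → contradiction (trans (sym l) b) λ ()))
                  ; 1F → sym (pend-jump a) ; 2F → sym (pend-jump b) }
    }
    where
    no-premise : ∀ {d} → head d ≢ n
    no-premise = premiseless (cong #premises l)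
    ¬• : label n ≢ •
    ¬• l′ = contradiction (trans (sym l) l′) λ ()
    e : Fin 3 → Point
    e 0F = inj₁ n
    e 1F = pend a
    e 2F = pend b
    e-inj : ∀ x y → e x ≡ e y → x ≡ y
    e-inj 0F 0F _  = refl
    e-inj 0F 1F eq = contradiction (pend-node (sym eq)) ¬•
    e-inj 0F 2F eq = contradiction (pend-node (sym eq)) ¬•
    e-inj 1F 0F eq = contradiction (pend-node eq) ¬•
    e-inj 1F 1F _  = refl
    e-inj 1F 2F eq = contradiction (pend-injective eq) a≢b
    e-inj 2F 0F eq = contradiction (pend-node eq) ¬•
    e-inj 2F 1F eq = contradiction (pend-injective (sym eq)) a≢b
    e-inj 2F 2F _  = refl
    ε : Fin 2 → Arc
    ε 0F = a
    ε 1F = b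

  realizes-one : ∀ {n} → label n ≡ one → ∀ c → tail c ≡ n → Realizes oneStructure (_≡ n)
  realizes-one {n} l c refl = record
    { U?      = _≟ᴺ n
    ; up      = λ h → contradiction h no-premise
    ; proper  = λ { refl → ¬• }
    ; e       = e
    ; e-inj   = λ {x} {y} → e-inj x y
    ; e-image = λ { 0F → inj₁ (n , refl , refl) ; 1F → inj₂ (c , refl , refl , no-premise) }
    ; ε       = λ _ → c
    ; ε-inj   = λ { {0F} {0F} _ → refl }
    ; ε-sur   = λ t → 0F , sym (conclusions-≡ t λ l′ → contradiction (trans (sym l) l′) λ ())
    ; ε-image = λ _ → refl
    ; tail≡   = λ _ → refl
    ; head∈   = λ h → contradiction h no-premise
    ; head∉   = λ _ → refl
    ; label≡  = λ { 0F → sym l ; 1F → sym (pend-label c) }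
    ; type≡   = λ _ → sym (type-one c l)
    ; index∈  = λ h → contradiction h no-premise
    ; index∉  = λ _ → refl
    ; jump≡   = λ { 0F → cong (Maybe.map inj₁) (sym (J-nothing λ b → contradiction (trans (sym l) b) λ ()))
                  ; 1F → sym (pend-jump c) }
    }
    where
    no-premise : ∀ {d} → head d ≢ n
    no-premise = premiseless (cong #premises l)
    ¬• : label n ≢ •
    ¬• l′ = contradiction (trans (sym l) l′) λ ()
    e : Fin 2 → Point
    e 0F = inj₁ n
    e 1F = pend c
    e-inj : ∀ x y → e x ≡ e y → x ≡ y
    e-inj 0F 0F _  = refl
    e-inj 0F 1F eq = contradiction (pend-node (sym eq)) ¬•
    e-inj 1F 0F eq = contradiction (pend-node eq) ¬•
    e-inj 1F 1F _  = refl

-- Sequent rules on realized sets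

∈⇒↭∷ : ∀ {A : Set} {x : A} {xs} → x ∈ xs → ∃[ ys ] xs ↭ x ∷ ys
∈⇒↭∷ x∈ with ys , zs , refl ← ∈-∃++ x∈ = ys ++ zs , shift _ ys zs

unique-resp-↭ : ∀ {A : Set} {xs ys : List A} → xs ↭ ys → Unique xs → Unique ys
unique-resp-↭ {A} p = Perm.Unique-resp-↭ (setoid A) (↭⇒↭ₛ p)

module _ {𝒜 : Atoms} where

  -- The order of the conclusions is an argument of its own, so that exchange changes `cs` while
  -- `S`, and with it the embedding into R, stays fixed.
  Derives : (S : Structure 𝒜) → List (Structure.Arc S) → Set₁
  Derives S cs = Σ[ Γ ∈ List (Formula 𝒜) ] Σ[ π ∈ ⊢ Γ ]
    (π |⇒ withConclusions S cs) × Γ ≡ map (Structure.type S) cs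

  module _ {S : Structure 𝒜} where
    open Structure S using (type)

    derives-exch : ∀ cs {a b ds} → Derives S (cs ++ a ∷ b ∷ ds) → Derives S (cs ++ b ∷ a ∷ ds)
    derives-exch cs {a} {b} {ds} (Γ , π , der , eq)
      with refl ← trans eq (map-++ type cs (a ∷ b ∷ ds)) =
      _ , exch (map type cs) (map type ds) π ,
      exch der cs a b ds (sym (length-map type cs)) refl ,
      sym (map-++ type cs (b ∷ a ∷ ds))

    -- The prefix `cs` collects the conclusions already passed, so that each transposition becomes
    -- one exchange rule at its place in the sequent.
    derives-↭-++ : ∀ cs {xs ys} → xs ↭ ys → Derives S (cs ++ xs) → Derives S (cs ++ ys)
    derives-↭-++ cs ↭.refl d = d
    derives-↭-++ cs {x ∷ xs} {x ∷ ys} (↭.prep x p) d =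
      subst (Derives S) (++-assoc cs (x ∷ []) ys)
        (derives-↭-++ (cs ++ x ∷ []) p (subst (Derives S) (sym (++-assoc cs (x ∷ []) xs)) d))
    derives-↭-++ cs {x ∷ y ∷ xs} {y ∷ x ∷ ys} (↭.swap x y p) d =
      subst (Derives S) (++-assoc cs (y ∷ x ∷ []) ys)
        (derives-↭-++ (cs ++ y ∷ x ∷ []) p
          (subst (Derives S) (sym (++-assoc cs (y ∷ x ∷ []) xs)) (derives-exch cs d)))
    derives-↭-++ cs (↭.trans p q) d = derives-↭-++ cs q (derives-↭-++ cs p d)

    derives-↭ : ∀ {xs ys} → xs ↭ ys → Derives S xs → Derives S ys
    derives-↭ = derives-↭-++ []

module Sequentialization {𝒜 : Atoms} (R : ProofStructure 𝒜)
    (J : ProofStructure.Node R → Maybe (ProofStructure.Node R))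
    (J-label : ∀ {n t} → J n ≡ just t → ProofStructure.label R n ≡ bot) where
  open Basics R
  open Realization R J J-label public

  record Seq (U : Node → Set) : Set₁ where
    field
      S         : Structure 𝒜
      cs        : List (Structure.Arc S)
      derives   : Derives S cs
      realizes  : Realizes S U

    open Realizes realizes public

    field
      unique    : Unique cs
      sound     : ∀ {s} → s ∈ cs → ¬ U (head (ε s))
      complete  : ∀ {s} → ¬ U (head (ε s)) → s ∈ cs

  seq-ax : ∀ {n} → label n ≡ ax → Seq (_≡ n)
  seq-ax {n} l with a , b , a≢b , ta , tb , cover ← ax-conclusions l = record
    { S        = axiomStructure (type a)
    ; cs       = 0F ∷ 1F ∷ []
    ; derives  = _ , ax (type a) (type-fragment a) (subst Fragment type-b (type-fragment b)) ,
                 ax _ _ _ , refl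
    ; realizes = realizes-ax l a≢b ta tb cover
    ; unique   = ((λ ()) ∷ []) ∷ [] ∷ []
    ; sound    = λ _ → premiseless (cong #premises l)
    ; complete = λ { {0F} _ → here refl ; {1F} _ → there (here refl) }
    }
    where
    type-b : type b ≡ type a ^⊥
    type-b = type-ax a b a≢b (trans ta (sym tb)) (trans (cong label ta) l)

  seq-one : ∀ {n} → label n ≡ one → Seq (_≡ n)
  seq-one {n} l with c , tc ← conclusion {n} (λ b → contradiction (trans (sym l) b) λ ()) = record
    { S        = oneStructure
    ; cs       = 0F ∷ []
    ; derives  = _ , one , one , refl
    ; realizes = realizes-one l c tc
    ; unique   = [] ∷ []
    ; sound    = λ _ → premiseless (cong #premises l)
    ; complete = λ { {0F} _ → here refl }
    }

  seq-bot : ∀ {U n} (q : Seq U) → label n ≡ bot → ¬ U n →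
            (∃[ t ] Maybe.map inj₁ (J n) ≡ just (Seq.e q t)) → Seq (λ x → U x ⊎ x ≡ n)
  seq-bot {U} {n} q b ¬u (t , jn)
    with c , refl ← conclusion {n} (λ l → contradiction (trans (sym b) l) λ ())
       | Γ , π , der , refl ← Seq.derives q = record
    { S        = addBot (withConclusions S cs) t
    ; cs       = map just cs ++ nothing ∷ []
    ; derives  = _ , bot π , bot der t ,
                 trans (cong (_++ _) (map-∘ cs)) (sym (map-++ _ (map just cs) (nothing ∷ [])))
    ; realizes = realizes-addBot (realizes-withConclusions cs realizes) b ¬u c refl t jn
    ; unique   = Uniqueₚ.++⁺ (Uniqueₚ.map⁺ just-injective unique) ([] ∷ [])
                   λ { (p , here refl) → nothing∉ p }
    ; sound    = λ i → sound′ (∈-++⁻ (map just cs) i)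
    ; complete = λ { {just s} ¬h → ∈-++⁺ˡ (∈-map⁺ just (complete (¬h ∘ inj₁)))
                   ; {nothing} _ → ∈-++⁺ʳ (map just cs) (here refl) }
    }
    where
    open Seq q hiding (derives)
    nothing∉ : nothing ∉ map just cs
    nothing∉ i with _ , _ , () ← ∈-map⁻ just i
    no-premise : ∀ {a} → head a ≢ n
    no-premise = premiseless (cong #premises b)
    sound′ : ∀ {s} → s ∈ map just cs ⊎ s ∈ nothing ∷ [] →
             ¬ (U (head (Maybe.maybe′ ε c s)) ⊎ head (Maybe.maybe′ ε c s) ≡ n)
    sound′ _ (inj₂ h) = no-premise h
    sound′ (inj₁ i) (inj₁ u) with _ , j , refl ← ∈-map⁻ just i = sound j u
    sound′ (inj₂ (here refl)) (inj₁ u) = ¬u (up u)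

  -- `cs` lists the conclusions not consumed by the rule. This form serves both the ⅋ rule, on one
  -- structure, and the ⊗ rule, on a disjoint union.
  record Joinable {U} (S : Structure 𝒜) (r : Realizes S U) (sl sr : Structure.Arc S)
                  (cs : List (Structure.Arc S)) : Set where
    open Realizes r
    field
      unique   : Unique cs
      sound    : ∀ {s} → s ∈ cs → ¬ U (head (ε s)) × s ≢ sl × s ≢ sr
      complete : ∀ {s} → ¬ U (head (ε s)) → s ≢ sl → s ≢ sr → s ∈ cs

  seq-join : ∀ {U S n} (real : Realizes S U) {ℓ} →
             label n ≡ ℓ → ℓ ≡ par ⊎ ℓ ≡ tens →
             ¬ U n → (B : Binary n) →
             ∀ {c _∙_} → tail c ≡ n → type c ≡ type (Binary.l B) ∙ type (Binary.r B) →
             ∀ {sl sr} → Realizes.ε real sl ≡ Binary.l B → Realizes.ε real sr ≡ Binary.r B →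
             ∀ cs ds → Joinable S real sl sr (cs ++ ds) →
             Derives (joinWith S sl sr ℓ _∙_ cs ds) (map just cs ++ nothing ∷ map just ds) →
             Seq (λ x → U x ⊎ x ≡ n)
  seq-join {U} {S} {n} real {ℓ} lab ℓ≡ ¬u B {c} {_∙_} refl type-c {sl} {sr} εl εr cs ds join derives = record
    { S        = joinWith S sl sr ℓ _∙_ cs ds
    ; cs       = map just cs ++ nothing ∷ map just ds
    ; derives  = derives
    ; realizes = real′
    ; unique   = unique-resp-↭ (↭-sym perm)
        (Allₚ.¬Any⇒All¬ _ nothing∉ ∷ Uniqueₚ.map⁺ just-injective Join.unique)
    ; sound    = λ i → sound′ (∈-resp-↭ perm i)
    ; complete = λ {s} ¬h → ∈-resp-↭ (↭-sym perm) (complete′ s ¬h)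
    }
    where
    open Realizes real
    open Binary B
    module Join = Joinable join
    real′ = realizes-join real B lab ℓ≡ ¬u c refl {_∙_} type-c εl εr cs ds
    ε′ = Realizes.ε real′
    perm : map just cs ++ nothing ∷ map just ds ↭ nothing ∷ map just (cs ++ ds)
    perm = ↭-trans (shift nothing (map just cs) (map just ds))
      (↭-reflexive (cong (nothing ∷_) (sym (map-++ just cs ds))))
    nothing∉ : nothing ∉ map just (cs ++ ds)
    nothing∉ i with _ , _ , () ← ∈-map⁻ just i
    sound′ : ∀ {s} → s ∈ nothing ∷ map just (cs ++ ds) → ¬ (U (head (ε′ s)) ⊎ head (ε′ s) ≡ n)
    sound′ (here refl) (inj₁ u) = ¬u (up u)
    sound′ (here refl) (inj₂ h) = acyclic n (arc≺ h)
    sound′ (there i) u with _ , j , refl ← ∈-map⁻ just i with u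
    ... | inj₁ u = proj₁ (Join.sound j) u
    ... | inj₂ h with cover _ h
    ...   | inj₁ eq = proj₁ (proj₂ (Join.sound j)) (ε-inj (trans eq (sym εl)))
    ...   | inj₂ eq = proj₂ (proj₂ (Join.sound j)) (ε-inj (trans eq (sym εr)))
    complete′ : ∀ s → ¬ (U (head (ε′ s)) ⊎ head (ε′ s) ≡ n) → s ∈ nothing ∷ map just (cs ++ ds)
    complete′ nothing  _  = here refl
    complete′ (just s) ¬h = there (∈-map⁺ just (Join.complete (¬h ∘ inj₁)
      (λ { refl → ¬h (inj₂ (trans (cong head εl) head-l)) })
      (λ { refl → ¬h (inj₂ (trans (cong head εr) head-r)) })))

  seq-par : ∀ {U n} → Seq U → label n ≡ par → ¬ U n → (B : Binary n) →
            U (tail (Binary.l B)) → U (tail (Binary.r B)) → Seq (λ x → U x ⊎ x ≡ n)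
  seq-par {U} {n} q p ¬u B ul ur
    with c , tc ← conclusion {n} (λ l → contradiction (trans (sym p) l) λ ())
       | sl , εl ← Seq.ε-sur q ul | sr , εr ← Seq.ε-sur q ur
    with ¬hl ← (λ h → ¬u (subst U (trans (cong head εl) (Binary.head-l B)) h))
       | ¬hr ← (λ h → ¬u (subst U (trans (cong head εr) (Binary.head-r B)) h))
    with ys , perm₁ ← ∈⇒↭∷ (Seq.complete q ¬hl)
    with ∈-resp-↭ perm₁ (Seq.complete q ¬hr)
  ... | here eq = contradiction (trans (sym εl) (trans (cong (Seq.ε q) (sym eq)) εr)) (Binary.l≢r B)
  ... | there sr∈
    with zs , perm₂ ← ∈⇒↭∷ sr∈
    with perm ← ↭-trans perm₁ (↭-prep sl perm₂)
    -- The ⅋ rule acts on the last two formulae, so `sl` and `sr` are moved to the end.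
    with Γ , π , der , eq ← derives-↭ {S = Seq.S q} (↭-trans perm (++-comm (sl ∷ sr ∷ []) zs)) (Seq.derives q)
    with refl ← trans eq (map-++ _ zs (sl ∷ sr ∷ [])) =
    seq-join real′ p (inj₁ refl) ¬u B {_∙_ = _⅋_} tc type-c εl εr zs [] joinable
      (_ , par _ f π , par der zs sl sr refl
        (Realizes.pend-not-target real′ (not-• εl head-l) ¬hl)
        (Realizes.pend-not-target real′ (not-• εr head-r) ¬hr) ,
       trans (cong (_++ _) (map-∘ zs)) (sym (map-++ _ (map just zs) (nothing ∷ []))))
    where
    open Seq q
    open Binary B
    real′ = realizes-withConclusions (zs ++ sl ∷ sr ∷ []) realizes
    type-c : type c ≡ type l ⅋ type r
    type-c = type-par c l r (trans (cong label tc) p)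
      (trans head-l (sym tc)) index-l (trans head-r (sym tc)) index-r
    f : Fragment (Structure.type S sl ⅋ Structure.type S sr)
    f = subst Fragment (trans type-c (sym (cong₂ _⅋_ (trans (type≡ sl) (cong type εl))
      (trans (type≡ sr) (cong type εr))))) (type-fragment c)
    not-• : ∀ {s a} → ε s ≡ a → head a ≡ n → label (head (ε s)) ≢ •
    not-• refl h b = contradiction (trans (sym p) (trans (cong label (sym h)) b)) λ ()
    joinable : Joinable _ real′ sl sr (zs ++ [])
    joinable = build (unique-resp-↭ perm unique)
      where
      drop₂ : ∀ {s} → s ≢ sl → s ≢ sr → s ∈ sl ∷ sr ∷ zs → s ∈ zs
      drop₂ ≢l ≢r (here eq)         = contradiction eq ≢l
      drop₂ ≢l ≢r (there (here eq)) = contradiction eq ≢r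
      drop₂ ≢l ≢r (there (there i)) = i
      build : Unique (sl ∷ sr ∷ zs) → Joinable _ real′ sl sr (zs ++ [])
      build ((_ ∷ l∉) ∷ r∉ ∷ u) = record
        { unique = subst Unique (sym (++-identityʳ zs)) u
        ; sound = λ i → let j = subst (_ ∈_) (++-identityʳ zs) i in
            sound (∈-resp-↭ (↭-sym perm) (there (there j))) ,
            (λ eq → All.lookup l∉ j (sym eq)) , (λ eq → All.lookup r∉ j (sym eq))
        ; complete = λ ¬h ≢l ≢r → subst (_ ∈_) (sym (++-identityʳ zs))
            (drop₂ ≢l ≢r (∈-resp-↭ perm (complete ¬h)))
        }

  seq-tens : ∀ {U V n} → Seq U → Seq V → (∀ {x} → U x → ¬ V x) → label n ≡ tens →
             ¬ U n → ¬ V n → (B : Binary n) →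
             U (tail (Binary.l B)) → V (tail (Binary.r B)) →
             Seq (λ x → (U x ⊎ V x) ⊎ x ≡ n)
  seq-tens {U} {V} {n} q q′ disjoint p ¬u ¬v B ul vr
    with c , tc ← conclusion {n} (λ l → contradiction (trans (sym p) l) λ ())
       | sl , εl ← Seq.ε-sur q ul | sr , εr ← Seq.ε-sur q′ vr
    with ¬hl ← (λ h → ¬u (subst U (trans (cong head εl) (Binary.head-l B)) h))
       | ¬hr ← (λ h → ¬v (subst V (trans (cong head εr) (Binary.head-r B)) h))
    with ys , perm₁ ← ∈⇒↭∷ (Seq.complete q ¬hl) | zs , perm₂ ← ∈⇒↭∷ (Seq.complete q′ ¬hr)
    -- The ⊗ rule takes the last formula of its left premise and the first of its right one.
    with Γ , π , der , eq ← derives-↭ {S = Seq.S q} (↭-trans perm₁ (++-comm (sl ∷ []) ys)) (Seq.derives q)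
       | Δ , ρ , der′ , refl ← derives-↭ {S = Seq.S q′} perm₂ (Seq.derives q′)
    with refl ← trans eq (map-++ _ ys (sl ∷ [])) =
    seq-join real″ p (inj₂ refl) [ ¬u , ¬v ]′ B {_∙_ = _⊗_} tc type-c εl εr
      (map inj₁ ys) (map inj₂ zs) joinable
      (_ , tens _ _ f π ρ , tens der der′ ys sl sr zs refl refl
        (Realizes.pend-not-target real (not-• εl head-l) ¬hl)
        (Realizes.pend-not-target real′ (not-• εr head-r) ¬hr) ,
       sym (trans (map-++ _ (map just (map inj₁ ys)) _)
         (cong₂ _++_ (trans (sym (map-∘ (map inj₁ ys))) (sym (map-∘ ys)))
           (cong (_ ∷_) (trans (sym (map-∘ (map inj₂ zs))) (sym (map-∘ zs)))))))
    where
    open Binary B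
    module A = Seq q
    module B′ = Seq q′
    real = realizes-withConclusions (ys ++ sl ∷ []) A.realizes
    real′ = realizes-withConclusions (sr ∷ zs) B′.realizes
    real″ = realizes-⊎ real real′ disjoint
    type-c : type c ≡ type l ⊗ type r
    type-c = type-tens c l r (trans (cong label tc) p)
      (trans head-l (sym tc)) index-l (trans head-r (sym tc)) index-r
    f : Fragment (Structure.type A.S sl ⊗ Structure.type B′.S sr)
    f = subst Fragment (trans type-c (sym (cong₂ _⊗_ (trans (A.type≡ sl) (cong type εl))
      (trans (B′.type≡ sr) (cong type εr))))) (type-fragment c)
    not-• : ∀ {a b} → b ≡ a → head a ≡ n → label (head b) ≢ •
    not-• refl h b = contradiction (trans (sym p) (trans (cong label (sym h)) b)) λ ()
    joinable : Joinable _ real″ (inj₁ sl) (inj₂ sr) (map inj₁ ys ++ map inj₂ zs)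
    joinable = build (unique-resp-↭ perm₁ A.unique) (unique-resp-↭ perm₂ B′.unique)
      where
      build : Unique (sl ∷ ys) → Unique (sr ∷ zs) →
              Joinable _ real″ (inj₁ sl) (inj₂ sr) (map inj₁ ys ++ map inj₂ zs)
      build (l∉ ∷ u) (r∉ ∷ v) = record
        { unique   = Uniqueₚ.++⁺ (Uniqueₚ.map⁺ inj₁-injective u) (Uniqueₚ.map⁺ inj₂-injective v)
                     λ { (i , j) → apart (∈-map⁻ inj₁ i) (∈-map⁻ inj₂ j) }
        ; sound    = λ i → sound′ (∈-++⁻ (map inj₁ ys) i)
        ; complete = λ { {inj₁ s} ¬h ≢l ≢r → ∈-++⁺ˡ (∈-map⁺ inj₁
                           (drop (≢l ∘ cong inj₁) (∈-resp-↭ perm₁ (A.complete (¬h ∘ inj₁)))))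
                       ; {inj₂ s} ¬h ≢l ≢r → ∈-++⁺ʳ (map inj₁ ys) (∈-map⁺ inj₂
                           (drop (≢r ∘ cong inj₂) (∈-resp-↭ perm₂ (B′.complete (¬h ∘ inj₂))))) }
        }
        where
        apart : ∀ {s} → ∃[ x ] x ∈ ys × s ≡ inj₁ x → ¬ (∃[ y ] y ∈ zs × s ≡ inj₂ y)
        apart (_ , _ , refl) (_ , _ , ())
        drop : ∀ {A : Set} {s t : A} {ts} → s ≢ t → s ∈ t ∷ ts → s ∈ ts
        drop ≢t (here eq) = contradiction eq ≢t
        drop ≢t (there i) = i
        sound′ : ∀ {s} → s ∈ map inj₁ ys ⊎ s ∈ map inj₂ zs →
                 ¬ (U (head ([ A.ε , B′.ε ]′ s)) ⊎ V (head ([ A.ε , B′.ε ]′ s))) ×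
                 s ≢ inj₁ sl × s ≢ inj₂ sr
        sound′ (inj₁ i) with s , j , refl ← ∈-map⁻ inj₁ i =
          [ A.sound (∈-resp-↭ (↭-sym perm₁) (there j)) ,
            (λ v → disjoint (A.ε-image s) (B′.up v)) ]′ ,
          (λ { refl → All.lookup l∉ j refl }) , λ ()
        sound′ (inj₂ i) with s , j , refl ← ∈-map⁻ inj₂ i =
          [ (λ u → disjoint (A.up u) (B′.ε-image s)) ,
            B′.sound (∈-resp-↭ (↭-sym perm₂) (there j)) ]′ ,
          (λ ()) , (λ { refl → All.lookup r∉ j refl })

  -- Only • nodes are missing from U, and those are the points pend a.
  seq-total : ∀ {U} → Seq U → (∀ n → label n ≢ • → U n) →
              ∃[ Γ ] Σ[ π ∈ ⊢ Γ ] π |⇒ record structure { jump = J }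
  seq-total {U} q all = Γ′ , π , iso der equal
    where
    open Seq q hiding (derives)
    module S = Structure S

    terminal : ∀ {a} → ¬ U (head a) → label (head a) ≡ •
    terminal {a} ¬u with label (head a) ≟ᴸ •
    ... | yes b = b
    ... | no ¬b = contradiction (all _ ¬b) ¬u

    node : Point → Node
    node = [ id , head ]′

    node-pend : ∀ a → node (pend a) ≡ head a
    node-pend a with label (head a) ≟ᴸ •
    ... | yes _ = refl
    ... | no _  = refl

    e-node≡ : ∀ x → e x ≡ inj₁ (node (e x))
    e-node≡ x with e-image x
    ... | inj₁ (n , eq , _) = trans eq (cong (inj₁ ∘ node) (sym eq))
    ... | inj₂ (a , eq , _ , ¬u) = trans eq
      (trans (pend-• (terminal ¬u)) (cong inj₁ (sym (trans (cong node eq) (node-pend a)))))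

    node-sur : ∀ n → ∃[ x ] node (e x) ≡ n
    node-sur n with label n ≟ᴸ •
    ... | no ¬b = let x , eq = e-sur-node (all n ¬b) in x , cong node eq
    ... | yes b with a , refl ← •-premise b =
      let x , eq = e-sur-pend (all (tail a) (tail-• a)) (λ u → proper u b) in
      x , trans (cong node eq) (node-pend a)

    arc-sur : ∀ a → ∃[ s ] ε s ≡ a
    arc-sur a = ε-sur (all (tail a) (tail-• a))

    ↔-from : ∀ {A B : Set} (f : A → B) → (∀ {x y} → f x ≡ f y → x ≡ y) → (∀ y → ∃[ x ] f x ≡ y) → A ↔ B
    ↔-from f inj sur = mk↔ₛ′ f (proj₁ ∘ sur) (proj₂ ∘ sur) λ x → inj (proj₂ (sur (f x)))

    -- Both lists are duplicate-free and consist of the arcs into • nodes, so exchange rules lead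
    -- from the order obtained to the one prescribed by R.
    perm : map ε cs ↭ conclusions
    perm = ∼bag⇒↭ (unique∧set⇒bag (Uniqueₚ.map⁺ ε-inj unique) conclusions-unique
      (mk⇔ forth back))
      where
      forth : ∀ {a} → a ∈ map ε cs → a ∈ conclusions
      forth i with s , j , refl ← ∈-map⁻ ε i =
        Equivalence.from (conclusions-complete (ε s)) (terminal (sound j))
      back : ∀ {a} → a ∈ conclusions → a ∈ map ε cs
      back {a} i with s , refl ← arc-sur a =
        ∈-map⁺ ε (complete λ u → proper u (Equivalence.to (conclusions-complete (ε s)) i))

    cs′ : List S.Arc
    cs′ = map (proj₁ ∘ arc-sur) conclusions

    perm′ : cs ↭ cs′
    perm′ = ↭-trans (↭-reflexive (trans (sym (map-id cs))
      (trans (map-cong (λ s → sym (ε-inj (proj₂ (arc-sur (ε s))))) cs) (map-∘ cs))))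
      (map⁺ (proj₁ ∘ arc-sur) perm)

    derives : Derives S cs′
    derives = derives-↭ {S = S} perm′ (Seq.derives q)

    Γ′  = proj₁ derives
    π   = proj₁ (proj₂ derives)
    der = proj₁ (proj₂ (proj₂ derives))

    equal : withConclusions S cs′ ≅ record structure { jump = J }
    equal = record
      { nodes       = ↔-from (node ∘ e)
          (λ {x} {y} eq → e-inj (trans (e-node≡ x) (trans (cong inj₁ eq) (sym (e-node≡ y))))) node-sur
      ; arcs        = ↔-from ε ε-inj arc-sur
      ; tail        = λ s → sym (cong node (tail≡ s))
      ; head        = head≡
      ; label       = λ x → sym (trans (label≡ x) (cong pointLabel (e-node≡ x)))
      ; type        = λ s → sym (type≡ s)
      ; index       = index≡
      ; conclusions = sym (trans (sym (map-∘ conclusions))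
          (trans (map-cong (proj₂ ∘ arc-sur) conclusions) (map-id conclusions)))
      ; jump        = jump≡′
      }
      where
      head≡ : ∀ s → head (ε s) ≡ node (e (S.head s))
      head≡ s with U? (head (ε s))
      ... | yes u = sym (cong node (head∈ u))
      ... | no ¬u = sym (trans (cong node (head∉ ¬u)) (node-pend (ε s)))
      index≡ : ∀ s → index (ε s) ≡ S.index s
      index≡ s with U? (head (ε s))
      ... | yes u = sym (index∈ u)
      ... | no ¬u = trans (•-index (terminal ¬u)) (sym (index∉ ¬u))
      jump≡′ : ∀ x → J (node (e x)) ≡ Maybe.map (node ∘ e) (S.jump x)
      jump≡′ x = sym (trans (Maybeₚ.map-∘ (S.jump x)) (trans (cong (Maybe.map node)
        (trans (jump≡ x) (cong pointJump (e-node≡ x))))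
        (trans (sym (Maybeₚ.map-∘ (J (node (e x))))) (Maybeₚ.map-id _))))

-- Switchings and connectedness

record Enumeration {A : Set} (P : A → Set) (k : ℕ) : Set where
  field
    at     : Fin k → A
    at-P   : ∀ i → P (at i)
    at-inj : ∀ {i j} → at i ≡ at j → i ≡ j
    at-sur : ∀ a → P a → ∃[ i ] at i ≡ a

module _ {A : Set} {P : A → Set} (P? : ∀ a → Dec (P a)) where

  enumerateVec : ∀ {n} (xs : Vec A n) → Enumeration (P ∘ lookup xs) (count P? xs)
  enumerateVec [] = record { at = λ () ; at-P = λ () ; at-inj = λ { {()} } ; at-sur = λ () }
  enumerateVec (x ∷ xs) with P? x
  ... | no ¬p = record
    { at     = suc ∘ at
    ; at-P   = at-P
    ; at-inj = at-inj ∘ Fin.suc-injective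
    ; at-sur = λ { zero p → contradiction p ¬p ; (suc i) p → let j , eq = at-sur i p in j , cong suc eq }
    }
    where open Enumeration (enumerateVec xs)
  ... | yes p = record
    { at     = λ { zero → zero ; (suc i) → suc (at i) }
    ; at-P   = λ { zero → p ; (suc i) → at-P i }
    ; at-inj = λ { {zero} {zero} _ → refl ; {suc i} {suc j} eq → cong suc (at-inj (Fin.suc-injective eq)) }
    ; at-sur = λ { zero _ → zero , refl ; (suc i) p → let j , eq = at-sur i p in suc j , cong suc eq }
    }
    where open Enumeration (enumerateVec xs)

  -- Turns the number `#w`, a count over a vector, into that many distinct ⊥ nodes; applied to core
  -- nodes it also provides the initial classes.
  enumerate : ∀ {n} (A↔ : A ↔ Fin n) → Enumeration P (count P? (tabulate (Inverse.from A↔)))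
  enumerate A↔ = record
    { at     = from ∘ at
    ; at-P   = λ i → subst P (lookup∘tabulate from (at i)) (at-P i)
    ; at-inj = λ {i} {j} eq → at-inj
        (trans (sym (strictlyInverseˡ (at i))) (trans (cong to eq) (strictlyInverseˡ (at j))))
    ; at-sur = λ a p → let i , eq = at-sur (to a)
                             (subst P (sym (trans (lookup∘tabulate from (to a)) (strictlyInverseʳ a))) p)
                       in i , trans (cong from eq) (strictlyInverseʳ a)
    }
    where
    open Inverse A↔
    open Enumeration (enumerateVec (tabulate from))

module Switchings {𝒜 : Atoms} (R : ProofStructure 𝒜) where
  open Basics R

  IsCore : Node → Set
  IsCore n = ¬ Erasing n × label n ≢ •

  Core : Set
  Core = Σ Node IsCore

  core? : ∀ n → Dec (IsCore n)
  core? n = ¬? (erasing? n) ×-dec ¬? (label n ≟ᴸ •)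

  core-tail : ∀ {a} → ¬ Erasing (tail a) → IsCore (tail a)
  core-tail {a} ¬e = ¬e , tail-• a

  •-erasing : ∀ {a} → label (head a) ≡ • → Erasing (tail a) → Erasing (head a)
  •-erasing {a} b e = erasing (inj₂ (inj₂ b)) λ c h →
    subst (Erasing ∘ tail) (•-premise-≡ b (sym h)) e

  module _ (φ : Switching) where

    switched-¬par : ∀ {a} → label (head a) ≢ par → switchedHead φ a ≡ inj₁ (head a)
    switched-¬par {a} ¬p with label (head a) ≟ᴸ par
    ... | yes p = contradiction p ¬p
    ... | no _  = refl

    Kept : Arc → Set
    Kept a = ∀ p → proj₁ (φ (head a , p)) ≡ a

    switched-kept : ∀ {a} → Kept a → switchedHead φ a ≡ inj₁ (head a)
    switched-kept {a} s with label (head a) ≟ᴸ par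
    ... | no _  = refl
    ... | yes p with proj₁ (φ (head a , p)) ≟ᴬ a
    ...   | yes _ = refl
    ...   | no ¬s = contradiction (s p) ¬s

    switched-lost : ∀ {a} p → proj₁ (φ (head a , p)) ≢ a → switchedHead φ a ≡ inj₂ (head a , p)
    switched-lost {a} p ¬s with label (head a) ≟ᴸ par
    ... | no ¬p = contradiction p ¬p
    ... | yes p′ with proj₁ (φ (head a , p′)) ≟ᴬ a
    ...   | yes s = contradiction (trans (cong (λ p → proj₁ (φ (head a , p))) (uip p p′)) s) ¬s
    ...   | no _  = cong (λ p → inj₂ (head a , p)) (uip p′ p)

    -- Every erasing node is connected to exactly one ⊥ node; together with the two values of s
    -- this would make one component more than ACC allows.
    module _ (avoids : ∀ {n} p → ¬ Erasing n → ¬ Erasing (tail (proj₁ (φ (n , p)))))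
             (s : Core → Bool)
             (s-kept : ∀ {a} → Kept a → ∀ t h → s (tail a , t) ≡ s (head a , h)) where
      private
        origin : ∀ {n} → Erasing n → Node
        origin {n} (erasing (inj₁ _) _) = n
        origin {n} (erasing (inj₂ (inj₁ p)) ps) = origin (ps (proj₁ (φ (n , p))) (proj₂ (φ (n , p))))
        origin {n} (erasing (inj₂ (inj₂ b)) ps) = origin (ps _ (proj₂ (•-premise b)))

        clash : ∀ {A : Set} {n l l′} → label n ≡ l → label n ≡ l′ → l ≢ l′ → A
        clash p q ≢ = contradiction (trans (sym p) q) ≢

        origin-unique : ∀ {n} (e e′ : Erasing n) → origin e ≡ origin e′
        origin-unique (erasing (inj₁ _) _) (erasing (inj₁ _) _) = refl
        origin-unique (erasing (inj₂ (inj₁ p)) ps) (erasing (inj₂ (inj₁ q)) qs)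
          with refl ← uip p q = origin-unique (ps _ _) (qs _ _)
        origin-unique (erasing (inj₂ (inj₂ p)) ps) (erasing (inj₂ (inj₂ q)) qs)
          with refl ← uip p q = origin-unique (ps _ _) (qs _ _)
        origin-unique (erasing (inj₁ p) _) (erasing (inj₂ (inj₁ q)) _) = clash p q λ ()
        origin-unique (erasing (inj₁ p) _) (erasing (inj₂ (inj₂ q)) _) = clash p q λ ()
        origin-unique (erasing (inj₂ (inj₁ p)) _) (erasing (inj₁ q) _) = clash p q λ ()
        origin-unique (erasing (inj₂ (inj₂ p)) _) (erasing (inj₁ q) _) = clash p q λ ()
        origin-unique (erasing (inj₂ (inj₁ p)) _) (erasing (inj₂ (inj₂ q)) _) = clash p q λ ()
        origin-unique (erasing (inj₂ (inj₂ p)) _) (erasing (inj₂ (inj₁ q)) _) = clash p q λ ()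

        ¬erasing-•-premise : ∀ {n} (b : label n ≡ •) → ¬ Erasing n → ¬ Erasing (tail (proj₁ (•-premise b)))
        ¬erasing-•-premise b ¬e e = ¬e (subst Erasing (proj₂ (•-premise b))
          (•-erasing (trans (cong label (proj₂ (•-premise b))) b) e))

        -- Designed to be constant on components: an erasing node is coloured by the ⊥ node reached
        -- upwards along kept premises, a core node by `s`, and a non-erasing • node like the tail
        -- of its premise. Nodes of different colours then lie in different components.
        colour : Node → Node ⊎ Bool
        colour n with erasing? n | label n ≟ᴸ •
        ... | yes e | _     = inj₁ (origin e)
        ... | no ¬e | yes b = inj₂ (s (tail (proj₁ (•-premise b)) , core-tail (¬erasing-•-premise b ¬e)))
        ... | no ¬e | no ¬b = inj₂ (s (n , ¬e , ¬b))

        colour-erasing : ∀ {n} (e : Erasing n) → colour n ≡ inj₁ (origin e)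
        colour-erasing {n} e with erasing? n | label n ≟ᴸ •
        ... | yes e′ | _ = cong inj₁ (origin-unique e′ e)
        ... | no ¬e  | _ = contradiction e ¬e

        colour-core : ∀ {n} (c : IsCore n) → colour n ≡ inj₂ (s (n , c))
        colour-core {n} (¬e , ¬b) with erasing? n | label n ≟ᴸ •
        ... | yes e | _     = contradiction e ¬e
        ... | no _  | yes b = contradiction b ¬b
        ... | no _  | no _  = refl

        colour-• : ∀ {a} → label (head a) ≡ • → (c : IsCore (tail a)) → colour (head a) ≡ inj₂ (s (tail a , c))
        colour-• {a} b (¬e , ¬b) with erasing? (head a) | label (head a) ≟ᴸ •
        ... | yes e | _     = contradiction (erasing-premise e) ¬e
        ... | no _  | no ¬b = contradiction b ¬b
        ... | no ¬e′ | yes b′ = cong inj₂ (same (•-premise-≡ b (sym (proj₂ (•-premise b′)))))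
          where
          same : ∀ {a b c c′} → a ≡ b → s (tail b , c) ≡ s (tail a , c′)
          same refl = refl

        other : ⅋Node → Arc
        other (n , p) with proj₁ (φ (n , p)) ≟ᴬ Binary.l (par-binary p)
        ... | yes _ = Binary.r (par-binary p)
        ... | no _  = Binary.l (par-binary p)

        other-lost : ∀ {a} p → proj₁ (φ (head a , p)) ≢ a → other (head a , p) ≡ a
        other-lost {a} p ¬s
          with proj₁ (φ (head a , p)) ≟ᴬ Binary.l (par-binary p)
             | Binary.cover (par-binary p) a refl
        ... | yes eq | inj₁ a≡l = contradiction (trans eq (sym a≡l)) ¬s
        ... | yes eq | inj₂ a≡r = sym a≡r
        ... | no _   | inj₁ a≡l = sym a≡l
        ... | no ¬l  | inj₂ a≡r with Binary.cover (par-binary p) _ (proj₂ (φ (head a , p)))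
        ...   | inj₁ eq = contradiction eq ¬l
        ...   | inj₂ eq = contradiction (trans eq (sym a≡r)) ¬s

        colour′ : Node ⊎ ⅋Node → Node ⊎ Bool
        colour′ = [ colour , colour ∘ tail ∘ other ]′

        kept-core : ∀ {a} → Kept a → IsCore (tail a) → IsCore (head a) → colour (tail a) ≡ colour (head a)
        kept-core k t h = trans (colour-core t) (trans (cong inj₂ (s-kept k t h)) (sym (colour-core h)))

        -- A kept arc never leads from an erasing node to a core node: at a ⊗ node by the fragment,
        -- at a non-erasing ⅋ node by `avoids`. An erasing ⅋ or • node shares the origin of its kept
        -- premise, and a lost arc ends in a fresh • node that `colour′` colours like the tail of
        -- that arc.
        colour-arc : ∀ a {l} → label (head a) ≡ l → colour (tail a) ≡ colour′ (switchedHead φ a)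
        colour-arc a {par} eq with proj₁ (φ (head a , eq)) ≟ᴬ a
        ... | no ¬s = sym (trans (cong colour′ (switched-lost eq ¬s)) (cong (colour ∘ tail) (other-lost eq ¬s)))
        ... | yes s = trans (by (erasing? (head a))) (cong colour′ (sym (switched-kept kept)))
          where
          kept : Kept a
          kept p = trans (cong (λ p → proj₁ (φ (head a , p))) (uip p eq)) s
          by : Dec (Erasing (head a)) → colour (tail a) ≡ colour (head a)
          by (no ¬e) = kept-core kept (core-tail (avoids eq ¬e ∘ subst (Erasing ∘ tail) (sym s)))
                         (¬e , λ b → contradiction (trans (sym eq) b) λ ())
          by (yes (erasing _ ps)) = trans (cong (colour ∘ tail) (sym s))
            (trans (colour-erasing (ps _ (proj₂ (φ (head a , eq)))))
              (sym (colour-erasing (erasing (inj₂ (inj₁ eq)) ps))))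
        colour-arc a {•} eq = trans (by (erasing? (tail a)))
            (cong colour′ (sym (switched-¬par λ p → contradiction (trans (sym eq) p) λ ())))
          where
          by : Dec (Erasing (tail a)) → colour (tail a) ≡ colour (head a)
          by (no ¬e) = trans (colour-core (core-tail ¬e)) (sym (colour-• eq (core-tail ¬e)))
          by (yes e) with erasing _ ps ← •-erasing eq e =
            trans (cong (colour ∘ tail) (•-premise-≡ eq (sym (proj₂ (•-premise eq)))))
              (trans (colour-erasing (ps _ (proj₂ (•-premise eq))))
                (sym (colour-erasing (erasing (inj₂ (inj₂ eq)) ps))))
        colour-arc a {tens} eq = trans
            (kept-core (λ p → contradiction (trans (sym eq) p) λ ()) (core-tail (tens-premise a eq))
              ((λ e → not-erasable (subst Lab eq (erasing-label e))) , λ b → contradiction (trans (sym eq) b) λ ()))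
            (cong colour′ (sym (switched-¬par λ p → contradiction (trans (sym eq) p) λ ())))
          where
          Lab : Label → Set
          Lab l = l ≡ bot ⊎ l ≡ par ⊎ l ≡ •
          not-erasable : ¬ Lab tens
          not-erasable (inj₂ (inj₁ ()))
          not-erasable (inj₂ (inj₂ ()))
        colour-arc a {ax} eq = contradiction refl (premiseless (cong #premises eq))
        colour-arc a {one} eq = contradiction refl (premiseless (cong #premises eq))
        colour-arc a {bot} eq = contradiction refl (premiseless (cong #premises eq))

      kept-invariant-constant : JumpFree → ACC#w → ∀ x y → s x ≡ s y
      kept-invariant-constant jumpFree correct x y with s x Bool.≟ s y
      ... | yes eq  = eq
      ... | no s≢ = contradiction
        (ℕ.≤-trans (Fin.injective⇒≤ {f = f} (λ {i} {j} → f-injective i j))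
          -- `x`, `y` and the ⊥ nodes are `#w + 2` points in pairwise different components, but
          -- there are at most `#w + 1` components.
          (ℕ.≤-trans (ℕ.+-monoˡ-≤ 1 (ℕ.m∸n≤m #w #dom)) (ℕ.≤-reflexive (ℕ.+-comm #w 1))))
        (ℕ.<-irrefl refl)
        where
        component = proj₁ (proj₂ (correct φ))

        colour-connected : ∀ {u v} → component u ≡ component v → colour′ u ≡ colour′ v
        colour-connected {u} {v} eq = EqC.gfold isEquivalence colour′ arrow
          (Equivalence.to (proj₂ (proj₂ (proj₂ (correct φ))) u v) eq)
          where
          arrow : ∀ {u v} → Graph.Arrow (switchingGraph φ) u v → colour′ u ≡ colour′ v
          arrow (inj₁ a , refl , refl) = colour-arc a refl
          arrow (inj₂ (n , t , eq) , _) = contradiction (trans (sym (jumpFree n)) eq) λ ()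

        open Enumeration (enumerate (λ n → label n ≟ᴸ bot) nodes)

        point : Fin (suc (suc #w)) → Node
        point zero          = proj₁ x
        point (suc zero)    = proj₁ y
        point (suc (suc i)) = at i

        f : Fin (suc (suc #w)) → Fin (#w ∸ #dom + 1)
        f = component ∘ inj₁ ∘ point

        value : Fin (suc (suc #w)) → Node ⊎ Bool
        value zero          = inj₂ (s x)
        value (suc zero)    = inj₂ (s y)
        value (suc (suc i)) = inj₁ (at i)

        colour-point : ∀ i → colour (point i) ≡ value i
        colour-point zero          = colour-core (proj₂ x)
        colour-point (suc zero)    = colour-core (proj₂ y)
        colour-point (suc (suc i)) = colour-erasing (erasing-bot (at-P i))

        value-injective : ∀ i j → value i ≡ value j → i ≡ j
        value-injective zero          zero          _  = refl
        value-injective zero          (suc zero)    eq = contradiction (inj₂-injective eq) s≢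
        value-injective (suc zero)    zero          eq = contradiction (sym (inj₂-injective eq)) s≢
        value-injective (suc zero)    (suc zero)    _  = refl
        value-injective (suc (suc i)) (suc (suc j)) eq = cong (λ k → suc (suc k)) (at-inj (inj₁-injective eq))

        f-injective : ∀ i j → f i ≡ f j → i ≡ j
        f-injective i j eq = value-injective i j
          (trans (sym (colour-point i)) (trans (colour-connected eq) (colour-point j)))

-- Merging blocks

module Construction {𝒜 : Atoms} (R : ProofStructure 𝒜)
    (jumpFree : ProofStructure.JumpFree R) (correct : ProofStructure.ACC#w R)
    (m : ProofStructure.Node R) (¬em : ¬ ProofStructure.Erasing R m)
    (J : ProofStructure.Node R → Maybe (ProofStructure.Node R))
    (canonical : ProofStructure.IsCanonicalJump R m J) where
  open Basics R
  open CanonicalJump m ¬em J canonical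
  open Sequentialization R J jump-label
  open Switchings R

  up-≼ : ∀ {U} (q : Seq U) {x y} → x ≼ y → U y → U x
  up-≼ q (inj₁ refl) u = u
  up-≼ q (inj₂ [ a , refl , refl ]⁺) u = Seq.up q u
  up-≼ q (inj₂ ((a , refl , refl) ∷ p)) u = Seq.up q (up-≼ q (inj₂ p) u)

  -- The second case is needed because `m` may be a • node: it is then available as soon as the tail
  -- of its premise is.
  Target : (Node → Set) → Node → Set
  Target U t = U t ⊎ (label t ≡ • × ∃[ a ] head a ≡ t × U (tail a))

  target-mono : ∀ {U V t} → (∀ {x} → U x → V x) → Target U t → Target V t
  target-mono f (inj₁ u)               = inj₁ (f u)
  target-mono f (inj₂ (b , a , h , u)) = inj₂ (b , a , h , f u)

  target-point : ∀ {U t} (q : Seq U) → Target U t → ∃[ x ] Seq.e q x ≡ inj₁ t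
  target-point q (inj₁ u) = Seq.e-sur-node q u
  target-point q (inj₂ (b , a , refl , u)) =
    let x , eq = Seq.e-sur-pend q u (λ u′ → Seq.proper q u′ b) in x , trans eq (pend-• b)

  record Extension (U : Node → Set) (n : Node) (New : Node → Set) : Set₁ where
    field
      V    : Node → Set
      seq  : Seq V
      ⊇U   : ∀ {x} → U x → V x
      ∋n   : V n
      only : ∀ {x} → V x → U x ⊎ New x

  -- Adds the tree above `n` from its ⊥ leaves downwards; a part of it may be present already. The
  -- bound `_≼ n` on the new nodes keeps `n` itself out until both premises are in: by acyclicity
  -- `n` is not above its own premises.
  addErasing : ∀ {U n} → Seq U → Erasing n → label n ≢ • →
               (∀ {x t} → x ≼ n → J x ≡ just t → Target U t) → Extension U n (_≼ n)
  addErasing {U} {n} q e ¬• targets with Seq.U? q n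
  ... | yes u = record { seq = q ; ⊇U = id ; ∋n = u ; only = inj₁ }
  addErasing {U} {n} q (erasing (inj₁ b) _) ¬• targets | no ¬u
    with t , jn ← jump-total b
    with x , eq ← target-point q (targets (inj₁ refl) jn) = record
    { seq  = seq-bot q b ¬u (x , trans (cong (Maybe.map inj₁) jn) (cong just (sym eq)))
    ; ⊇U   = inj₁
    ; ∋n   = inj₂ refl
    ; only = Sum.map id inj₁
    }
  addErasing {U} {n} q (erasing (inj₂ (inj₁ p)) ps) ¬• targets | no ¬u = record
    { seq  = seq-par E₂.seq p ¬n B (E₂.⊇U E₁.∋n) E₂.∋n
    ; ⊇U   = inj₁ ∘ E₂.⊇U ∘ E₁.⊇U
    ; ∋n   = inj₂ refl
    ; only = [ only , inj₂ ∘ inj₁ ]′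
    }
    where
    B = par-binary p
    open Binary B
    below : ∀ {a x} → head a ≡ n → x ≼ tail a → x ≼ n
    below h x≼ = inj₂ (≼-≺-trans x≼ (arc≺ h))
    module E₁ = Extension (addErasing q (ps l head-l) (tail-• l) (targets ∘ below head-l))
    module E₂ = Extension (addErasing E₁.seq (ps r head-r) (tail-• r)
      (λ x≼ → target-mono E₁.⊇U ∘ targets (below head-r x≼)))
    only : ∀ {x} → E₂.V x → U x ⊎ x ≼ n
    only v = [ Sum.map id (below head-l) ∘ E₁.only , inj₂ ∘ below head-r ]′ (E₂.only v)
    below≢ : ∀ {a} → head a ≡ n → ¬ n ≼ tail a
    below≢ h n≼ = acyclic n (≼-≺-trans n≼ (arc≺ h))
    ¬n : ¬ E₂.V n
    ¬n v = [ [ ¬u , below≢ head-l ]′ ∘ E₁.only , below≢ head-r ]′ (E₂.only v)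
  addErasing q (erasing (inj₂ (inj₂ b)) _) ¬• targets | no ¬u = contradiction b ¬•

  -- By `down`, an erasing node belongs to a block only together with the path leading from it down
  -- to a core node. No block can thus seize an erasing tree that is due at a ⅋ node outside it.
  record Block (C : Core → Set) : Set₁ where
    field
      U      : Node → Set
      seq    : Seq U
      core→  : ∀ {x} → C x → U (proj₁ x)
      core←  : ∀ {x} → U (proj₁ x) → C x
      down   : ∀ {a} → U (tail a) → Erasing (tail a) → U (head a)

  block-map : ∀ {C D} → (∀ {x} → C x → D x) → (∀ {x} → D x → C x) → Block C → Block D
  block-map f g b = record { Block b hiding (core→; core←) ; core→ = core→ ∘ g ; core← = f ∘ core← }
    where open Block b

  -- From a common erasing node, `down` leads to a common node strictly below it; the descent ends
  -- at a common core node, which `apart` excludes.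
  blocks-disjoint : ∀ {C D} (b : Block C) (b′ : Block D) → (∀ {x} → C x → ¬ D x) →
                    ∀ {n} → Block.U b n → ¬ Block.U b′ n
  blocks-disjoint b b′ apart {n} = go n (≻-wellFounded n)
    where
    module B = Block b
    module B′ = Block b′
    go : ∀ n → Acc (flip _≺_) n → B.U n → ¬ B′.U n
    go n (acc rec) u u′ with erasing? n
    ... | no ¬e = apart (B.core← {n , ¬e , Seq.proper B.seq u} u) (B′.core← u′)
    ... | yes e with c , refl ← conclusion (Seq.proper B.seq u) =
      go (head c) (rec (arc≺ refl)) (B.down u e) (B′.down u′ e)

  -- Switchings that avoid erasing premises and, where possible, given arcs

  module Avoiding (P : Arc → Set) (P? : ∀ a → Dec (P a)) where
    Right : ∀ {n} → Binary n → Set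
    Right B = ¬ Erasing (tail r) × (Erasing (tail l) ⊎ P l)
      where open Binary B

    right? : ∀ {n} (B : Binary n) → Dec (Right B)
    right? B = ¬? (erasing? (tail r)) ×-dec (erasing? (tail l) ⊎-dec P? l)
      where open Binary B

    -- At each ⅋ node a core premise outside `P` is preferred, then any core premise. An erasing
    -- premise is kept only if both are erasing, and a premise in `P` only if the other one is
    -- erasing or in `P` too (`φ-forced`).
    φ : Switching
    φ (n , p) with right? (par-binary p)
    ... | no _  = Binary.l (par-binary p) , Binary.head-l (par-binary p)
    ... | yes _ = Binary.r (par-binary p) , Binary.head-r (par-binary p)

    φ-avoids : ∀ {n} p → ¬ Erasing n → ¬ Erasing (tail (proj₁ (φ (n , p))))
    φ-avoids {n} p ¬e with right? (par-binary p)
    ... | yes (¬r , _) = ¬r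
    ... | no ¬right    = λ el → ¬e (erasing (inj₂ (inj₁ p)) λ a h →
        [ (λ { refl → el }) , (λ { refl → decidable-stable (erasing? _) λ ¬r → ¬right (¬r , inj₁ el) }) ]′
        (cover a h))
      where open Binary (par-binary p)

    φ-forced : ∀ {a} p → proj₁ (φ (head a , p)) ≡ a → P a →
               ∀ b → head b ≡ head a → Erasing (tail b) ⊎ P b
    φ-forced {a} p eq pa b h with right? (par-binary p) | Binary.cover (par-binary p) b h
    φ-forced {a} p eq pa b h | yes (_ , pl) | inj₁ refl = pl
    φ-forced {a} p eq pa b h | yes _        | inj₂ refl = inj₂ (subst P (sym eq) pa)
    φ-forced {a} p eq pa b h | no _         | inj₁ refl = inj₂ (subst P (sym eq) pa)
    φ-forced {a} p eq pa b h | no ¬right    | inj₂ refl = inj₁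
      (decidable-stable (erasing? _) λ ¬r → ¬right (¬r , inj₂ (subst P (sym eq) pa)))

  -- The reference switching: the paths inside classes and all cycles derived later live in its
  -- switching graph.
  module φ₀ = Avoiding (λ _ → ⊥) (λ _ → no id)
  φ₀ : Switching
  φ₀ = φ₀.φ

  G₀ : Graph
  G₀ = switchingGraph φ₀

  _≟ᴳ_ : DecidableEquality (Graph.Arc G₀)
  _≟ᴳ_ = Sumₚ.≡-dec _≟ᴬ_ λ (n , t , eq) _ → contradiction (trans (sym (jumpFree n)) eq) λ ()

  open Trails G₀ _≟ᴳ_

  acyclic₀ : ¬ Graph.UndirectedCycle G₀
  acyclic₀ = proj₁ (correct φ₀)

  module Classes {k : ℕ} (cl : Core → Fin k) (done : Fin k → Bool) where
    Done : Core → Set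
    Done x = T (done (cl x))

    -- Decided by the head alone: blocks are upward closed, so a core tail lies in the same block.
    -- An arc into a pending node is never inner, and this makes it a new arc for `closeCycle` and
    -- `tooManyArcs`.
    Inner : Graph.Arc G₀ → Set
    Inner (inj₁ a) = Σ[ h ∈ IsCore (head a) ] Done (head a , h)
    Inner (inj₂ _) = ⊥

  at : Core → Graph.Node G₀
  at (n , _) = inj₁ n

  -- The number `k` of classes is the termination measure. `linked` lets each class act as a single
  -- vertex in the search for cycles; being stated with inner arcs, it leaves the arcs into pending
  -- nodes free to close them.
  record State (k : ℕ) : Set₁ where
    field
      cl      : Core → Fin k
      rp      : Fin k → Core
      cl-rp   : ∀ i → cl (rp i) ≡ i
      done    : Fin k → Bool
    open Classes cl done public
    field
      block   : ∀ {i} → T (done i) → Block (λ x → cl x ≡ i)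
      joint   : ∀ {i} → ¬ T (done i) → label (proj₁ (rp i)) ≡ tens ⊎ label (proj₁ (rp i)) ≡ par
      single  : ∀ {i} → ¬ T (done i) → ∀ {x} → cl x ≡ i → x ≡ rp i
      linked  : ∀ {x y} → cl x ≡ cl y → Linked Inner (at x) (at y)

    Into : (Fin k → Set) → Graph.Arc G₀ → Set
    Into S a = Inner a ⊎ ∃[ b ] a ≡ inj₁ b × Σ[ h ∈ IsCore (head b) ] S (cl (head b , h))

    up-class : ∀ {a} t h → Done (head a , h) → cl (tail a , t) ≡ cl (head a , h)
    up-class {a} t h d = core← (Seq.up seq (core→ refl))
      where open Block (block d)

  module _ {k} (st : State k) where
    open State st

    -- The bookkeeping common to the ⊗ and the ⅋ step: the classes in `S` become one class with
    -- block `new`. The arcs allowed by `Into S` are inner after the contraction, so `linked′`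
    -- restores the invariant.
    module Extend {S : Fin k → Set} (S? : ∀ i → Dec (S i)) (mg : Merge S) (new : Block (S ∘ cl))
        (linked′ : ∀ {x y} → S (cl x) → S (cl y) → Linked (Into S) (at x) (at y)) where
      open Merge mg

      done′ : Fin k′ → Bool
      done′ i = ⌊ S? (σ i) ⌋ ∨ done (σ i)

      back : ∀ i → σ (μ i) ≡ i ⊎ (S (σ (μ i)) × S i)
      back i = μ-≡ (μ∘σ (μ i))

      done-S : ∀ {i} → S i → T (done′ (μ i))
      done-S {i} s with S? (σ (μ i)) | back i
      ... | yes _ | _ = _
      ... | no ¬s | inj₁ eq = contradiction (subst S (sym eq) s) ¬s
      ... | no ¬s | inj₂ (s′ , _) = contradiction s′ ¬s

      done-old : ∀ {i} → T (done i) → T (done′ (μ i))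
      done-old {i} d with S? (σ (μ i)) | back i
      ... | yes _ | _ = _
      ... | no _  | inj₁ eq = subst (T ∘ done) (sym eq) d
      ... | no ¬s | inj₂ (s′ , _) = contradiction s′ ¬s

      μ≡⇒ : ∀ {x i} → ¬ S (σ i) → μ (cl x) ≡ i → cl x ≡ σ i
      μ≡⇒ {x} {i} ¬s eq with μ-≡ (trans eq (sym (μ∘σ i)))
      ... | inj₁ eq′ = eq′
      ... | inj₂ (_ , s) = contradiction s ¬s

      ⇒μ≡ : ∀ {x i} → cl x ≡ σ i → μ (cl x) ≡ i
      ⇒μ≡ eq = trans (cong μ eq) (μ∘σ _)

      state : State k′
      state = record
        { cl     = μ ∘ cl
        ; rp     = rp ∘ σ
        ; cl-rp  = λ i → trans (cong μ (cl-rp (σ i))) (μ∘σ i)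
        ; done   = done′
        ; block  = block′
        ; joint  = λ ¬d → joint (λ d → ¬d (Equivalence.from T-∨ (inj₂ d)))
        ; single = λ ¬d eq → single (λ d → ¬d (Equivalence.from T-∨ (inj₂ d)))
            (μ≡⇒ (λ s → ¬d (Equivalence.from T-∨ (inj₁ (fromWitness {a? = S? _} s)))) eq)
        ; linked = linked″
        }
        where
        open Classes (μ ∘ cl) done′ using () renaming (Inner to Inner′)

        block′ : ∀ {i} → T (done′ i) → Block (λ x → μ (cl x) ≡ i)
        block′ {i} d with S? (σ i)
        ... | yes s = block-map
                (λ s′ → trans (μ-S s′ s) (μ∘σ i))
                (λ eq → [ (λ eq′ → subst S (sym eq′) s) , proj₁ ]′ (μ-≡ (trans eq (sym (μ∘σ i))))) new
        ... | no ¬s = block-map ⇒μ≡ (μ≡⇒ ¬s) (block d)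

        grow : ∀ {a} → Inner a → Inner′ a
        grow {inj₁ a} (h , d) = h , done-old d

        linked″ : ∀ {x y} → μ (cl x) ≡ μ (cl y) → Linked Inner′ (at x) (at y)
        linked″ eq with μ-≡ eq
        ... | inj₁ eq′ = linked-map grow (linked eq′)
        ... | inj₂ (s , s′) = linked-map [ grow , (λ { (b , refl , h , s) → h , done-S s }) ]′ (linked′ s s′)

  -- `IsCore` is a pair of negations, and these are proof-irrelevant by definition.
  core-≡ : ∀ {x y : Core} → proj₁ x ≡ proj₁ y → x ≡ y
  core-≡ refl = refl

  φ₀-kept : ∀ {n} (p : label n ≡ par) → Kept φ₀ (proj₁ (φ₀ (n , p)))
  φ₀-kept {n} p = go (proj₂ (φ₀ (n , p)))
    where
    -- `Kept` evaluates the switching at `head a`, which is only propositionally equal to `n`.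
    go : ∀ {n′} → n′ ≡ n → (p′ : label n′ ≡ par) → proj₁ (φ₀ (n′ , p′)) ≡ proj₁ (φ₀ (n , p))
    go refl p′ = cong (λ p → proj₁ (φ₀ (n , p))) (uip p′ p)

  module _ {k} (st : State k) where
    open State st

    kept-arc : ∀ {a P} → switchedHead φ₀ a ≡ inj₁ (head a) → P (inj₁ a) →
               Linked P (inj₁ (tail a)) (inj₁ (head a))
    kept-arc {a} eq p = fwd (inj₁ a , p , refl , eq) ◅ ε⋆

    tensStep : ∀ {i} → ¬ T (done i) → label (proj₁ (rp i)) ≡ tens →
               (∀ a → head a ≡ proj₁ (rp i) → ∀ t → Done (tail a , t)) →
               ∃[ k′ ] k′ < k × State k′
    tensStep {i} ¬d lab ready = _ , Merge.k′<k mg , Extend.state st S? mg new linked′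
      where
      n = proj₁ (rp i)
      B = tens-binary {n} lab
      open Binary B
      core-of : ∀ {a} → head a ≡ n → IsCore (tail a)
      core-of h = core-tail (tens-premise _ (trans (cong label h) lab))
      tl tr : Core
      tl = tail l , core-of head-l
      tr = tail r , core-of head-r
      dl : Done tl
      dl = ready l head-l _
      dr : Done tr
      dr = ready r head-r _

      kept : ∀ {a} → head a ≡ n → switchedHead φ₀ a ≡ inj₁ (head a)
      kept h = switched-¬par φ₀ λ p → contradiction (trans (sym lab) (trans (cong label (sym h)) p)) λ ()

      ¬inner : ∀ {a} → head a ≡ n → ¬ Inner (inj₁ a)
      ¬inner h (c , d) = ¬d (subst (T ∘ done) (trans (cong cl (core-≡ h)) (cl-rp i)) d)

      l≢r-class : cl tl ≢ cl tr
      l≢r-class eq = acyclic₀ (closeCycle {P} {inj₁ r} ¬r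
        (linked-map inj₁ (linked (sym eq)) ◅◅
          subst (Linked P (inj₁ (tail l))) (cong inj₁ (trans head-l (sym head-r)))
            (kept-arc {P = P} (kept head-l) (inj₂ refl)) ◅◅
          subst (λ x → Linked P (inj₁ (head r)) x) (sym (kept head-r)) ε⋆))
        where
        P : Graph.Arc G₀ → Set
        P a = Inner a ⊎ a ≡ inj₁ l
        -- `r` is not on the path through the block and `l`: its head is still pending, so it is not
        -- inner, and it differs from `l`.
        ¬r : ¬ P (inj₁ r)
        ¬r (inj₁ inner) = ¬inner head-r inner
        ¬r (inj₂ eq)    = l≢r (sym (inj₁-injective eq))

      S : Fin k → Set
      S x = x ≡ cl tl ⊎ x ≡ cl tr ⊎ x ≡ i
      S? : ∀ x → Dec (S x)
      S? x = (x Fin.≟ _) ⊎-dec ((x Fin.≟ _) ⊎-dec (x Fin.≟ _))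
      mg : Merge S
      mg = merge₃ l≢r-class (λ eq → ¬d (subst (T ∘ done) eq dl)) (λ eq → ¬d (subst (T ∘ done) eq dr))

      module L = Block (block dl)
      module Q = Block (block dr)
      apart : ∀ {x} → L.U x → ¬ Q.U x
      apart = blocks-disjoint (block dl) (block dr) λ p q → l≢r-class (trans (sym p) q)
      ¬L : ¬ L.U n
      ¬L u = ¬d (subst (T ∘ done) (trans (sym (L.core← {rp i} u)) (cl-rp i)) dl)
      ¬Q : ¬ Q.U n
      ¬Q u = ¬d (subst (T ∘ done) (trans (sym (Q.core← {rp i} u)) (cl-rp i)) dr)

      new : Block (S ∘ cl)
      new = record
        { U     = λ x → (L.U x ⊎ Q.U x) ⊎ x ≡ n
        ; seq   = seq-tens L.seq Q.seq apart lab ¬L ¬Q B (L.core→ refl) (Q.core→ refl)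
        ; core→ = λ { (inj₁ eq) → inj₁ (inj₁ (L.core→ eq))
                    ; (inj₂ (inj₁ eq)) → inj₁ (inj₂ (Q.core→ eq))
                    ; (inj₂ (inj₂ eq)) → inj₂ (cong proj₁ (single ¬d eq)) }
        ; core← = λ { (inj₁ (inj₁ u)) → inj₁ (L.core← u)
                    ; (inj₁ (inj₂ u)) → inj₂ (inj₁ (Q.core← u))
                    ; (inj₂ eq) → inj₂ (inj₂ (trans (cong cl (core-≡ eq)) (cl-rp i))) }
        ; down  = λ { (inj₁ (inj₁ u)) e → inj₁ (inj₁ (L.down u e))
                    ; (inj₁ (inj₂ u)) e → inj₁ (inj₂ (Q.down u e))
                    ; (inj₂ eq) e → contradiction (subst Erasing eq e) (proj₁ (proj₂ (rp i))) }
        }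

      P : Graph.Arc G₀ → Set
      P = Into S

      to-n : ∀ {a} (h : head a ≡ n) → Linked P (inj₁ (tail a)) (inj₁ n)
      to-n {a} h = subst (Linked P (inj₁ (tail a))) (cong inj₁ h) (kept-arc {P = P} (kept h)
        (inj₂ (a , refl , subst IsCore (sym h) (proj₂ (rp i)) ,
          inj₂ (inj₂ (trans (cong cl (core-≡ h)) (cl-rp i))))))

      hub : ∀ {x} → S (cl x) → Linked P (at x) (inj₁ n)
      hub (inj₁ eq)        = linked-map inj₁ (linked eq) ◅◅ to-n head-l
      hub (inj₂ (inj₁ eq)) = linked-map inj₁ (linked eq) ◅◅ to-n head-r
      hub (inj₂ (inj₂ eq)) with refl ← single ¬d eq = ε⋆

      linked′ : ∀ {x y} → S (cl x) → S (cl y) → Linked P (at x) (at y)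
      linked′ p q = hub p ◅◅ EqC.symmetric _ (hub q)

    parStep : ∀ {i j} → ¬ T (done i) → label (proj₁ (rp i)) ≡ par → T (done j) →
              (∀ a → head a ≡ proj₁ (rp i) → ∀ t → cl (tail a , t) ≡ j) →
              ∃[ k′ ] k′ < k × State k′
    parStep {i} {j} ¬d lab dj ready = _ , Merge.k′<k mg , Extend.state st S? mg new linked′
      where
      n = proj₁ (rp i)
      ¬en : ¬ Erasing n
      ¬en = proj₁ (proj₂ (rp i))
      B = par-binary {n} lab
      open Binary B

      S : Fin k → Set
      S x = x ≡ j ⊎ x ≡ i
      S? : ∀ x → Dec (S x)
      S? x = (x Fin.≟ _) ⊎-dec (x Fin.≟ _)
      mg : Merge S
      mg = merge₂ λ eq → ¬d (subst (T ∘ done) eq dj)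

      module K = Block (block dj)

      ErasingAbove : Node → Set
      ErasingAbove x = ∃[ b ] head b ≡ n × Erasing (tail b) × x ≼ tail b

      -- By `jump-into-⅋` the ⊥ nodes above an erasing premise jump to the tail of a core premise of
      -- `n`, and `ready` places that tail in the block. The canonical targets are thus present when
      -- the ⊥ rules are applied.
      addPremise : ∀ {V} → Seq V → (∀ {x} → K.U x → V x) → ∀ {a} → head a ≡ n →
                   Extension V (tail a) ErasingAbove
      addPremise q ⊇K {a} h with erasing? (tail a)
      ... | no ¬e = record { seq = q ; ⊇U = id ; only = inj₁
                           ; ∋n = ⊇K (K.core→ (ready a h (core-tail ¬e))) }
      ... | yes e = record
        { Extension ext hiding (only)
        ; only = Sum.map id (λ x≼ → a , h , e , x≼) ∘ Extension.only ext
        }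
        where
        targets : ∀ {x t} → x ≼ tail a → J x ≡ just t → Target _ t
        targets x≼ eq with b , hb , refl , ¬et ← jump-into-⅋ (trans (cong label h) lab)
                             (¬en ∘ subst Erasing h) e x≼ eq =
          inj₁ (⊇K (K.core→ (ready b (trans hb h) (core-tail ¬et))))
        ext = addErasing q e (tail-• a) targets

      module E₁ = Extension (addPremise K.seq id head-l)
      module E₂ = Extension (addPremise E₁.seq E₁.⊇U head-r)

      only : ∀ {x} → E₂.V x → K.U x ⊎ ErasingAbove x
      only v = [ E₁.only , inj₂ ]′ (E₂.only v)

      ¬n : ¬ E₂.V n
      ¬n v with only v
      ... | inj₁ u = ¬d (subst (T ∘ done) (trans (sym (K.core← {rp i} u)) (cl-rp i)) dj)
      ... | inj₂ (b , h , e , x≼) = ¬en (≼-erasing x≼ e)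

      ∋premise : ∀ {a} → head a ≡ n → E₂.V (tail a)
      ∋premise h with cover _ h
      ... | inj₁ refl = E₂.⊇U E₁.∋n
      ... | inj₂ refl = E₂.∋n

      new : Block (S ∘ cl)
      new = record
        { U     = λ x → E₂.V x ⊎ x ≡ n
        ; seq   = seq-par E₂.seq lab ¬n B (∋premise head-l) (∋premise head-r)
        ; core→ = λ { (inj₁ eq) → inj₁ (E₂.⊇U (E₁.⊇U (K.core→ eq)))
                    ; (inj₂ eq) → inj₂ (cong proj₁ (single ¬d eq)) }
        ; core← = λ { {x} (inj₁ v) → [ inj₁ ∘ K.core← ,
                      (λ (b , h , e , x≼) → contradiction (≼-erasing x≼ e) (proj₁ (proj₂ x))) ]′ (only v)
                    ; (inj₂ eq) → inj₂ (trans (cong cl (core-≡ eq)) (cl-rp i)) }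
        ; down  = down
        }
        where
        -- An erasing node added on the way to a premise `b` of `n` has a single conclusion. It
        -- leads to `n`, to `tail b`, or to a node above `tail b`, all of which are now in the
        -- block.
        down : ∀ {a} → E₂.V (tail a) ⊎ tail a ≡ n → Erasing (tail a) → E₂.V (head a) ⊎ head a ≡ n
        down (inj₂ eq) e = contradiction (subst Erasing eq e) ¬en
        down {a} (inj₁ v) e with only v
        ... | inj₁ u = inj₁ (E₂.⊇U (E₁.⊇U (K.down u e)))
        ... | inj₂ (b , h , eb , inj₁ eq) with refl ← erasing-conclusions-≡ e (sym eq) = inj₂ h
        ... | inj₂ (b , h , eb , inj₂ [ c , tc , hc ]⁺) with refl ← erasing-conclusions-≡ e tc =
          inj₁ (subst E₂.V (sym hc) (∋premise h))
        ... | inj₂ (b , h , eb , inj₂ ((c , tc , refl) ∷ p)) with refl ← erasing-conclusions-≡ e tc =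
          inj₁ (up-≼ E₂.seq (inj₂ p) (∋premise h))

      P : Graph.Arc G₀ → Set
      P = Into S

      -- In `G₀` only the premise kept by `φ₀` reaches `n`. Its tail is core because `φ₀` avoids
      -- erasing premises, so by `ready` it links the block to `n`.
      s : Arc
      s = proj₁ (φ₀ (n , lab))
      hs : head s ≡ n
      hs = proj₂ (φ₀ (n , lab))
      ts : Core
      ts = tail s , core-tail (φ₀.φ-avoids lab ¬en)

      hub : ∀ {x} → S (cl x) → Linked P (at x) (inj₁ n)
      hub (inj₂ eq) with refl ← single ¬d eq = ε⋆
      hub (inj₁ eq) = linked-map inj₁ (linked {y = ts} (trans eq (sym (ready s hs _)))) ◅◅
        subst (Linked P (at ts)) (cong inj₁ hs) (kept-arc {P = P} (switched-kept φ₀ (φ₀-kept lab))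
          (inj₂ (s , refl , subst IsCore (sym hs) (proj₂ (rp i)) ,
            inj₂ (trans (cong cl (core-≡ hs)) (cl-rp i)))))

      linked′ : ∀ {x y} → S (cl x) → S (cl y) → Linked P (at x) (at y)
      linked′ p q = hub p ◅◅ EqC.symmetric _ (hub q)

  -- Progress: a further merge or a block containing all core nodes

  core-any? : ∀ {n} {P : IsCore n → Set} → (∀ c → Dec (P c)) → Dec (∃ P)
  core-any? {n} P? with core? n
  ... | yes c = map′ (c ,_) proj₂ (P? c)
  ... | no ¬c = no (¬c ∘ proj₁)

  core-all? : ∀ {n} {P : IsCore n → Set} → (∀ c → Dec (P c)) → Dec (∀ c → P c)
  core-all? {n} {P} P? with core? n
  ... | yes c = map′ (λ (p : P c) _ → p) (λ p → p c) (P? c)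
  ... | no ¬c = yes λ c → contradiction c ¬c

  -- The vertex that excludes `k = 0` in the counting argument. It is `m` or, if `m` is a • node,
  -- the tail of its premise, which is non-erasing along with `m`.
  some-core : Core
  some-core with label m ≟ᴸ •
  ... | no ¬b = m , ¬em , ¬b
  ... | yes b with a , refl ← •-premise b = tail a , core-tail (¬em ∘ •-erasing b)

  Spanning : Set₁
  Spanning = Σ[ U ∈ (Node → Set) ] Seq U × (∀ (x : Core) → U (proj₁ x))

  module _ {k} (st : State k) where
    open State st

    ReadyTens ReadyPar Closed : Fin k → Set
    Missing Exit : Fin k → Set
    AllFrom : Fin k → Fin k → Set

    Missing i   = ∃[ a ] head a ≡ proj₁ (rp i) × Σ[ t ∈ IsCore (tail a) ] ¬ Done (tail a , t)
    ReadyTens i = ¬ T (done i) × label (proj₁ (rp i)) ≡ tens × ¬ Missing i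
    AllFrom i j = ∀ a → head a ≡ proj₁ (rp i) → ∀ t → cl (tail a , t) ≡ j
    ReadyPar i  = ¬ T (done i) × label (proj₁ (rp i)) ≡ par × ∃[ j ] T (done j) × AllFrom i j
    Exit j      = ∃[ a ] Σ[ t ∈ IsCore (tail a) ] cl (tail a , t) ≡ j ×
                  label (head a) ≡ tens × Σ[ h ∈ IsCore (head a) ] ¬ Done (head a , h)
    Closed j    = T (done j) × ¬ Exit j

    missing? : ∀ i → Dec (Missing i)
    missing? i = finite-any? arcs λ a → (head a ≟ᴺ _) ×-dec core-any? λ t → ¬? (T? _)

    readyTens? : ∀ i → Dec (ReadyTens i)
    readyTens? i = ¬? (T? _) ×-dec (label _ ≟ᴸ tens) ×-dec ¬? (missing? i)

    readyPar? : ∀ i → Dec (ReadyPar i)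
    readyPar? i = ¬? (T? _) ×-dec (label _ ≟ᴸ par) ×-dec Fin.any? λ j → T? _ ×-dec
      finite-all? arcs λ a → (head a ≟ᴺ _) →-dec core-all? λ t → cl _ Fin.≟ j

    exit? : ∀ j → Dec (Exit j)
    exit? j = finite-any? arcs λ a → core-any? λ t → (cl _ Fin.≟ j) ×-dec
      (label _ ≟ᴸ tens) ×-dec core-any? λ h → ¬? (T? _)

    closed? : ∀ j → Dec (Closed j)
    closed? j = T? _ ×-dec ¬? (exit? j)

    -- If no ⅋ node can be absorbed, the premises from a closed block can all be switched off.
    closed-spanning : (∀ i → ¬ ReadyPar i) → ∀ {j} → Closed j → Spanning
    closed-spanning noPar {j} (dj , ¬exit) = U , seq , λ x → core→ (in-j x)
      where
      open Block (block dj)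

      P : Arc → Set
      P a = Σ[ t ∈ IsCore (tail a) ] cl (tail a , t) ≡ j
      module φⱼ = Avoiding P (λ a → core-any? λ t → cl _ Fin.≟ j)

      s : Core → Bool
      s x = ⌊ cl x Fin.≟ j ⌋

      -- By `up-class` an arc from class `j` to another class has a pending head. A ⊗ head would be
      -- an exit. At a ⅋ head, `φⱼ` keeps an arc from `j` only if every premise is erasing or comes
      -- from `j`, and then the ⅋ node could be absorbed.
      not-from-j : ∀ {a} → Kept φⱼ.φ a → ∀ t h → cl (head a , h) ≢ j → cl (tail a , t) ≢ j
      not-from-j {a} kept t h h≢j t≡j with T? (done (cl (head a , h)))
      ... | yes d = h≢j (trans (sym (up-class t h d)) t≡j)
      ... | no ¬d = [ (λ l → ¬exit (a , t , t≡j , trans (cong label at-rp) l , h , ¬d)) , by-par ]′ (joint ¬d)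
        where
        at-rp : head a ≡ proj₁ (rp (cl (head a , h)))
        at-rp = cong proj₁ (single ¬d refl)
        by-par : ¬ label (proj₁ (rp (cl (head a , h)))) ≡ par
        by-par l = noPar _ (¬d , l , j , dj , λ b hb t′ →
          from-j t′ (φⱼ.φ-forced p (kept p) (t , t≡j) b (trans hb (sym at-rp))))
          where
          p = trans (cong label at-rp) l
          from-j : ∀ {b} t′ → Erasing (tail b) ⊎ P b → cl (tail b , t′) ≡ j
          from-j t′ (inj₁ e)        = contradiction e (proj₁ t′)
          from-j t′ (inj₂ (_ , eq)) = eq

      s-kept : ∀ {a} → Kept φⱼ.φ a → ∀ t h → s (tail a , t) ≡ s (head a , h)
      s-kept {a} kept t h with cl (tail a , t) Fin.≟ j | cl (head a , h) Fin.≟ j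
      ... | yes _ | yes _ = refl
      ... | no _  | no _  = refl
      ... | yes p | no q  = contradiction p (not-from-j kept t h q)
      ... | no p  | yes q = contradiction (trans (up-class t h (subst (T ∘ done) (sym q) dj)) q) p

      -- `s` is constant by connectedness, and true at the representative of `j`.
      in-j : ∀ x → cl x ≡ j
      in-j x with cl x Fin.≟ j
        | kept-invariant-constant φⱼ.φ φⱼ.φ-avoids s s-kept jumpFree correct x (rp j)
      ... | yes p | _ = p
      ... | no p  | eq with cl (rp j) Fin.≟ j
      ...   | no ¬p = contradiction (cl-rp j) ¬p
      in-j x | no p | () | yes _

    record Pick (i : Fin k) : Set where
      field
        arc   : Arc
        t     : IsCore (tail arc)
        h     : IsCore (head arc)
        kept  : Kept φ₀ arc
        fresh : ¬ Done (head arc , h)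
        owner : (cl (head arc , h) ≡ i × ¬ T (done i) × (label (head arc) ≡ tens → ¬ Done (tail arc , t))) ⊎
                (cl (tail arc , t) ≡ i × T (done i) × label (head arc) ≡ tens)

    -- The arc determines its owner. An arc into a pending ⊗ node is picked by its head if its tail
    -- is pending, and by the class of its tail if that is a block; an arc into a ⅋ node is picked
    -- by its head only.
    pick-injective : ∀ {i j} (p : Pick i) (q : Pick j) → Pick.arc p ≡ Pick.arc q → i ≡ j
    pick-injective p q refl with Pick.owner p | Pick.owner q
    ... | inj₁ (eq , _) | inj₁ (eq′ , _) = trans (sym eq) eq′
    ... | inj₂ (eq , _) | inj₂ (eq′ , _) = trans (sym eq) eq′
    ... | inj₁ (_ , _ , ¬d) | inj₂ (eq , d , l) = contradiction (subst (T ∘ done) (sym eq) d) (¬d l)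
    ... | inj₂ (eq , d , l) | inj₁ (_ , _ , ¬d) = contradiction (subst (T ∘ done) (sym eq) d) (¬d l)

    tens-kept : ∀ {a} → label (head a) ≡ tens → Kept φ₀ a
    tens-kept l p = contradiction (trans (sym l) p) λ ()

    pick : (∀ i → ¬ ReadyTens i) → (∀ i → ¬ Closed i) → ∀ i → Pick i
    pick noTens noClosed i with T? (done i)
    ... | yes d with a , t , eq , l , h , ¬d ← decidable-stable (exit? i) (λ ¬exit → noClosed i (d , ¬exit)) =
      record { arc = a ; t = t ; h = h ; kept = tens-kept l ; fresh = ¬d ; owner = inj₂ (eq , d , l) }
    ... | no ¬d with joint ¬d
    ...   | inj₁ l with a , h , t , ¬dt ← decidable-stable (missing? i) (λ ¬miss → noTens i (¬d , l , ¬miss)) =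
      record { arc = a ; t = t ; h = subst IsCore (sym h) (proj₂ (rp i)) ; kept = tens-kept (trans (cong label h) l)
             ; fresh = ¬d ∘ subst (T ∘ done) (cl-h h) ; owner = inj₁ (cl-h h , ¬d , λ _ → ¬dt) }
      where
      cl-h : ∀ {a} (h : head a ≡ proj₁ (rp i)) {c} → cl (head a , c) ≡ i
      cl-h h = trans (cong cl (core-≡ h)) (cl-rp i)
    ...   | inj₂ l = record
      { arc = proj₁ (φ₀ (n , l)) ; t = core-tail (φ₀.φ-avoids l (proj₁ (proj₂ (rp i))))
      ; h = subst IsCore (sym h) (proj₂ (rp i)) ; kept = φ₀-kept l
      ; fresh = ¬d ∘ subst (T ∘ done) cl-h
      ; owner = inj₁ (cl-h , ¬d , λ l′ → contradiction (trans (sym l) (trans (cong label (sym h)) l′)) λ ()) }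
      where
      n = proj₁ (rp i)
      h = proj₂ (φ₀ (n , l))
      cl-h : ∀ {c} → cl (_ , c) ≡ i
      cl-h = trans (cong cl (core-≡ h)) (cl-rp i)

    not-stuck : (∀ i → ¬ ReadyTens i) → ¬ (∀ i → ¬ Closed i)
    not-stuck noTens noClosed = acyclic₀ (tooManyArcs at (map (inj₁ ∘ arc) (allFin k)) cl {Inner}
      (λ _ _ → linked)
      (Uniqueₚ.map⁺ (λ {i} {j} eq → pick-injective (picks i) (picks j) (inj₁-injective eq)) (Uniqueₚ.allFin⁺ k))
      (Allₚ.map⁺ (All.tabulate λ {i} _ (h , d) → Pick.fresh (picks i) d))
      (Allₚ.map⁺ (All.tabulate λ {i} _ → (_ , Pick.t (picks i)) , (_ , Pick.h (picks i)) , refl ,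
        sym (switched-kept φ₀ (Pick.kept (picks i)))))
      (ℕ.≤-reflexive (sym (trans (length-map _ (allFin k)) (length-tabulate {n = k} id))))
      some-core)
      where
      picks = pick noTens noClosed
      arc : Fin k → Arc
      arc i = Pick.arc (picks i)

    progress : (∃[ k′ ] k′ < k × State k′) ⊎ Spanning
    progress with Fin.any? readyTens?
    ... | yes (i , ¬d , l , ¬miss) = inj₁ (tensStep st ¬d l λ a h t →
            decidable-stable (T? _) λ ¬dt → ¬miss (a , h , t , ¬dt))
    ... | no noTens with Fin.any? readyPar?
    ...   | yes (i , ¬d , l , j , dj , from) = inj₁ (parStep st ¬d l dj from)
    ...   | no noPar with Fin.any? closed?
    ...     | yes (j , c)  = inj₂ (closed-spanning (λ i r → noPar (i , r)) c)
    ...     | no noClosed = contradiction (λ i c → noClosed (i , c)) (not-stuck λ i r → noTens (i , r))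

  run : ∀ {k} → Acc _<_ k → State k → Spanning
  run (acc rec) st with progress st
  ... | inj₁ (k′ , k′<k , st′) = run (rec k′<k) st′
  ... | inj₂ spanning = spanning

  -- Initial state and addition of the remaining erasing nodes

  initial : ∃ State
  initial = _ , record
    { cl     = λ (n , c) → proj₁ (at-sur n c)
    ; rp     = λ i → E.at i , at-P i
    ; cl-rp  = λ i → at-inj (proj₂ (at-sur (E.at i) (at-P i)))
    ; done   = λ i → ⌊ initial? (label (E.at i)) ⌋
    ; block  = λ {i} d → singleton i (toWitness d)
    ; joint  = λ {i} ¬d → binary-label (λ p → ¬d (fromWitness p)) (at-P i)
    ; single = λ _ eq → single eq
    ; linked = λ {x} {y} eq → subst (Linked _ (at x) ∘ at) (trans (single {x} eq) (sym (single {y} refl))) ε⋆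
    }
    where
    module E = Enumeration (enumerate core? nodes)
    open E using (at-sur; at-inj; at-P)

    initial? : ∀ l → Dec (l ≡ ax ⊎ l ≡ one)
    initial? l = (l ≟ᴸ ax) ⊎-dec (l ≟ᴸ one)

    single : ∀ {x : Core} {i} → proj₁ (at-sur (proj₁ x) (proj₂ x)) ≡ i → x ≡ (E.at i , at-P i)
    single {n , c} refl = core-≡ (sym (proj₂ (at-sur n c)))

    binary-label : ∀ {n} → ¬ (label n ≡ ax ⊎ label n ≡ one) → IsCore n → label n ≡ tens ⊎ label n ≡ par
    binary-label {n} ¬i (¬e , ¬b) with label n in eq
    ... | ax   = contradiction (inj₁ refl) ¬i
    ... | one  = contradiction (inj₂ refl) ¬i
    ... | tens = inj₁ refl
    ... | par  = inj₂ refl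
    ... | •    = contradiction refl ¬b
    ... | bot  = contradiction (erasing-bot eq) ¬e

    singleton : ∀ i → label (E.at i) ≡ ax ⊎ label (E.at i) ≡ one →
                Block (λ x → proj₁ (at-sur (proj₁ x) (proj₂ x)) ≡ i)
    singleton i l = record
      { U     = _≡ E.at i
      ; seq   = [ seq-ax , seq-one ]′ l
      ; core→ = λ {x} eq → cong proj₁ (single {x} eq)
      ; core← = λ { {x} refl → at-inj (proj₂ (at-sur (proj₁ x) (proj₂ x))) }
      ; down  = λ eq e → contradiction (subst Erasing eq e) (proj₁ (at-P i))
      }

  spanning : Spanning
  spanning = run (<-wellFounded _) (proj₂ initial)

  -- With all core nodes present, every non-erasing node is an available target: it is core, or a •
  -- node whose premise leaves a core node. By `jump-nonErasing` this covers all jumps, so the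
  -- erasing nodes can be added in any order.
  addAllErasing : ∀ {U} → Seq U → (∀ (x : Core) → U (proj₁ x)) → (ns : List Node) →
                  Σ[ V ∈ (Node → Set) ] Seq V × (∀ {x} → U x → V x) ×
                  (∀ {n} → n ∈ ns → Erasing n → label n ≢ • → V n)
  addAllErasing q cores [] = _ , q , id , λ ()
  addAllErasing q cores (n ∷ ns) with V , q′ , ⊇U , rest ← addAllErasing q cores ns
    with erasing? n | label n ≟ᴸ •
  ... | no ¬e | _     = V , q′ , ⊇U , λ { (here refl) e → contradiction e ¬e ; (there i) → rest i }
  ... | yes _ | yes b = V , q′ , ⊇U , λ { (here refl) _ ¬b → contradiction b ¬b ; (there i) → rest i }
  ... | yes e | no ¬b = E.V , E.seq , E.⊇U ∘ ⊇U , λ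
      { (here refl) _ _ → E.∋n ; (there i) e ¬b → E.⊇U (rest i e ¬b) }
    where
    targets : ∀ {x t} → x ≼ n → J x ≡ just t → Target V t
    targets {t = t} _ eq with ¬et ← jump-nonErasing eq | label t ≟ᴸ •
    ... | no ¬b = inj₁ (⊇U (cores (t , ¬et , ¬b)))
    ... | yes b with a , refl ← •-premise b =
      inj₂ (b , a , refl , ⊇U (cores (tail a , core-tail (¬et ∘ •-erasing b))))
    module E = Extension (addErasing q′ e ¬b targets)

  sequentializable : ∃[ Γ ] Σ[ π ∈ ⊢ Γ ] π |⇒ record structure { jump = J }
  sequentializable with U , q , cores ← spanning
    with V , q′ , ⊇U , erasings ← addAllErasing q cores (map (Inverse.from nodes) (allFin #nodes)) =
    seq-total q′ all
    where
    all : ∀ n → label n ≢ • → V n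
    all n ¬b with erasing? n
    ... | no ¬e = ⊇U (cores (n , ¬e , ¬b))
    ... | yes e = erasings (subst (_∈ _) (Inverse.strictlyInverseʳ nodes n)
                    (∈-map⁺ (Inverse.from nodes) (∈-allFin (Inverse.to nodes n)))) e ¬b

theorem62 : (𝒜 : Atoms) (R : ProofStructure 𝒜) →
    let open ProofStructure R in
    JumpFree → ACC#w → (m : Node) → ¬ Erasing m →
    ∃[ Γ ] Σ[ π ∈ ⊢ Γ ] π |⇒ ProofStructure.structure (⟨ R ⟩ʷ m)
theorem62 𝒜 R jumpFree correct m ¬em =
  Construction.sequentializable R jumpFree correct m ¬em
    (proj₁ (ProofStructure.canonicalJump R m)) (proj₂ (ProofStructure.canonicalJump R m))
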